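{- For any $m \ge 1$, there is a quantile estimation algorithm that uses $O(m)$ words of memory and incurs zero error (i.e., returns exactly the $k$-th largest element) with probability at least \[ 1 - 12\lfloor\log_2 k\rfloor\cdot\exp\left(-\frac{m}{12}\right) - 2\sum_{i=0}^{\lfloor\log_2 k\rfloor-1}\exp\left(-\frac{m^2}{32(k/2^i)}\right). \]
   Context: Quantile estimation: Let $x_1 > \cdots > x_n$ be distinct numbers unknown to the algorithm. The algorithm takes $n$ and $k$ ($1\le k\le n$) as inputs, reads a uniformly random permutation of the $n$ numbers one by one, and outputs some $x^*\in\{x_1,\dots,x_n\}$. Its error is $|\mathrm{Rank}(x^*) - k|$, where $\mathrm{Rank}(x^*) = |\{j : x_j\ge x^*\}|$. The probability is over the random permutation and the algorithm's randomness. Memory model: word RAM, where each word can store either an integer of magnitude $\mathrm{poly}(n)$ or one element of the stream. Memory usage is the number of words used. -}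

module Defs where

open import Algebra.Definitions.RawSemiring using () renaming (_^_ to pow)
open import Data.Bool.Base using (Bool; true; false; if_then_else_)
open import Data.Fin.Base as Fin using (Fin; toℕ; fromℕ<)
open import Data.Integer.Base as ℤ using (ℤ; +_; -[1+_])
import Data.Integer.DivMod as ℤ
open import Data.List.Base as List
  using (List; []; _∷_; _++_; length; map; concatMap; filter; drop; head; upTo; tabulate)
open import Data.List.Membership.Propositional using (_∈_)
open import Data.List.Membership.Propositional.Properties
  using (∈-∃++; ∈-map⁺; ∈-concatMap⁺)
open import Data.List.Properties using (length-++; length-map)
open import Data.List.Relation.Binary.Permutation.Propositional
  using (_↭_; ↭-sym; ↭-trans)
open import Data.List.Relation.Binary.Permutation.Propositional.Properties
  using (↭-empty-inv; ↭-length; ∈-resp-↭; shift; drop-∷)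
open import Data.List.Relation.Unary.All as All using (All; []; _∷_)
open import Data.List.Relation.Unary.Any as Any using (here; there)
open import Data.Maybe.Base as Maybe using (Maybe; just; nothing; _>>=_)
open import Data.Nat.Base as ℕ using (ℕ; zero; suc; _!; NonZero)
import Data.Nat.Properties as ℕ
open import Data.Nat.Logarithm using (⌊log₂_⌋)
open import Data.Product.Base using (∃-syntax; _×_; _,_)
open import Data.Rational.Base as ℚ using (ℚ; 0ℚ; 1ℚ)
open import Data.Rational.Properties using (+-*-rawSemiring)
open import Data.Sum.Base using (_⊎_; inj₁; inj₂)
open import Data.Vec.Base as Vec using (Vec; []; _∷_)
open import Data.Vec.Functional using (Vector)
open import Level using (Level; 0ℓ)
open import Relation.Binary.Bundles using (StrictTotalOrder)
import Relation.Binary.Properties.StrictTotalOrder as STOProperties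
open import Relation.Binary.PropositionalEquality
  using (_≡_; refl; trans; cong; cong₂)
open import Relation.Nullary.Decidable using (does; yes; no)

private
  variable
    a p : Level
    A B : Set a

-- Real numbers are given by rational sequences converging to them, with
-- pointwise arithmetic.  For convergent sequences, s ≤ᴿ t says lim s ≤ lim t.

ℝ : Set
ℝ = ℕ → ℚ

fromℚ : ℚ → ℝ
fromℚ q _ = q

fromℕ : ℕ → ℝ
fromℕ n = fromℚ (+ n ℚ./ 1)

infixl 6 _+ᴿ_ _-ᴿ_
infixl 7 _*ᴿ_
infix  4 _≤ᴿ_

_+ᴿ_ _-ᴿ_ _*ᴿ_ : ℝ → ℝ → ℝ
(s +ᴿ t) N = s N ℚ.+ t N
(s -ᴿ t) N = s N ℚ.- t N
(s *ᴿ t) N = s N ℚ.* t N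

_≤ᴿ_ : ℝ → ℝ → Set
s ≤ᴿ t = (ε : ℚ) → 0ℚ ℚ.< ε →
  ∃[ N₀ ] ((N : ℕ) → N₀ ℕ.≤ N → s N ℚ.≤ t N ℚ.+ ε)

sumℚ : List ℚ → ℚ
sumℚ = List.foldr ℚ._+_ 0ℚ

sumᴿ : List ℝ → ℝ
sumᴿ = List.foldr _+ᴿ_ (fromℚ 0ℚ)

-- The power series of the exponential: t ↦ (Σ_{j ≤ N} tʲ / j!)_N.

exp : ℚ → ℝ
exp t N = sumℚ (map term (upTo (suc N)))
  where
  term : ℕ → ℚ
  term j = pow +-*-rawSemiring t j ℚ.* ((+ 1 ℚ./ (j !)) {{j ℕ.!≢0}})

-- m² / (32 (k / 2ⁱ)), where the division of k by 2ⁱ is exact.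

exponent : (m k i : ℕ) .{{_ : NonZero k}} → ℚ
exponent m k i = (+ (m ℕ.^ 2 ℕ.* 2 ℕ.^ i) ℚ./ (32 ℕ.* k)) {{ℕ.m*n≢0 32 k}}

bound : (m k : ℕ) .{{_ : NonZero k}} → ℝ
bound m k =
  fromℕ 1
  -ᴿ fromℕ 12 *ᴿ fromℕ ⌊log₂ k ⌋ *ᴿ exp (ℚ.- (+ m ℚ./ 12))
  -ᴿ fromℕ 2 *ᴿ sumᴿ (map (λ i → exp (ℚ.- exponent m k i)) (upTo ⌊log₂ k ⌋))

data Rand (A : Set a) : Set a where
  return  : A → Rand A
  uniform : (n : ℕ) .{{_ : NonZero n}} → (Fin n → Rand A) → Rand A

bind : Rand A → (A → Rand B) → Rand B
bind (return x)    f = f x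
bind (uniform n c) f = uniform n λ j → bind (c j) f

Pr : (A → Bool) → Rand A → ℚ
Pr E (return x)    = if E x then 1ℚ else 0ℚ
Pr E (uniform n c) = sumℚ (tabulate λ j → Pr E (c j)) ℚ.* (+ 1 ℚ./ n)

-- P holds for every outcome of the random choices.

Surely : (A → Set p) → Rand A → Set p
Surely P (return x)    = P x
Surely P (uniform n c) = (j : Fin n) → Surely P (c j)

-- The list of all orderings.  By length-orderings and orderings-complete a
-- list of n distinct elements has each of its n ! orderings here exactly once.

insertions : A → List A → List (List A)
insertions x []       = (x ∷ []) ∷ []
insertions x (y ∷ ys) = (x ∷ y ∷ ys) ∷ map (y ∷_) (insertions x ys)

orderings : List A → List (List A)
orderings []       = [] ∷ []
orderings (x ∷ xs) = concatMap (insertions x) (orderings xs)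

module _ {A : Set a} where

  length-insertions : (x : A) (ys : List A) →
                      length (insertions x ys) ≡ suc (length ys)
  length-insertions x []       = refl
  length-insertions x (y ∷ ys) =
    cong suc (trans (length-map (y ∷_) (insertions x ys)) (length-insertions x ys))

  insertions-lengths : (x : A) (ys : List A) →
    All (λ zs → length zs ≡ suc (length ys)) (insertions x ys)
  insertions-lengths x []       = refl ∷ []
  insertions-lengths x (y ∷ ys) = refl ∷ go (insertions-lengths x ys)
    where
    go : ∀ {zss} → All (λ zs → length zs ≡ suc (length ys)) zss →
         All (λ zs → length zs ≡ suc (suc (length ys))) (map (y ∷_) zss)
    go []       = []
    go (e ∷ es) = cong suc e ∷ go es

  private
    all-++ : ∀ {P : List A → Set} {xss yss} → All P xss → All P yss → All P (xss ++ yss)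
    all-++ []       qs = qs
    all-++ (p ∷ ps) qs = p ∷ all-++ ps qs

    concat-lengths : (x : A) (n : ℕ) (xss : List (List A)) →
      All (λ zs → length zs ≡ n) xss →
      All (λ zs → length zs ≡ suc n) (concatMap (insertions x) xss)
      × length (concatMap (insertions x) xss) ≡ length xss ℕ.* suc n
    concat-lengths x n []         []         = [] , refl
    concat-lengths x _ (ys ∷ xss) (refl ∷ es) with concat-lengths x (length ys) xss es
    ... | as , e =
      all-++ (insertions-lengths x ys) as ,
      trans (length-++ (insertions x ys)) (cong₂ ℕ._+_ (length-insertions x ys) e)

    orderings-lengths : (xs : List A) →
      All (λ zs → length zs ≡ length xs) (orderings xs)
      × length (orderings xs) ≡ length xs !
    orderings-lengths []       = refl ∷ [] , refl
    orderings-lengths (x ∷ xs) with orderings-lengths xs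
    ... | as , e with concat-lengths x (length xs) (orderings xs) as
    ... | as′ , e′ = as′ ,
      trans e′ (trans (cong (ℕ._* suc (length xs)) e)
                      (ℕ.*-comm (length xs !) (suc (length xs))))

  length-orderings : (xs : List A) → length (orderings xs) ≡ length xs !
  length-orderings xs = let _ , e = orderings-lengths xs in e

  private
    ∈-insertions : (x : A) (as bs : List A) → as ++ x ∷ bs ∈ insertions x (as ++ bs)
    ∈-insertions x []       []       = here refl
    ∈-insertions x []       (b ∷ bs) = here refl
    ∈-insertions x (a ∷ as) bs       = there (∈-map⁺ (a ∷_) (∈-insertions x as bs))

  orderings-complete : (xs : List A) {ys : List A} → ys ↭ xs → ys ∈ orderings xs
  orderings-complete [] p with ↭-empty-inv p
  ... | refl = here refl
  orderings-complete (x ∷ xs) p with ∈-∃++ (∈-resp-↭ (↭-sym p) (here refl))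
  ... | as , bs , refl =
    ∈-concatMap⁺ (insertions x)
      (Any.map (λ { refl → ∈-insertions x as bs })
        (orderings-complete xs (drop-∷ (↭-trans (↭-sym (shift x as bs)) p))))

-- A word RAM.  All data live in numbered memory cells, each holding one word;
-- programs may contain integer literals.

data Place : Set where
  cell    : ℕ → Place   -- the cell with this address
  cell[_] : ℕ → Place   -- the cell whose address is stored in the given cell

data Operand : Set where
  lit : ℤ → Operand
  val : Place → Operand

data ArithOp : Set where
  add sub mul div : ArithOp

data Instr : Set where
  copy   : Place → Operand → Instr
  arith  : ArithOp → Place → Operand → Operand → Instr
  random : Place → Operand → Instr              -- uniform in {0, …, v - 1}
  read   : Place → Instr                        -- next element of the stream
  jump<  : Operand → Operand → ℕ → Instr        -- jump if u < v
  output : Operand → Instr                      -- output a stream element and halt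

record Algorithm : Set where
  field
    spare : ℕ
    code  : List Instr

  words : ℕ
  words = 2 ℕ.+ spare

-- The magnitude of integers that fit into a word on inputs of length n.
-- Every polynomial in n ≥ 1 is dominated by one of these.

wordBound : (d n : ℕ) → ℕ
wordBound d n = suc d ℕ.* n ℕ.^ suc d

module Machine (O : StrictTotalOrder 0ℓ 0ℓ 0ℓ) (W : ℕ) where

  open StrictTotalOrder O using (Carrier; _<?_)

  data Word : Set where
    int  : ℤ → Word
    elem : Carrier → Word

  record Config (s : ℕ) : Set where
    constructor config
    field
      pc     : ℕ
      mem    : Vec Word s
      stream : List Carrier

  -- In all of the following, nothing stands for a fault.

  address : ∀ {s} → Word → Maybe (Fin s)
  address {s} (int (+ i)) with i ℕ.<? s
  ... | yes i<s = just (fromℕ< i<s)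
  ... | no  _   = nothing
  address (int -[1+ _ ]) = nothing
  address (elem _)       = nothing

  locate : ∀ {s} → Vec Word s → Place → Maybe (Fin s)
  locate mem (cell i)    = address (int (+ i))
  locate mem (cell[ i ]) = address (int (+ i)) >>= λ j → address (Vec.lookup mem j)

  eval : ∀ {s} → Vec Word s → Operand → Maybe Word
  eval mem (lit z) = just (int z)
  eval mem (val q) = Maybe.map (Vec.lookup mem) (locate mem q)

  fits : Word → Bool
  fits (int z)  = ℤ.∣ z ∣ ℕ.≤ᵇ W
  fits (elem _) = true

  store : ∀ {s} → Vec Word s → Place → Word → Maybe (Vec Word s)
  store mem q w with fits w
  ... | true  = Maybe.map (λ i → mem Vec.[ i ]≔ w) (locate mem q)
  ... | false = nothing

  compute : ArithOp → Word → Word → Maybe Word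
  compute add (int y) (int z)            = just (int (y ℤ.+ z))
  compute sub (int y) (int z)            = just (int (y ℤ.- z))
  compute mul (int y) (int z)            = just (int (y ℤ.* z))
  compute div (int y) (int (+ 0))        = nothing
  compute div (int y) (int z@(+ suc _))  = just (int (y ℤ./ z))
  compute div (int y) (int z@(-[1+ _ ])) = just (int (y ℤ./ z))
  compute _   _       _                  = nothing

  -- Stream elements are accessible only through comparisons.

  less : Word → Word → Maybe Bool
  less (int y)  (int z)  = just (does (y <?ℤ z))
    where open import Data.Integer.Properties using () renaming (_<?_ to _<?ℤ_)
  less (elem y) (elem z) = just (does (y <? z))
  less _        _        = nothing

  module _ {s : ℕ} where

    private
      Result : Set
      Result = Maybe (Config s ⊎ Carrier)

    execute : Instr → Config s → Rand Result
    execute (copy q u) (config pc mem xs) = return (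
      eval mem u >>= λ w → store mem q w >>= λ mem′ →
      just (inj₁ (config (suc pc) mem′ xs)))
    execute (arith op q u v) (config pc mem xs) = return (
      eval mem u >>= λ y → eval mem v >>= λ z → compute op y z >>= λ w →
      store mem q w >>= λ mem′ →
      just (inj₁ (config (suc pc) mem′ xs)))
    execute (random q u) (config pc mem xs) with eval mem u
    ... | just (int (+ suc n)) = uniform (suc n) λ j → return (
      store mem q (int (+ toℕ j)) >>= λ mem′ →
      just (inj₁ (config (suc pc) mem′ xs)))
    ... | _ = return nothing
    execute (read q) (config pc mem []) = return nothing
    execute (read q) (config pc mem (x ∷ xs)) = return (
      store mem q (elem x) >>= λ mem′ →
      just (inj₁ (config (suc pc) mem′ xs)))
    execute (jump< u v target) (config pc mem xs) = return (
      eval mem u >>= λ y → eval mem v >>= λ z → less y z >>= λ b →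
      just (inj₁ (config (if b then target else suc pc) mem xs)))
    execute (output u) (config pc mem xs) with eval mem u
    ... | just (elem x) = return (just (inj₂ x))
    ... | _             = return nothing

    -- The program counter has to fit into a word as well.

    step : List Instr → Config s → Rand Result
    step code c with Config.pc c ℕ.≤ᵇ W | head (drop (Config.pc c) code)
    ... | true | just i = execute i c
    ... | _    | _      = return nothing

    -- The output within T steps, nothing if there is none.

    runFor : (T : ℕ) → List Instr → Config s → Rand (Maybe Carrier)
    runFor zero    code c = return nothing
    runFor (suc T) code c = bind (step code c) λ where
      nothing          → return nothing
      (just (inj₁ c′)) → runFor T code c′
      (just (inj₂ x))  → return (just x)

  initial : (alg : Algorithm) (n k : ℕ) → List Carrier → Config (Algorithm.words alg)
  initial alg n k = config 0
    (int (+ n) ∷ int (+ k) ∷ Vec.replicate (Algorithm.spare alg) (int (+ 0)))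

  run : Algorithm → (T n k : ℕ) → List Carrier → Rand (Maybe Carrier)
  run alg T n k xs = runFor T (Algorithm.code alg) (initial alg n k xs)

module Quantile (O : StrictTotalOrder 0ℓ 0ℓ 0ℓ) {n : ℕ}
                (x : Vector (StrictTotalOrder.Carrier O) n) where

  open StrictTotalOrder O using (Carrier; _<_)
  open STOProperties O using (_≤?_)

  Decreasing : Set
  Decreasing = ∀ {i j} → i Fin.< j → x j < x i

  Rank : Carrier → ℕ
  Rank y = length (filter (y ≤?_) (tabulate x))

  error : (k : ℕ) → Carrier → ℕ
  error k y = ℕ.∣ Rank y - k ∣

  zeroError : (k : ℕ) → Maybe Carrier → Bool
  zeroError k (just y) = does (error k y ℕ.≟ 0)
  zeroError k nothing  = false

  -- Words hold integers of magnitude at most wordBound d n.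

  module _ (d : ℕ) (alg : Algorithm) (T k : ℕ) where

    open Machine O (wordBound d n) using (run)

    -- Whatever the order and the random choices, some xⱼ is output within T steps.

    OutputsElement : Set
    OutputsElement = (σ : List Carrier) → σ ∈ orderings (tabulate x) →
      Surely (λ r → ∃[ j ] r ≡ just (x j)) (run alg T n k σ)

    zeroErrorProbability : ℚ
    zeroErrorProbability =
      sumℚ (map (λ σ → Pr (zeroError k) (run alg T n k σ)) (orderings (tabulate x)))
      ℚ.* ((+ 1 ℚ./ (n !)) {{n ℕ.!≢0}})

{-# OPTIONS --safe #-}

-- The algorithm keeps a buffer of elements that may still be the k-th largest.  It draws a uniformly
-- random k-subset of the positions of the stream online; the number of positions drawn so far, minus
-- the number of large elements discarded so far, is its guess (the gap) for the rank of the target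
-- within the buffer.  When a buffer of capacity 2D + 1 overflows, the maximum is discarded if the gap
-- is at least D + 2 and the minimum otherwise.  The target survives as long as the number of positions
-- drawn and the number of top-k elements read differ by at most D.
--
-- Both numbers come from independent uniform k-subsets of the n positions.  Exchanging the two subsets
-- after their counts first differ by δ = D + 1 shows, as in the reflection principle, that this happens
-- with probability C(n, k + δ) C(n, k - δ) / C(n, k)² in either direction.  For δ = 2m this vanishes if
-- k < 2m, and otherwise it is at most (k / (k + m))^m ≤ exp(-m² / (32 k)), so that the term i = 0 of the
-- bound already covers the failures.
module Submission where

-- Why a second random subset: guessing that a prefix of t elements holds k t / n of the k largest
-- would call for a concentration inequality for sampling without replacement. The drawn subset is
-- instead an independent copy of the set of positions of the k largest elements, so the two counts
-- have the same law and a reflection argument replaces all tail estimates. The exchange of subsets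
-- is never carried out as a bijection. It is encoded in `potential`, a function of the four
-- remaining counts which by Pascal's rule does not increase on average in a step and which on the
-- boundary is at least the number of all outcomes. This is counting in ℕ, over n! orders times n!
-- toss outcomes; the division by n!² comes last. A real number is a sequence here and exp(-t) an
-- alternating series, so lower bounds on it are taken from (1 - t / N)^N, which exceeds the N-th
-- partial sum by at most a constant over N. Why δ = 2m: consecutive products C(n, k + i) C(n, k -
-- i) may have a ratio near 1 for small i. After m steps the ratio is at most k / (k + m), and the
-- other m steps collect this factor m times.

open import Defs

-- Estimates for binomial coefficients and factorials in ℕ.

module Binomials where

  open import Data.Nat.Base
  open import Data.Nat.Properties
  open import Data.Nat.Combinatorics
  open import Data.Nat.DivMod using (m/n*n≡m)
  open import Data.Nat.Tactic.RingSolver using (solve-∀)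
  open import Relation.Binary.PropositionalEquality
  open import Relation.Nullary.Decidable using (yes; no)

  C-factorial : ∀ k l → ((k + l) C k) * (k ! * l !) ≡ (k + l) !
  C-factorial k l = begin
    ((k + l) C k) * (k ! * l !)              ≡⟨ cong (λ j → ((k + l) C k) * (k ! * j !)) (m+n∸m≡n k l) ⟨
    ((k + l) C k) * (k ! * (k + l ∸ k) !)
      ≡⟨ cong (_* (k ! * (k + l ∸ k) !)) (nCk≡n!/k![n-k]! (m≤m+n k l)) ⟩
    ((k + l) ! / (k ! * (k + l ∸ k) !)) * (k ! * (k + l ∸ k) !) ≡⟨ m/n*n≡m (k![n∸k]!∣n! (m≤m+n k l)) ⟩
    (k + l) !                              ∎
    where
    open ≡-Reasoning
    open import Data.Nat.DivMod using (_/_)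
    instance _ = k !* (k + l ∸ k) !≢0

  nC0≡1 : ∀ n → n C 0 ≡ 1
  nC0≡1 n = *-cancelʳ-≡ _ _ (0 ! * n !) {{0 !* n !≢0}} (trans (C-factorial 0 n)
    (sym (trans (*-identityˡ (0 ! * n !)) (*-identityˡ (n !)))))

  -- For i ≥ n both sides vanish, the right one through truncated subtraction, so the identity holds
  -- without a side condition.
  C-absorb : ∀ n i → suc i * (n C suc i) ≡ (n ∸ i) * (n C i)
  C-absorb n i with i <? n
  ... | no i≮n rewrite k>n⇒nCk≡0 (s≤s (≮⇒≥ i≮n)) | m≤n⇒m∸n≡0 (≮⇒≥ i≮n) = *-zeroʳ i
  ... | yes i<n = subst (λ n → suc i * (n C suc i) ≡ (n ∸ i) * (n C i)) (m+[n∸m]≡n i<n) (go (n ∸ suc i))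
    where
    go : ∀ l → suc i * ((suc i + l) C suc i) ≡ (suc i + l ∸ i) * ((suc i + l) C i)
    go l = *-cancelʳ-≡ _ _ (i ! * l !) {{i !* l !≢0}} (begin
      suc i * ((suc i + l) C suc i) * (i ! * l !)
        ≡⟨ l₁ (suc i) ((suc i + l) C suc i) (i !) (l !) ⟩
      ((suc i + l) C suc i) * (suc i ! * l !)               ≡⟨ C-factorial (suc i) l ⟩
      (suc i + l) !                                         ≡⟨ cong _! (+-suc i l) ⟨
      (i + suc l) !                                         ≡⟨ C-factorial i (suc l) ⟨
      ((i + suc l) C i) * (i ! * (suc l * l !))
        ≡⟨ l₂ (suc l) ((i + suc l) C i) (i !) (l !) ⟩
      suc l * ((i + suc l) C i) * (i ! * l !)               ≡⟨ cong₂ (λ a b → a * (b C i) * (i ! * l !))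
        (sym (trans (cong (_∸ i) (sym (+-suc i l))) (m+n∸m≡n i (suc l)))) (+-suc i l) ⟩
      (suc i + l ∸ i) * ((suc i + l) C i) * (i ! * l !)     ∎)
      where
      open ≡-Reasoning
      l₁ : ∀ s c a b → s * c * (a * b) ≡ c * (s * a * b)
      l₁ = solve-∀
      l₂ : ∀ s c a b → c * (a * (s * b)) ≡ s * c * (a * b)
      l₂ = solve-∀

  -- N^i - i! C(N,i) is at most i² N^(i-1), multiplied by N to avoid the predecessor.
  C-close : ∀ N i → N ^ i * N ≤ i ! * (N C i) * N + i * i * N ^ i
  C-close N zero rewrite nC0≡1 N = ≤-reflexive (l N)
    where
    l : ∀ N → 1 * N ≡ 1 * 1 * N + 0 * 0 * 1
    l = solve-∀
  C-close N (suc i) = begin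
    N * N ^ i * N                                        ≡⟨ l₁ N (N ^ i) ⟩
    N ^ i * N * N                                        ≤⟨ *-monoʳ-≤ (N ^ i * N) (m≤n+m∸n N i) ⟩
    N ^ i * N * (i + u)                                  ≡⟨ l₂ N (N ^ i) i u ⟩
    i * (N * N ^ i) + (N ^ i * N) * u
      ≤⟨ +-monoʳ-≤ (i * (N * N ^ i)) (*-monoˡ-≤ u (C-close N i)) ⟩
    i * (N * N ^ i) + (i ! * (N C i) * N + i * i * N ^ i) * u ≡⟨ l₃ N (N ^ i) i u (i !) (N C i) ⟩
    i ! * (u * (N C i)) * N + (i * i * N ^ i * u + i * (N * N ^ i))
      ≡⟨ cong (λ z → i ! * z * N + (i * i * N ^ i * u + i * (N * N ^ i))) (sym (C-absorb N i)) ⟩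
    i ! * (suc i * (N C suc i)) * N + (i * i * N ^ i * u + i * (N * N ^ i))
      ≤⟨ +-monoʳ-≤ (i ! * (suc i * (N C suc i)) * N)
      (+-monoˡ-≤ (i * (N * N ^ i)) (*-monoʳ-≤ (i * i * N ^ i) (m∸n≤m N i))) ⟩
    i ! * (suc i * (N C suc i)) * N + (i * i * N ^ i * N + i * (N * N ^ i))
      -- The error has coefficient i² + i by now; adding i + 1 completes the square (i + 1)².
      ≤⟨ m≤m+n _ (suc i * (N * N ^ i)) ⟩
    i ! * (suc i * (N C suc i)) * N + (i * i * N ^ i * N + i * (N * N ^ i)) + suc i * (N * N ^ i)
      ≡⟨ l₄ N (N ^ i) i (i !) (N C suc i) ⟩
    suc i ! * (N C suc i) * N + suc i * suc i * (N * N ^ i) ∎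
    where
    open ≤-Reasoning
    u = N ∸ i
    l₁ : ∀ N p → N * p * N ≡ p * N * N
    l₁ = solve-∀
    l₂ : ∀ N p i u → p * N * (i + u) ≡ i * (N * p) + (p * N) * u
    l₂ = solve-∀
    l₃ : ∀ N p i u f c → i * (N * p) + (f * c * N + i * i * p) * u ≡ f * (u * c) * N + (i * i * p * u +
      i * (N * p))
    l₃ = solve-∀
    l₄ : ∀ N p i f c → f * (suc i * c) * N + (i * i * p * N + i * (N * p)) + suc i * (N * p)
       ≡ (suc i * f) * c * N + suc i * suc i * (N * p)
    l₄ = solve-∀

  -- The left side is a falling factorial, with i factors of at most N each.
  C-falling : ∀ N i → i ! * (N C i) ≤ N ^ i
  C-falling N zero rewrite nC0≡1 N = ≤-refl
  C-falling N (suc i) = begin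
    suc i * i ! * (N C suc i)   ≡⟨ l₁ (suc i) (i !) (N C suc i) ⟩
    i ! * (suc i * (N C suc i)) ≡⟨ cong (i ! *_) (C-absorb N i) ⟩
    i ! * ((N ∸ i) * (N C i))   ≡⟨ l₂ (i !) (N ∸ i) (N C i) ⟩
    (N ∸ i) * (i ! * (N C i))   ≤⟨ *-mono-≤ (m∸n≤m N i) (C-falling N i) ⟩
    N * N ^ i                   ∎
    where
    open ≤-Reasoning
    l₁ : ∀ s f c → s * f * c ≡ f * (s * c)
    l₁ = solve-∀
    l₂ : ∀ f u c → f * (u * c) ≡ u * (f * c)
    l₂ = solve-∀

  ^-distribʳ-* : ∀ n a b → (a * b) ^ n ≡ a ^ n * b ^ n
  ^-distribʳ-* zero    a b = refl
  ^-distribʳ-* (suc n) a b = trans (cong (a * b *_) (^-distribʳ-* n a b)) (l a b (a ^ n) (b ^ n))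
    where
    l : ∀ a b p q → a * b * (p * q) ≡ a * p * (b * q)
    l = solve-∀

  square≤4^ : ∀ i → i * i ≤ 4 ^ i
  square≤4^ i = ≤-trans (*-mono-≤ (i≤2^ i) (i≤2^ i)) (≤-reflexive (sym (^-distribʳ-* i 2 2)))
    where
    i≤2^ : ∀ i → i ≤ 2 ^ i
    i≤2^ zero    = z≤n
    i≤2^ (suc i) = ≤-trans (+-mono-≤ (m^n>0 2 i) (i≤2^ i)) (≤-reflexive (cong (2 ^ i +_)
      (sym (+-identityʳ _))))

  -- Up to i = a the first factor suffices on its own; beyond that, every further factor a is at
  -- most the new factor of the factorial. The point is a bound on a^i / i! that is uniform in i.
  power≤factorial : ∀ a i → a ^ i ≤ a ^ a * i !
  power≤factorial zero    zero    = ≤-refl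
  power≤factorial zero    (suc i) = z≤n
  power≤factorial (suc a) zero    = ≤-trans (m^n>0 (suc a) (suc a)) (≤-reflexive (sym (*-identityʳ _)))
  power≤factorial a@(suc _) (suc i) with suc i ≤? a
  ... | yes l = ≤-trans (^-monoʳ-≤ a l) (m≤m*n (a ^ a) (suc i !) {{suc i !≢0}})
  ... | no  l = begin
    a * a ^ i             ≤⟨ *-mono-≤ (≤-trans (n≤1+n a) (≰⇒> l)) (power≤factorial a i) ⟩
    suc i * (a ^ a * i !) ≡⟨ l₁ (suc i) (a ^ a) (i !) ⟩
    a ^ a * (suc i * i !) ∎
    where
    open ≤-Reasoning
    l₁ : ∀ s p f → s * (p * f) ≡ p * (s * f)
    l₁ = solve-∀

  -- Squares are absorbed by 4^i, and the factor 2^i leaves a geometric tail.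
  term-bound : ∀ a i → a ^ i * (i * i) * 2 ^ i ≤ (8 * a) ^ (8 * a) * i !
  term-bound a i = begin
    a ^ i * (i * i) * 2 ^ i ≤⟨ *-monoˡ-≤ (2 ^ i) (*-monoʳ-≤ (a ^ i) (square≤4^ i)) ⟩
    a ^ i * 4 ^ i * 2 ^ i   ≡⟨ cong (_* 2 ^ i) (^-distribʳ-* i a 4) ⟨
    (a * 4) ^ i * 2 ^ i     ≡⟨ ^-distribʳ-* i (a * 4) 2 ⟨
    (a * 4 * 2) ^ i         ≡⟨ cong (_^ i) (l a) ⟩
    (8 * a) ^ i             ≤⟨ power≤factorial (8 * a) i ⟩
    (8 * a) ^ (8 * a) * i ! ∎
    where
    open ≤-Reasoning
    l : ∀ a → a * 4 * 2 ≡ 8 * a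
    l = solve-∀

-- Embedding of ℕ into ℚ, powers and finite sums.

module Rationals where

  open import Algebra.Definitions.RawSemiring using () renaming (_^_ to pow)
  open import Data.Integer.Base as ℤ using (+_)
  import Data.Integer.Properties as ℤ
  open import Data.List.Base using (map; applyUpTo; upTo)
  open import Data.Nat.Base as ℕ using (ℕ; zero; suc; NonZero)
  import Data.Nat.Properties as ℕ
  open import Data.Rational.Base hiding (NonZero)
  open import Data.Rational.Properties
  open import Data.Rational.Solver
  open import Data.Rational.Unnormalised.Base as ℚᵘ using (mkℚᵘ; *≡*)
  import Data.Rational.Unnormalised.Properties as ℚᵘ
  open import Function.Base using (_∘_; id)
  open import Relation.Binary.PropositionalEquality

  ι : ℕ → ℚ
  ι n = + n / 1

  -- Division in ℚ normalises by a gcd, which does not compute on variables; this identity and the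
  -- next two are therefore checked on unnormalised fractions.
  ι-+ : ∀ a b → ι (a ℕ.+ b) ≡ ι a + ι b
  ι-+ a b = toℚᵘ-injective (begin
    toℚᵘ (ι (a ℕ.+ b))                ≈⟨ toℚᵘ-fromℚᵘ (mkℚᵘ (+ (a ℕ.+ b)) 0) ⟩
    mkℚᵘ (+ (a ℕ.+ b)) 0              ≈⟨ *≡* (cong (ℤ._* + 1) (cong₂ ℤ._+_ (sym (ℤ.*-identityʳ (+ a)))
      (sym (ℤ.*-identityʳ (+ b))))) ⟩
    mkℚᵘ (+ a) 0 ℚᵘ.+ mkℚᵘ (+ b) 0    ≈⟨ ℚᵘ.+-cong (toℚᵘ-fromℚᵘ (mkℚᵘ (+ a) 0))
      (toℚᵘ-fromℚᵘ (mkℚᵘ (+ b) 0)) ⟨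
    toℚᵘ (ι a) ℚᵘ.+ toℚᵘ (ι b)        ≈⟨ toℚᵘ-homo-+ (ι a) (ι b) ⟨
    toℚᵘ (ι a + ι b)                  ∎)
    where open ℚᵘ.≃-Reasoning

  ι-* : ∀ a b → ι (a ℕ.* b) ≡ ι a * ι b
  ι-* a b = toℚᵘ-injective (begin
    toℚᵘ (ι (a ℕ.* b))                ≈⟨ toℚᵘ-fromℚᵘ (mkℚᵘ (+ (a ℕ.* b)) 0) ⟩
    mkℚᵘ (+ (a ℕ.* b)) 0              ≈⟨ *≡* (cong (ℤ._* + 1) (ℤ.pos-* a b)) ⟩
    mkℚᵘ (+ a) 0 ℚᵘ.* mkℚᵘ (+ b) 0    ≈⟨ ℚᵘ.*-cong (toℚᵘ-fromℚᵘ (mkℚᵘ (+ a) 0))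
      (toℚᵘ-fromℚᵘ (mkℚᵘ (+ b) 0)) ⟨
    toℚᵘ (ι a) ℚᵘ.* toℚᵘ (ι b)        ≈⟨ toℚᵘ-homo-* (ι a) (ι b) ⟨
    toℚᵘ (ι a * ι b)                  ∎)
    where open ℚᵘ.≃-Reasoning

  /-cancel : ∀ a b .{{_ : NonZero b}} → (+ a / b) * ι b ≡ ι a
  /-cancel a b@(suc b-1) = toℚᵘ-injective (begin
    toℚᵘ ((+ a / b) * ι b)            ≈⟨ toℚᵘ-homo-* (+ a / b) (ι b) ⟩
    toℚᵘ (+ a / b) ℚᵘ.* toℚᵘ (ι b)    ≈⟨ ℚᵘ.*-cong (toℚᵘ-fromℚᵘ (mkℚᵘ (+ a) b-1))
      (toℚᵘ-fromℚᵘ (mkℚᵘ (+ b) 0)) ⟩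
    mkℚᵘ (+ a) b-1 ℚᵘ.* mkℚᵘ (+ b) 0  ≈⟨ *≡* (trans (ℤ.*-identityʳ _) (cong (λ c → + a ℤ.* + c)
      (sym (ℕ.*-identityʳ b)))) ⟩
    mkℚᵘ (+ a) 0                      ≈⟨ toℚᵘ-fromℚᵘ (mkℚᵘ (+ a) 0) ⟨
    toℚᵘ (ι a)                        ∎)
    where open ℚᵘ.≃-Reasoning

  0≤/ : ∀ a b .{{_ : NonZero b}} → 0ℚ ≤ + a / b
  0≤/ a b = nonNegative⁻¹ _ {{normalize-nonNeg a b}}

  0<1/ : ∀ b .{{_ : NonZero b}} → 0ℚ < + 1 / b
  0<1/ b = positive⁻¹ _ {{normalize-pos 1 b}}

  0≤ι : ∀ n → 0ℚ ≤ ι n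
  0≤ι n = 0≤/ n 1

  0<ι : ∀ n .{{_ : NonZero n}} → 0ℚ < ι n
  0<ι n = positive⁻¹ _ {{normalize-pos n 1}}

  p≤p+q : ∀ {p q} → 0ℚ ≤ q → p ≤ p + q
  p≤p+q {p} {q} l = subst (_≤ p + q) (+-identityʳ p) (+-monoʳ-≤ p l)

  ι-mono : ∀ {a b} → a ℕ.≤ b → ι a ≤ ι b
  ι-mono {a} {b} l = subst (ι a ≤_) (trans (sym (ι-+ a (b ℕ.∸ a))) (cong ι (ℕ.m+[n∸m]≡n l)))
    (p≤p+q (0≤ι (b ℕ.∸ a)))

  *-mono : ∀ {p q r s} → 0ℚ ≤ p → 0ℚ ≤ r → p ≤ q → r ≤ s → p * r ≤ q * s
  *-mono {p} {q} {r} {s} 0≤p 0≤r p≤q r≤s = ≤-trans (*-monoʳ-≤-nonNeg r {{nonNegative 0≤r}} p≤q)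
    (*-monoˡ-≤-nonNeg q {{nonNegative (≤-trans 0≤p p≤q)}} r≤s)

  0≤* : ∀ {p q} → 0ℚ ≤ p → 0ℚ ≤ q → 0ℚ ≤ p * q
  0≤* {p} {q} 0≤p 0≤q =
    nonNegative⁻¹ _ {{nonNeg*nonNeg⇒nonNeg p {{nonNegative 0≤p}} q {{nonNegative 0≤q}}}}

  *-monoˡ : ∀ {p q r} → 0ℚ ≤ p → q ≤ r → p * q ≤ p * r
  *-monoˡ {p} 0≤p = *-monoˡ-≤-nonNeg p {{nonNegative 0≤p}}

  *-monoʳ : ∀ {p q r} → 0ℚ ≤ p → q ≤ r → q * p ≤ r * p
  *-monoʳ {p} 0≤p = *-monoʳ-≤-nonNeg p {{nonNegative 0≤p}}

  infixr 8 _^_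
  -- The same power as in the definition of `exp`, so that the terms of the series match by
  -- computation.
  _^_ : ℚ → ℕ → ℚ
  _^_ = pow +-*-rawSemiring

  0≤^ : ∀ {p} n → 0ℚ ≤ p → 0ℚ ≤ p ^ n
  0≤^ zero    l = 0≤ι 1
  0≤^ (suc n) l = 0≤* l (0≤^ n l)

  ^-mono : ∀ {p q} n → 0ℚ ≤ p → p ≤ q → p ^ n ≤ q ^ n
  ^-mono zero    0≤p p≤q = ≤-refl
  ^-mono (suc n) 0≤p p≤q = *-mono 0≤p (0≤^ n 0≤p) p≤q (^-mono n 0≤p p≤q)

  ι-^ : ∀ a n → ι (a ℕ.^ n) ≡ ι a ^ n
  ι-^ a zero    = refl
  ι-^ a (suc n) = trans (ι-* a (a ℕ.^ n)) (cong (ι a *_) (ι-^ a n))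

  *-^ : ∀ p q n → (p * q) ^ n ≡ p ^ n * q ^ n
  *-^ p q zero    = refl
  *-^ p q (suc n) = trans (cong ((p * q) *_) (*-^ p q n))
    (solve 4 (λ p q a b → (p :* q) :* (a :* b) := (p :* a) :* (q :* b)) refl p q (p ^ n) (q ^ n))
    where open +-*-Solver

  p≤q⇒0≤q-p : ∀ {p q} → p ≤ q → 0ℚ ≤ q - p
  p≤q⇒0≤q-p {p} {q} l = subst (_≤ q - p) (+-inverseʳ p) (+-monoˡ-≤ (- p) l)

  ∑ : ℕ → (ℕ → ℚ) → ℚ
  ∑ zero    f = 0ℚ
  ∑ (suc n) f = f 0 + ∑ n (f ∘ suc)

  sumℚ-upTo : ∀ n (f : ℕ → ℚ) → sumℚ (map f (upTo n)) ≡ ∑ n f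
  sumℚ-upTo n f = go n id
    where
    -- Unfolding `upTo` shifts the generating function, hence the generalisation over `g`.
    go : ∀ n {f : ℕ → ℚ} g → sumℚ (map f (applyUpTo g n)) ≡ ∑ n (f ∘ g)
    go zero        g = refl
    go (suc n) {f} g = cong (λ z → f (g 0) + z) (go n (g ∘ suc))

  ∑-mono : ∀ n {f g : ℕ → ℚ} → (∀ i → f i ≤ g i) → ∑ n f ≤ ∑ n g
  ∑-mono zero    l = ≤-refl
  ∑-mono (suc n) l = +-mono-≤ (l 0) (∑-mono n (l ∘ suc))

  ∑-+ : ∀ n (f g : ℕ → ℚ) → ∑ n (λ i → f i + g i) ≡ ∑ n f + ∑ n g
  ∑-+ zero    f g = refl
  ∑-+ (suc n) f g = trans (cong (λ z → (f 0 + g 0) + z) (∑-+ n (f ∘ suc) (g ∘ suc)))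
    (solve 4 (λ a b c d → (a :+ b) :+ (c :+ d) := (a :+ c) :+ (b :+ d)) refl
      (f 0) (g 0) (∑ n (f ∘ suc)) (∑ n (g ∘ suc)))
    where open +-*-Solver

  ∑-* : ∀ n c (f : ℕ → ℚ) → ∑ n (λ i → c * f i) ≡ c * ∑ n f
  ∑-* zero    c f = sym (*-zeroʳ c)
  ∑-* (suc n) c f = trans (cong (λ z → c * f 0 + z) (∑-* n c (f ∘ suc))) (sym (*-distribˡ-+ c (f 0) _))

  ∑-cong : ∀ n {f g : ℕ → ℚ} → (∀ i → f i ≡ g i) → ∑ n f ≡ ∑ n g
  ∑-cong zero    e = refl
  ∑-cong (suc n) e = cong₂ _+_ (e 0) (∑-cong n (e ∘ suc))

-- Comparison of (1 - t / N)^N with the partial sums of the exponential series.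

module Exponential where

  open import Data.Integer.Base as ℤ using (+_; -[1+_]; +[1+_])
  open import Data.Nat.Base as ℕ using (ℕ; zero; suc; _!; NonZero; z≤n; s≤s)
  open import Data.Nat.Combinatorics using (_C_; k>n⇒nCk≡0; nCk+nC[k+1]≡[n+1]C[k+1])
  import Data.Nat.Properties as ℕ
  open import Data.Product.Base using (_,_; ∃-syntax)
  open import Data.Rational.Base hiding (NonZero)
  open import Data.Rational.Properties
  open import Data.Rational.Solver
  open import Data.Sum.Base using (_⊎_; inj₁; inj₂)
  open import Function.Base using (_∘_)
  open import Relation.Binary.PropositionalEquality
  open Rationals
  open Binomials
  open +-*-Solver using (solve; _:+_; _:*_; _:-_; :-_; _:=_; con)

  ∑-zero : ∀ n {f : ℕ → ℚ} → (∀ i → f i ≡ 0ℚ) → ∑ n f ≡ 0ℚ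
  ∑-zero zero    e = refl
  ∑-zero (suc n) e = trans (cong₂ _+_ (e 0) (∑-zero n (e ∘ suc))) (+-identityˡ 0ℚ)

  -- The range `M` is free because coefficients beyond n vanish. The induction needs this: Pascal's
  -- rule calls for the case n with the two ranges `M` and `suc M`.
  binomial-theorem : ∀ n M y → n ℕ.< M → (1ℚ + y) ^ n ≡ ∑ M (λ i → ι (n C i) * y ^ i)
  binomial-theorem zero (suc M) y _ = sym (trans
    (cong (λ z → 1ℚ * 1ℚ + z) (∑-zero M λ i → trans (cong (λ c → ι c * y ^ suc i)
      (k>n⇒nCk≡0 {0} {suc i} (s≤s z≤n))) (*-zeroˡ (y ^ suc i))))
    (+-identityʳ (1ℚ * 1ℚ)))
  binomial-theorem (suc n) (suc M) y (s≤s n<M) = sym (begin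
    ι (suc n C 0) * 1ℚ + ∑ M (λ i → ι (suc n C suc i) * y ^ suc i)
      ≡⟨ cong₂ (λ c z → ι c * 1ℚ + z) (trans (nC0≡1 (suc n)) (sym (nC0≡1 n))) (∑-cong M pascal) ⟩
    ι (n C 0) * 1ℚ + ∑ M (λ i → y * (ι (n C i) * y ^ i) + ι (n C suc i) * y ^ suc i)
      ≡⟨ cong (λ z → ι (n C 0) * 1ℚ + z) (trans (∑-+ M _ _) (cong (λ z → z + rest) (∑-* M y _))) ⟩
    ι (n C 0) * 1ℚ + (y * ∑ M (λ i → ι (n C i) * y ^ i) + rest)
      ≡⟨ solve 3 (λ a b c → a :+ (b :+ c) := (a :+ c) :+ b) refl (ι (n C 0) * 1ℚ) (y * ∑ M (λ i →
        ι (n C i) * y ^ i)) rest ⟩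
    ∑ (suc M) (λ i → ι (n C i) * y ^ i) + y * ∑ M (λ i → ι (n C i) * y ^ i)
      ≡⟨ cong₂ (λ a b → a + y * b) (binomial-theorem n (suc M) y (ℕ.m<n⇒m<1+n n<M))
        (binomial-theorem n M y n<M) ⟨
    (1ℚ + y) ^ n + y * (1ℚ + y) ^ n
      ≡⟨ cong (λ z → z + y * (1ℚ + y) ^ n) (*-identityˡ ((1ℚ + y) ^ n)) ⟨
    1ℚ * (1ℚ + y) ^ n + y * (1ℚ + y) ^ n
      ≡⟨ *-distribʳ-+ ((1ℚ + y) ^ n) 1ℚ y ⟨
    (1ℚ + y) ^ suc n ∎)
    where
    open ≡-Reasoning
    rest = ∑ M (λ i → ι (n C suc i) * y ^ suc i)
    pascal : ∀ i → ι (suc n C suc i) * y ^ suc i ≡ y * (ι (n C i) * y ^ i) + ι (n C suc i) * y ^ suc i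
    pascal i = trans (cong (λ c → c * y ^ suc i) (trans (cong ι (sym (nCk+nC[k+1]≡[n+1]C[k+1] n i)))
      (ι-+ (n C i) (n C suc i))))
      (solve 4 (λ a b y p → (a :+ b) :* (y :* p) := y :* (a :* p) :+ b :* (y :* p)) refl (ι (n C i))
        (ι (n C suc i)) y (y ^ i))

  1/! : ℕ → ℚ
  1/! i = (+ 1 / (i !)) {{i ℕ.!≢0}}

  1/!-cancel : ∀ i → 1/! i * ι (i !) ≡ 1ℚ
  1/!-cancel i = /-cancel 1 (i !) {{i ℕ.!≢0}}

  0≤1/! : ∀ i → 0ℚ ≤ 1/! i
  0≤1/! i = 0≤/ 1 (i !) {{i ℕ.!≢0}}

  1/-^-cancel : ∀ n i → (+ 1 / suc n) ^ i * ι (suc n ℕ.^ i) ≡ 1ℚ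
  1/-^-cancel n i = trans (cong (λ z → (+ 1 / suc n) ^ i * z) (ι-^ (suc n) i))
    (trans (sym (*-^ (+ 1 / suc n) (ι (suc n)) i)) (trans (cong (_^ i) (/-cancel 1 (suc n))) (1^ i)))
    where
    1^ : ∀ i → 1ℚ ^ i ≡ 1ℚ
    1^ zero    = refl
    1^ (suc i) = trans (*-identityˡ _) (1^ i)

  module _ (n i : ℕ) where

    private
      N = suc n
      r = + 1 / suc n
      f = 1/! i
      0≤r^ = 0≤^ i (0≤/ 1 N)

    -- The coefficient of yⁱ in (1 + y / N)^N. The two lemmas that follow place it between 1 / i!
    -- minus an error of i² / (N i!) and 1 / i! itself.
    coefficient : ℚ
    coefficient = ι (N C i) * r ^ i

    coefficient≤ : coefficient ≤ f
    coefficient≤ = begin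
      ι (N C i) * r ^ i                  ≡⟨ *-identityˡ _ ⟨
      1ℚ * (ι (N C i) * r ^ i)           ≡⟨ cong (λ z → z * (ι (N C i) * r ^ i)) (1/!-cancel i) ⟨
      f * ι (i !) * (ι (N C i) * r ^ i)
        ≡⟨ solve 4 (λ f g c p → f :* g :* (c :* p) := f :* p :* (g :* c)) refl f (ι (i !)) (ι (N C i))
          (r ^ i) ⟩
      f * r ^ i * (ι (i !) * ι (N C i))  ≡⟨ cong (λ z → f * r ^ i * z) (ι-* (i !) (N C i)) ⟨
      f * r ^ i * ι (i ! ℕ.* (N C i))    ≤⟨ *-monoˡ (0≤* (0≤1/! i) 0≤r^) (ι-mono (C-falling N i)) ⟩
      f * r ^ i * ι (N ℕ.^ i)            ≡⟨ *-assoc f (r ^ i) _ ⟩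
      f * (r ^ i * ι (N ℕ.^ i))          ≡⟨ cong (f *_) (1/-^-cancel n i) ⟩
      f * 1ℚ                             ≡⟨ *-identityʳ f ⟩
      f                                  ∎
      where open ≤-Reasoning

    -- This is `C-close` divided by i! N^(i+1).
    ≤coefficient : f ≤ coefficient + r * (ι (i ℕ.* i) * f)
    ≤coefficient = begin
      f
        ≡⟨ trans (*-identityʳ (f * 1ℚ)) (*-identityʳ f) ⟨
      f * 1ℚ * 1ℚ
        ≡⟨ cong₂ (λ a b → f * a * b) (1/-^-cancel n i) (/-cancel 1 N) ⟨
      f * (r ^ i * ι (N ℕ.^ i)) * (r * ι N)
        ≡⟨ solve 5 (λ f p q r s → f :* (p :* q) :* (r :* s) := f :* p :* r :* (q :* s)) refl f (r ^ i)
          (ι (N ℕ.^ i)) r (ι N) ⟩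
      f * r ^ i * r * (ι (N ℕ.^ i) * ι N)
        ≡⟨ cong (λ z → f * r ^ i * r * z) (ι-* (N ℕ.^ i) N) ⟨
      f * r ^ i * r * ι (N ℕ.^ i ℕ.* N)
        ≤⟨ *-monoˡ (0≤* (0≤* (0≤1/! i) 0≤r^) (0≤/ 1 N)) (ι-mono (C-close N i)) ⟩
      f * r ^ i * r * ι (i ! ℕ.* (N C i) ℕ.* N ℕ.+ i ℕ.* i ℕ.* N ℕ.^ i)
        ≡⟨ cong (λ z → f * r ^ i * r * z) expand ⟩
      f * r ^ i * r * (ι (i !) * ι (N C i) * ι N + ι (i ℕ.* i) * ι (N ℕ.^ i))
        ≡⟨ solve 8 (λ f p r g c s e q →
        f :* p :* r :* (g :* c :* s :+ e :* q) := (f :* g) :* (r :* s) :* (c :* p) :+ (p :* q) :*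
          (r :* (e :* f)))
        refl f (r ^ i) r (ι (i !)) (ι (N C i)) (ι N) (ι (i ℕ.* i)) (ι (N ℕ.^ i)) ⟩
      (f * ι (i !)) * (r * ι N) * coefficient + (r ^ i * ι (N ℕ.^ i)) * (r * (ι (i ℕ.* i) * f))
        ≡⟨ cong₂ _+_ (trans (cong₂ (λ a b → a * b * coefficient) (1/!-cancel i) (/-cancel 1 N))
          (*-identityˡ coefficient))
                     (trans (cong (λ z → z * (r * (ι (i ℕ.* i) * f))) (1/-^-cancel n i))
                       (*-identityˡ _)) ⟩
      coefficient + r * (ι (i ℕ.* i) * f)                ∎
      where
      open ≤-Reasoning
      expand : ι (i ! ℕ.* (N C i) ℕ.* N ℕ.+ i ℕ.* i ℕ.* N ℕ.^ i) ≡ ι (i !) * ι (N C i) * ι N +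
        ι (i ℕ.* i) * ι (N ℕ.^ i)
      expand = trans (ι-+ (i ! ℕ.* (N C i) ℕ.* N) _) (cong₂ _+_
        (trans (ι-* (i ! ℕ.* (N C i)) N) (cong (λ z → z * ι N) (ι-* (i !) (N C i)))) (ι-* (i ℕ.* i)
          (N ℕ.^ i)))

  neg-^ : ∀ p i → (- p) ^ i ≡ p ^ i ⊎ (- p) ^ i ≡ - (p ^ i)
  neg-^ p zero    = inj₁ refl
  neg-^ p (suc i) with neg-^ p i
  ... | inj₁ e = inj₂ (trans (cong (- p *_) e) (sym (neg-distribˡ-* p (p ^ i))))
  ... | inj₂ e = inj₁ (trans (cong (- p *_) e) (solve 2 (λ p q → (:- p) :* (:- q) := p :* q) refl p
    (p ^ i)))

  module _ (a b : ℕ) .{{_ : NonZero b}} where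

    private
      t = + a / b
      0≤t = 0≤/ a b
      A = (8 ℕ.* a) ℕ.^ (8 ℕ.* a)

    -- N times the allowed difference between the i-th terms of (1 - t / N)^N and of the series. Its
    -- sum over i stays bounded independently of N, since the terms decay geometrically.
    error-term : ℕ → ℚ
    error-term i = t ^ i * (ι (i ℕ.* i) * 1/! i)

    t≤a : t ≤ ι a
    t≤a = begin
      t        ≡⟨ *-identityʳ t ⟨
      t * 1ℚ   ≤⟨ *-monoˡ 0≤t (ι-mono (ℕ.>-nonZero⁻¹ b)) ⟩
      t * ι b  ≡⟨ /-cancel a b ⟩
      ι a      ∎
      where open ≤-Reasoning

    error-term≤ : ∀ i → error-term i ≤ ι A * ½ ^ i
    error-term≤ i = begin
      t ^ i * (ι (i ℕ.* i) * f)
        ≤⟨ *-monoʳ (0≤* (0≤ι (i ℕ.* i)) (0≤1/! i)) (^-mono i 0≤t t≤a) ⟩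
      ι a ^ i * (ι (i ℕ.* i) * f)
        ≡⟨ cong (λ z → z * (ι (i ℕ.* i) * f)) (ι-^ a i) ⟨
      ι (a ℕ.^ i) * (ι (i ℕ.* i) * f)                   ≡⟨ *-identityʳ _ ⟨
      ι (a ℕ.^ i) * (ι (i ℕ.* i) * f) * 1ℚ
        ≡⟨ cong (λ z → ι (a ℕ.^ i) * (ι (i ℕ.* i) * f) * z) (1/-^-cancel 1 i) ⟨
      ι (a ℕ.^ i) * (ι (i ℕ.* i) * f) * (½ ^ i * ι (2 ℕ.^ i))
        ≡⟨ solve 5 (λ p e f h q → p :* (e :* f) :* (h :* q) := (p :* e :* q) :* (f :* h))
        refl (ι (a ℕ.^ i)) (ι (i ℕ.* i)) f (½ ^ i) (ι (2 ℕ.^ i)) ⟩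
      ι (a ℕ.^ i) * ι (i ℕ.* i) * ι (2 ℕ.^ i) * (f * ½ ^ i)
        ≡⟨ cong (λ z → z * (f * ½ ^ i)) (trans (ι-* (a ℕ.^ i ℕ.* (i ℕ.* i)) (2 ℕ.^ i)) (cong (λ z →
          z * ι (2 ℕ.^ i)) (ι-* (a ℕ.^ i) (i ℕ.* i)))) ⟨
      ι (a ℕ.^ i ℕ.* (i ℕ.* i) ℕ.* 2 ℕ.^ i) * (f * ½ ^ i)
        ≤⟨ *-monoʳ (0≤* (0≤1/! i) (0≤^ i (0≤/ 1 2))) (ι-mono (term-bound a i)) ⟩
      ι (A ℕ.* i !) * (f * ½ ^ i)                       ≡⟨ cong (λ z → z * (f * ½ ^ i)) (ι-* A (i !)) ⟩
      ι A * ι (i !) * (f * ½ ^ i)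
        ≡⟨ solve 4 (λ a g f h → a :* g :* (f :* h) := (f :* g) :* (a :* h)) refl (ι A)
          (ι (i !)) f (½ ^ i) ⟩
      (f * ι (i !)) * (ι A * ½ ^ i)
        ≡⟨ cong (λ z → z * (ι A * ½ ^ i)) (1/!-cancel i) ⟩
      1ℚ * (ι A * ½ ^ i)                                ≡⟨ *-identityˡ _ ⟩
      ι A * ½ ^ i                                       ∎
      where
      open ≤-Reasoning
      f = 1/! i

    geometric : ∀ n → ∑ n (½ ^_) ≤ ι 2
    geometric zero    = 0≤ι 2
    geometric (suc n) = begin
      1ℚ + ∑ n (λ i → ½ * ½ ^ i)  ≡⟨ cong (λ z → 1ℚ + z) (∑-* n ½ (½ ^_)) ⟩
      1ℚ + ½ * ∑ n (½ ^_)         ≤⟨ +-monoʳ-≤ 1ℚ (*-monoˡ (0≤/ 1 2) (geometric n)) ⟩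
      1ℚ + ½ * ι 2                ≡⟨⟩
      ι 2                         ∎
      where open ≤-Reasoning

    error≤ : ∀ n → ∑ n error-term ≤ ι (A ℕ.* 2)
    error≤ n = begin
      ∑ n error-term             ≤⟨ ∑-mono n error-term≤ ⟩
      ∑ n (λ i → ι A * ½ ^ i)    ≡⟨ ∑-* n (ι A) (½ ^_) ⟩
      ι A * ∑ n (½ ^_)           ≤⟨ *-monoˡ (0≤ι A) (geometric n) ⟩
      ι A * ι 2                  ≡⟨ ι-* A 2 ⟨
      ι (A ℕ.* 2)                ∎
      where open ≤-Reasoning

    compound : ℕ → ℚ
    compound n = (1ℚ + (- t) * (+ 1 / suc n)) ^ suc n

    -- The binomial expansion and the partial sum run over the same indices 0, ..., N, so they can
    -- be compared term by term, and no tail of the series arises.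
    compound≤exp : ∀ n → compound n ≤ exp (- t) (suc n) + (+ 1 / suc n) * ι (A ℕ.* 2)
    compound≤exp n = begin
      compound n
        ≡⟨ binomial-theorem N (suc N) ((- t) * r) ℕ.≤-refl ⟩
      ∑ (suc N) (λ i → ι (N C i) * ((- t) * r) ^ i)
        ≤⟨ ∑-mono (suc N) termwise ⟩
      ∑ (suc N) (λ i → (- t) ^ i * 1/! i + r * error-term i)
        ≡⟨ trans (∑-+ (suc N) (λ i → (- t) ^ i * 1/! i) (λ i → r * error-term i))
          (cong₂ _+_ (sym (sumℚ-upTo (suc N) (λ i → (- t) ^ i * 1/! i))) (∑-* (suc N) r error-term)) ⟩
      exp (- t) N + r * ∑ (suc N) error-term
        ≤⟨ +-monoʳ-≤ (exp (- t) N) (*-monoˡ (0≤/ 1 N) (error≤ (suc N))) ⟩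
      exp (- t) N + r * ι (A ℕ.* 2) ∎
      where
      open ≤-Reasoning
      N = suc n
      r = + 1 / suc n

      -- The signs alternate: a positive term uses the upper estimate of the coefficient, a negative
      -- one the lower estimate with its error.
      signed : ∀ i {s c f e p} → 0ℚ ≤ p → 0ℚ ≤ e → c ≤ f → f ≤ c + e → s ≡ p ⊎ s ≡ - p → s * c ≤
        s * f + p * e
      signed i {c = c} {f} {e} {p} 0≤p 0≤e c≤f f≤c+e (inj₁ refl) =
        ≤-trans (*-monoˡ 0≤p c≤f) (p≤p+q (0≤* 0≤p 0≤e))
      signed i {c = c} {f} {e} {p} 0≤p 0≤e c≤f f≤c+e (inj₂ refl) = begin
        - p * c
          ≡⟨ solve 3 (λ p c e → :- p :* c := :- p :* (c :+ e) :+ p :* e) refl p c e ⟩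
        - p * (c + e) + p * e          ≡⟨ cong (λ z → z + p * e) (neg-distribˡ-* p (c + e)) ⟨
        - (p * (c + e)) + p * e        ≤⟨ +-monoˡ-≤ (p * e) (neg-antimono-≤ (*-monoˡ 0≤p f≤c+e)) ⟩
        - (p * f) + p * e              ≡⟨ cong (λ z → z + p * e) (neg-distribˡ-* p f) ⟩
        - p * f + p * e                ∎

      termwise : ∀ i → ι (N C i) * ((- t) * r) ^ i ≤ (- t) ^ i * 1/! i + r * error-term i
      termwise i = begin
        ι (N C i) * ((- t) * r) ^ i          ≡⟨ cong (λ z → ι (N C i) * z) (*-^ (- t) r i) ⟩
        ι (N C i) * ((- t) ^ i * r ^ i)
          ≡⟨ solve 3 (λ c s p → c :* (s :* p) := s :* (c :* p)) refl (ι (N C i)) ((- t) ^ i) (r ^ i) ⟩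
        (- t) ^ i * coefficient n i
          ≤⟨ signed i (0≤^ i 0≤t) (0≤* (0≤/ 1 N) (0≤* (0≤ι (i ℕ.* i)) (0≤1/! i)))
                                                  (coefficient≤ n i) (≤coefficient n i) (neg-^ t i) ⟩
        (- t) ^ i * 1/! i + t ^ i * (r * (ι (i ℕ.* i) * 1/! i)) ≡⟨ cong (λ z → (- t) ^ i * 1/! i + z)
          (solve 3 (λ p r e → p :* (r :* e) := r :* (p :* e)) refl (t ^ i) r (ι (i ℕ.* i) * 1/! i)) ⟩
        (- t) ^ i * 1/! i + r * error-term i ∎

    -- The denominator of ε is a witness, because the numerator is at least 1.
    archimedean : ∀ {ε} → 0ℚ < ε → ∃[ M ] 1ℚ ≤ ε * ι M
    archimedean {ε@(mkℚ +[1+ p ] d _)} _ = suc d , (begin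
      1ℚ                              ≤⟨ ι-mono {1} {suc p} (s≤s z≤n) ⟩
      ι (suc p)                       ≡⟨ /-cancel (suc p) (suc d) ⟨
      (+ suc p / suc d) * ι (suc d)   ≡⟨ cong (λ z → z * ι (suc d)) (↥p/↧p≡p ε) ⟩
      ε * ι (suc d)                   ∎)
      where open ≤-Reasoning
    archimedean {mkℚ (+ 0) d _}    (*<* (ℤ.+<+ ()))
    archimedean {mkℚ -[1+ p ] d _} (*<* ())

    -- All lower bounds on exp(-t) come from here, so that later only powers of 1 - t / N have to be
    -- estimated, for large N.
    exp-lower-bound : ∀ {q} N₁ → (∀ n → N₁ ℕ.≤ suc n → q ≤ compound n) → fromℚ q ≤ᴿ exp (- t)
    exp-lower-bound {q} N₁ q≤ ε 0<ε with archimedean 0<ε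
    -- N₁ activates the hypothesis, 2 A M makes the error 2 A / N at most ε, and the successor rules
    -- out N = 0.
    ... | M , 1≤εM = suc (N₁ ℕ.+ A ℕ.* 2 ℕ.* M) , bound′
      where
      open ≤-Reasoning
      bound′ : ∀ N → suc (N₁ ℕ.+ A ℕ.* 2 ℕ.* M) ℕ.≤ N → q ≤ exp (- t) N + ε
      bound′ (suc n) (s≤s l) = begin
        q                                          ≤⟨ q≤ n (ℕ.m≤n⇒m≤1+n (ℕ.≤-trans (ℕ.m≤m+n N₁ _) l)) ⟩
        compound n                                 ≤⟨ compound≤exp n ⟩
        exp (- t) (suc n) + r * ι (A ℕ.* 2)        ≤⟨ +-monoʳ-≤ (exp (- t) (suc n)) small ⟩
        exp (- t) (suc n) + ε                      ∎
        where
        r = + 1 / suc n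
        small : r * ι (A ℕ.* 2) ≤ ε
        small = begin
          r * ι (A ℕ.* 2)                ≡⟨ cong (r *_) (*-identityˡ (ι (A ℕ.* 2))) ⟨
          r * (1ℚ * ι (A ℕ.* 2))         ≤⟨ *-monoˡ (0≤/ 1 (suc n)) (*-monoʳ (0≤ι (A ℕ.* 2)) 1≤εM) ⟩
          r * (ε * ι M * ι (A ℕ.* 2))
            ≡⟨ cong (r *_) (trans (*-assoc ε (ι M) _) (cong (ε *_) (trans (sym (ι-* M (A ℕ.* 2)))
              (cong ι (ℕ.*-comm M _))))) ⟩
          r * (ε * ι (A ℕ.* 2 ℕ.* M))
            ≤⟨ *-monoˡ (0≤/ 1 (suc n)) (*-monoˡ (<⇒≤ 0<ε)
              (ι-mono (ℕ.m≤n⇒m≤1+n (ℕ.≤-trans (ℕ.m≤n+m _ N₁) l)))) ⟩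
          r * (ε * ι (suc n))
            ≡⟨ solve 3 (λ r e s → r :* (e :* s) := (r :* s) :* e) refl r ε (ι (suc n)) ⟩
          (r * ι (suc n)) * ε            ≡⟨ cong (_* ε) (/-cancel 1 (suc n)) ⟩
          1ℚ * ε                         ≡⟨ *-identityˡ ε ⟩
          ε                              ∎

-- Inequalities between rationals and the real bound of the theorem.

module Bounds where

  import Algebra.Properties.Semiring.Exp as Exp
  open import Algebra.Bundles using (module CommutativeRing)
  open import Data.Integer.Base using (+_)
  open import Data.List.Base using ([]; _∷_; map; applyUpTo; upTo)
  open import Data.Nat.Base as ℕ using (ℕ; zero; suc; NonZero; z≤n; s≤s)
  open import Data.Nat.DivMod using (m≡m%n+[m/n]*n; m%n<n; m/n*n≤m)
  open import Data.Nat.Logarithm using (⌊log₂_⌋; ⌊log₂⌋-mono-≤)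
  import Data.Nat.Properties as ℕ
  import Data.Nat.Tactic.RingSolver as ℕ
  open import Data.Product.Base using (_,_)
  open import Data.Rational.Base hiding (NonZero)
  open import Data.Rational.Properties
  open import Data.Rational.Solver
  open import Data.Sum.Base using (inj₁; inj₂)
  open import Relation.Binary.PropositionalEquality
  open Rationals
  open Exponential
  open +-*-Solver using (solve; _:+_; _:*_; _:-_; :-_; _:=_; con)


  bernoulli : ∀ {y} n → 0ℚ ≤ 1ℚ + y → 1ℚ + ι n * y ≤ (1ℚ + y) ^ n
  bernoulli {y} zero    l = ≤-reflexive (trans (cong (λ z → 1ℚ + z) (*-zeroˡ y)) (+-identityʳ 1ℚ))
  bernoulli {y} (suc n) l = begin
    1ℚ + ι (suc n) * y                        ≡⟨ cong (λ z → 1ℚ + z * y) (ι-+ 1 n) ⟩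
    1ℚ + (1ℚ + ι n) * y                       ≤⟨ p≤p+q (0≤* (0≤ι n) (0≤square y)) ⟩
    1ℚ + (1ℚ + ι n) * y + ι n * (y * y)
      ≡⟨ solve 3 (λ o n y → o :+ (o :+ n) :* y :+ n :* (y :* y) := o :+ n :* y :+ (o :* y :+ n :* y :*
        y)) refl 1ℚ (ι n) y ⟩
    1ℚ + ι n * y + (1ℚ * y + ι n * y * y)
      ≡⟨ cong (λ z → 1ℚ + ι n * y + z) (trans (sym (*-distribʳ-+ y 1ℚ (ι n * y))) (*-comm _ y)) ⟩
    1ℚ + ι n * y + y * (1ℚ + ι n * y)
      ≡⟨ cong (λ z → z + y * (1ℚ + ι n * y)) (*-identityˡ (1ℚ + ι n * y)) ⟨
    1ℚ * (1ℚ + ι n * y) + y * (1ℚ + ι n * y)  ≡⟨ *-distribʳ-+ (1ℚ + ι n * y) 1ℚ y ⟨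
    (1ℚ + y) * (1ℚ + ι n * y)                 ≤⟨ *-monoˡ l (bernoulli n l) ⟩
    (1ℚ + y) * (1ℚ + y) ^ n                   ∎
    where
    open ≤-Reasoning
    0≤square : ∀ y → 0ℚ ≤ y * y
    0≤square y with ≤-total 0ℚ y
    ... | inj₁ 0≤y = 0≤* 0≤y 0≤y
    ... | inj₂ y≤0 = subst (0ℚ ≤_) (solve 1 (λ y → :- y :* :- y := y :* y) refl y)
                       (0≤* (neg-antimono-≤ y≤0) (neg-antimono-≤ y≤0))

  ^-anti : ∀ {v i j} → 0ℚ ≤ v → v ≤ 1ℚ → i ℕ.≤ j → v ^ j ≤ v ^ i
  ^-anti {j = zero}  0≤v v≤1 z≤n = ≤-refl
  ^-anti {v} {j = suc j} 0≤v v≤1 z≤n = begin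
    v * v ^ j    ≤⟨ *-monoʳ (0≤^ j 0≤v) v≤1 ⟩
    1ℚ * v ^ j   ≡⟨ *-identityˡ (v ^ j) ⟩
    v ^ j        ≤⟨ ^-anti 0≤v v≤1 (z≤n {j}) ⟩
    1ℚ           ∎
    where open ≤-Reasoning
  ^-anti 0≤v v≤1 (s≤s l) = *-monoˡ 0≤v (^-anti 0≤v v≤1 l)

  module _ (a b : ℕ) .{{_ : NonZero b}} where

    private t = + a / b

    0≤base : ∀ n → a ℕ.≤ suc n → 0ℚ ≤ 1ℚ + (- t) * (+ 1 / suc n)
    0≤base n l = subst (0ℚ ≤_) (cong (λ z → 1ℚ + z) (neg-distribˡ-* t (+ 1 / suc n))) (p≤q⇒0≤q-p (begin
      t * (+ 1 / suc n)         ≤⟨ *-monoʳ (0≤/ 1 (suc n)) (≤-trans (t≤a a b) (ι-mono l)) ⟩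
      ι (suc n) * (+ 1 / suc n) ≡⟨ trans (*-comm (ι (suc n)) _) (/-cancel 1 (suc n)) ⟩
      1ℚ                        ∎))
      where open ≤-Reasoning

    -- The alternating series hides its sign, but the powers (1 - t / N)^N have a nonnegative base
    -- as soon as N ≥ a ≥ t.
    0≤exp : fromℚ 0ℚ ≤ᴿ exp (- t)
    0≤exp = exp-lower-bound a b a λ n l → 0≤^ (suc n) (0≤base n l)

  ratio : (k m : ℕ) .{{_ : NonZero k}} → ℚ
  ratio k m = (+ k / (k ℕ.+ m)) {{ℕ.>-nonZero (ℕ.≤-trans (ℕ.>-nonZero⁻¹ k) (ℕ.m≤m+n k m))}}

  ratio≤exp : (m k : ℕ) .{{_ : NonZero m}} .{{_ : NonZero k}} → m ℕ.≤ k →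
    fromℚ (ratio k m ^ m) ≤ᴿ exp (- exponent m k 0)
  -- N ≥ a keeps the base nonnegative, and N ≥ m keeps the rounded-up block length c below 2 N / m.
  ratio≤exp m k m≤k = exp-lower-bound a b (a ℕ.+ m) λ n l →
      below n (ℕ.≤-trans (ℕ.m≤m+n a m) l) (ℕ.≤-trans (ℕ.m≤n+m m a) l)
    where
    instance
      32k≢0 = ℕ.m*n≢0 32 k
      k+m≢0 : NonZero (k ℕ.+ m)
      k+m≢0 = ℕ.>-nonZero (ℕ.≤-trans (ℕ.>-nonZero⁻¹ k) (ℕ.m≤m+n k m))
    a = m ℕ.^ 2 ℕ.* 2 ℕ.^ 0
    b = 32 ℕ.* k
    t = + a / b
    p = ratio k m
    module _ (n : ℕ) (a≤N : a ℕ.≤ suc n) (m≤N : m ℕ.≤ suc n) where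
      N = suc n
      r = + 1 / N
      y = (- t) * r
      v = 1ℚ + y
      -- N is split into m blocks of length at most c.
      c = suc (N ℕ./ m)

      N≤cm : N ℕ.≤ c ℕ.* m
      N≤cm = ℕ.≤-trans (ℕ.≤-reflexive (m≡m%n+[m/n]*n N m)) (ℕ.+-monoˡ-≤ _ (ℕ.<⇒≤ (m%n<n N m)))

      cm≤2N : c ℕ.* m ℕ.≤ N ℕ.+ N
      cm≤2N = ℕ.+-mono-≤ m≤N (m/n*n≤m N m)

      counts : (k ℕ.+ m) ℕ.* (c ℕ.* a ℕ.* m) ℕ.≤ m ℕ.* (b ℕ.* N ℕ.* m)
      counts = begin
        (k ℕ.+ m) ℕ.* (c ℕ.* a ℕ.* m)
          ≤⟨ ℕ.*-monoˡ-≤ (c ℕ.* a ℕ.* m) (ℕ.+-monoʳ-≤ k m≤k) ⟩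
        (k ℕ.+ k) ℕ.* (c ℕ.* a ℕ.* m)                  ≡⟨ l₁ k m c ⟩
        (k ℕ.+ k) ℕ.* (m ℕ.* m) ℕ.* (c ℕ.* m)          ≤⟨ ℕ.*-monoʳ-≤ ((k ℕ.+ k) ℕ.* (m ℕ.* m)) cm≤2N ⟩
        (k ℕ.+ k) ℕ.* (m ℕ.* m) ℕ.* (N ℕ.+ N)          ≤⟨ ℕ.m≤m+n _ (28 ℕ.* (k ℕ.* (m ℕ.* m) ℕ.* N)) ⟩
        (k ℕ.+ k) ℕ.* (m ℕ.* m) ℕ.* (N ℕ.+ N) ℕ.+ 28 ℕ.* (k ℕ.* (m ℕ.* m) ℕ.* N) ≡⟨ l₂ k m N ⟩
        m ℕ.* (b ℕ.* N ℕ.* m)                          ∎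
        where
        open ℕ.≤-Reasoning
        l₁ : ∀ k m c → (k ℕ.+ k) ℕ.* (c ℕ.* (m ℕ.* (m ℕ.* 1) ℕ.* 1) ℕ.* m) ≡ (k ℕ.+ k) ℕ.* (m ℕ.* m) ℕ.*
          (c ℕ.* m)
        l₁ = ℕ.solve-∀
        l₂ : ∀ k m N → (k ℕ.+ k) ℕ.* (m ℕ.* m) ℕ.* (N ℕ.+ N) ℕ.+ 28 ℕ.* (k ℕ.* (m ℕ.* m) ℕ.* N) ≡
          m ℕ.* (32 ℕ.* k ℕ.* N ℕ.* m)
        l₂ = ℕ.solve-∀

      drift : ι c * (t * r) * ι (k ℕ.+ m) ≤ ι m
      drift = *-cancelʳ-≤-pos (ι (b ℕ.* N ℕ.* m))
        {{positive (0<ι (b ℕ.* N ℕ.* m) {{ℕ.m*n≢0 (b ℕ.* N) m {{ℕ.m*n≢0 b N}}}})}} (begin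
        ι c * (t * r) * ι (k ℕ.+ m) * ι (b ℕ.* N ℕ.* m)
          ≡⟨ cong (λ z → ι c * (t * r) * ι (k ℕ.+ m) * z) (trans (ι-* (b ℕ.* N) m) (cong (λ z → z * ι m)
            (ι-* b N))) ⟩
        ι c * (t * r) * ι (k ℕ.+ m) * (ι b * ι N * ι m)
          ≡⟨ solve 7 (λ c t r s b n m → c :* (t :* r) :* s :* (b :* n :* m) := (r :* n) :*
            (s :* (c :* (t :* b) :* m)))
               refl (ι c) t r (ι (k ℕ.+ m)) (ι b) (ι N) (ι m) ⟩
        (r * ι N) * (ι (k ℕ.+ m) * (ι c * (t * ι b) * ι m))
          ≡⟨ cong₂ (λ x z → x * (ι (k ℕ.+ m) * (ι c * z * ι m))) (/-cancel 1 N) (/-cancel a b) ⟩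
        1ℚ * (ι (k ℕ.+ m) * (ι c * ι a * ι m))
          ≡⟨ *-identityˡ (ι (k ℕ.+ m) * (ι c * ι a * ι m)) ⟩
        ι (k ℕ.+ m) * (ι c * ι a * ι m)
          ≡⟨ trans (ι-* (k ℕ.+ m) (c ℕ.* a ℕ.* m)) (cong (ι (k ℕ.+ m) *_) (trans (ι-* (c ℕ.* a) m)
            (cong (λ z → z * ι m) (ι-* c a)))) ⟨
        ι ((k ℕ.+ m) ℕ.* (c ℕ.* a ℕ.* m))
          ≤⟨ ι-mono counts ⟩
        ι (m ℕ.* (b ℕ.* N ℕ.* m))
          ≡⟨ ι-* m (b ℕ.* N ℕ.* m) ⟩
        ι m * ι (b ℕ.* N ℕ.* m) ∎)
        where open ≤-Reasoning

      p≤block : p ≤ 1ℚ + ι c * y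
      p≤block = *-cancelʳ-≤-pos (ι (k ℕ.+ m)) {{positive (0<ι (k ℕ.+ m))}} (begin
        p * ι (k ℕ.+ m)                                      ≡⟨ /-cancel k (k ℕ.+ m) ⟩
        ι k
          ≡⟨ solve 2 (λ k m → k := k :+ m :- m) refl (ι k) (ι m) ⟩
        ι k + ι m - ι m
          ≤⟨ +-monoʳ-≤ (ι k + ι m) (neg-antimono-≤ drift) ⟩
        ι k + ι m - ι c * (t * r) * ι (k ℕ.+ m)
          ≡⟨ cong (λ z → z - ι c * (t * r) * ι (k ℕ.+ m)) (trans (sym (ι-+ k m))
            (sym (*-identityˡ (ι (k ℕ.+ m))))) ⟩
        1ℚ * ι (k ℕ.+ m) - ι c * (t * r) * ι (k ℕ.+ m)
          ≡⟨ solve 5 (λ o c t r s → o :* s :- c :* (t :* r) :* s := (o :+ c :* ((:- t) :* r)) :* s)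
                                                                  refl 1ℚ (ι c) t r (ι (k ℕ.+ m)) ⟩
        (1ℚ + ι c * y) * ι (k ℕ.+ m)                         ∎)
        where open ≤-Reasoning

      v≤1 : v ≤ 1ℚ
      v≤1 = subst (v ≤_) (+-identityʳ 1ℚ) (+-monoʳ-≤ 1ℚ
        (subst (_≤ 0ℚ) (neg-distribˡ-* t r) (neg-antimono-≤ (0≤* (0≤/ a b) (0≤/ 1 N)))))

      below : p ^ m ≤ v ^ N
      below = begin
        p ^ m           ≤⟨ ^-mono m (0≤/ k (k ℕ.+ m)) (≤-trans p≤block (bernoulli c 0≤v)) ⟩
        (v ^ c) ^ m     ≡⟨ Exp.^-assocʳ (CommutativeRing.semiring +-*-commutativeRing) v c m ⟩
        v ^ (c ℕ.* m)   ≤⟨ ^-anti 0≤v v≤1 N≤cm ⟩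
        v ^ N           ∎
        where
        open ≤-Reasoning
        0≤v = 0≤base a b n a≤N

  ≤ᴿ-+ : ∀ {p q s t} → fromℚ p ≤ᴿ s → fromℚ q ≤ᴿ t → fromℚ (p + q) ≤ᴿ s +ᴿ t
  ≤ᴿ-+ {p} {q} {s} {t} p≤s q≤t ε 0<ε with p≤s (½ * ε) 0<½ε | q≤t (½ * ε) 0<½ε
    where
    0<½ε : 0ℚ < ½ * ε
    0<½ε = subst (_< ½ * ε) (*-zeroʳ ½) (*-monoʳ-<-pos ½ 0<ε)
  ... | N₁ , p≤ | N₂ , q≤ = N₁ ℕ.+ N₂ , λ N l → begin
    p + q
      ≤⟨ +-mono-≤ (p≤ N (ℕ.≤-trans (ℕ.m≤m+n N₁ N₂) l)) (q≤ N (ℕ.≤-trans (ℕ.m≤n+m N₂ N₁) l)) ⟩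
    s N + ½ * ε + (t N + ½ * ε)
      ≡⟨ solve 4 (λ s t h e → s :+ h :* e :+ (t :+ h :* e) := s :+ t :+ (h :+ h) :* e) refl (s N)
        (t N) ½ ε ⟩
    s N + t N + 1ℚ * ε                ≡⟨ cong (λ z → s N + t N + z) (*-identityˡ ε) ⟩
    s N + t N + ε                     ∎
    where open ≤-Reasoning

  -- The tolerance passed on is ε / (c + 1), which also makes sense for c = 0.
  ≤ᴿ-* : ∀ c {q s} → fromℚ q ≤ᴿ s → fromℚ (ι c * q) ≤ᴿ fromℕ c *ᴿ s
  ≤ᴿ-* c {q} {s} q≤s ε 0<ε with q≤s (r * ε) 0<rε
    where
    r = + 1 / suc c
    0<rε : 0ℚ < r * ε
    0<rε = subst (_< r * ε) (*-zeroʳ r) (*-monoʳ-<-pos r {{positive (0<1/ (suc c))}} 0<ε)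
  ... | N₀ , q≤ = N₀ , λ N l → begin
    ι c * q                          ≤⟨ *-monoˡ (0≤ι c) (q≤ N l) ⟩
    ι c * (s N + r * ε)              ≡⟨ *-distribˡ-+ (ι c) (s N) (r * ε) ⟩
    ι c * s N + ι c * (r * ε)
      ≤⟨ +-monoʳ-≤ (ι c * s N) (*-monoʳ (0≤* (0≤/ 1 (suc c)) (<⇒≤ 0<ε)) (ι-mono (ℕ.n≤1+n c))) ⟩
    ι c * s N + ι (suc c) * (r * ε)
      ≡⟨ cong (λ z → ι c * s N + z) (trans (sym (*-assoc (ι (suc c)) r ε))
        (cong (_* ε) (trans (*-comm (ι (suc c)) r) (/-cancel 1 (suc c))))) ⟩
    ι c * s N + 1ℚ * ε               ≡⟨ cong (λ z → ι c * s N + z) (*-identityˡ ε) ⟩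
    ι c * s N + ε                    ∎
    where
    open ≤-Reasoning
    r = + 1 / suc c

  0≤sumᴿ : ∀ {f : ℕ → ℝ} → (∀ i → fromℚ 0ℚ ≤ᴿ f i) → ∀ is → fromℚ 0ℚ ≤ᴿ sumᴿ (map f is)
  0≤sumᴿ l []       = λ ε 0<ε → 0 , λ N _ → ≤-trans (<⇒≤ 0<ε) (≤-reflexive (sym (+-identityˡ ε)))
  0≤sumᴿ {f} l (i ∷ is) = ≤ᴿ-+ {0ℚ} {0ℚ} {f i} {sumᴿ (map f is)} (l i) (0≤sumᴿ l is)

  -- Both `s` and `t` are subtracted, so lower estimates for them give an upper estimate for the
  -- whole; it has the shape of `bound`.
  1-≤ᴿ : ∀ {q P s t} c d ℓ → fromℚ 0ℚ ≤ᴿ s → fromℚ q ≤ᴿ t → 1ℚ - ι d * q ≤ P →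
    fromℕ 1 -ᴿ fromℕ c *ᴿ fromℕ ℓ *ᴿ s -ᴿ fromℕ d *ᴿ t ≤ᴿ fromℚ P
  1-≤ᴿ {q} {P} {s} {t} c d ℓ 0≤s q≤t l ε 0<ε =
    let N₀ , h = ≤ᴿ-+ {ι c * (ι ℓ * 0ℚ)} {ι d * q} {fromℕ c *ᴿ (fromℕ ℓ *ᴿ s)} {fromℕ d *ᴿ t}
                   (≤ᴿ-* c {ι ℓ * 0ℚ} {fromℕ ℓ *ᴿ s} (≤ᴿ-* ℓ {0ℚ} {s} 0≤s)) (≤ᴿ-* d {q} {t} q≤t) ε 0<ε
    in N₀ , λ N N₀≤N → begin
      1ℚ - ι c * ι ℓ * s N - ι d * t N
        ≡⟨ cong (λ z → 1ℚ - z - ι d * t N) (*-assoc (ι c) (ι ℓ) (s N)) ⟩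
      1ℚ - ι c * (ι ℓ * s N) - ι d * t N
        ≡⟨ solve 4 (λ o a b e → o :- a :- b := o :- (a :+ b :+ e) :+ e)
                                                             refl 1ℚ (ι c * (ι ℓ * s N)) (ι d * t N) ε ⟩
      1ℚ - (ι c * (ι ℓ * s N) + ι d * t N + ε) + ε
        ≤⟨ +-monoˡ-≤ ε (+-monoʳ-≤ 1ℚ (neg-antimono-≤ (h N N₀≤N))) ⟩
      1ℚ - (ι c * (ι ℓ * 0ℚ) + ι d * q) + ε
        ≡⟨ cong (λ z → 1ℚ - z + ε) (trans (cong (λ z → ι c * z + ι d * q) (*-zeroʳ (ι ℓ)))
          (trans (cong (λ z → z + ι d * q) (*-zeroʳ (ι c))) (+-identityˡ (ι d * q)))) ⟩
      1ℚ - ι d * q + ε                                  ≤⟨ +-monoˡ-≤ ε l ⟩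
      P + ε                                             ∎
    where open ≤-Reasoning

  module _ (m k : ℕ) .{{_ : NonZero m}} .{{_ : NonZero k}} where

    private
      instance
        32k≢0 : NonZero (32 ℕ.* k)
        32k≢0 = ℕ.m*n≢0 32 k

      0≤exponents : ∀ i → fromℚ 0ℚ ≤ᴿ exp (- exponent m k i)
      0≤exponents i = 0≤exp (m ℕ.^ 2 ℕ.* 2 ℕ.^ i) (32 ℕ.* k)

      rest : ℝ
      rest = exp (- (+ m / 12))

      e : ℕ → ℝ
      e i = exp (- exponent m k i)

    bound≤1 : ∀ {P} → 1ℚ ≤ P → bound m k ≤ᴿ fromℚ P
    bound≤1 {P} l = 1-≤ᴿ {0ℚ} {P} {rest} {sumᴿ (map e (upTo ⌊log₂ k ⌋))} 12 2 ⌊log₂ k ⌋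
      (0≤exp m 12) (0≤sumᴿ {e} 0≤exponents (upTo ⌊log₂ k ⌋)) l

    bound≤ratio : ∀ {P} → 2 ℕ.* m ℕ.≤ k → 1ℚ - ι 2 * ratio k m ^ m ≤ P → bound m k ≤ᴿ fromℚ P
    bound≤ratio {P} 2m≤k = 1-≤ᴿ {ratio k m ^ m} {P} {rest} {sumᴿ (map e (upTo ⌊log₂ k ⌋))} 12 2 ⌊log₂ k
      ⌋ (0≤exp m 12)
      -- From 2 ≤ 2 m ≤ k the logarithm is at least 1, so the sum does contain a term i = 0.
      (first ⌊log₂ k ⌋ (⌊log₂⌋-mono-≤ (ℕ.≤-trans (ℕ.*-monoʳ-≤ 2 (ℕ.>-nonZero⁻¹ m)) 2m≤k)))
      where
      first : ∀ ℓ → 1 ℕ.≤ ℓ → fromℚ (ratio k m ^ m) ≤ᴿ sumᴿ (map e (upTo ℓ))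
      first (suc ℓ) _ = subst (λ z → fromℚ z ≤ᴿ sumᴿ (map e (upTo (suc ℓ))))
        (+-identityʳ (ratio k m ^ m))
        (≤ᴿ-+ {ratio k m ^ m} {0ℚ} {e 0} {sumᴿ (map e (applyUpTo suc ℓ))}
          (ratio≤exp m k (ℕ.≤-trans (ℕ.m≤m+n m _) 2m≤k)) (0≤sumᴿ {e} 0≤exponents (applyUpTo suc ℓ)))

-- The algorithm as an abstract random process on indices.

module Buffers where

  open import Data.Bool.Base using (Bool; true; false; if_then_else_)
  open import Data.Fin.Base using (Fin; toℕ)
  open import Data.List.Base using (List; []; _∷_; _++_; [_]; length)
  open import Data.Nat.Base

  -- Elements are represented by their indices, so a larger element has a smaller index and every
  -- comparison computes on numbers.
  module Model {n : ℕ} (D : ℕ) (default : Fin n) where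

    capacity : ℕ
    capacity = suc (2 * D)

    beats : Bool → Fin n → Fin n → Bool
    beats true  i j = toℕ i <ᵇ toℕ j
    beats false i j = toℕ j <ᵇ toℕ i

    -- The element i is carried through the buffer and exchanged whenever it does not beat the entry met,
    -- so the element finally carried out is the maximum (for true) or the minimum (for false).
    kept : Bool → Fin n → List (Fin n) → List (Fin n)
    kept d i []       = []
    kept d i (j ∷ js) = if beats d i j then j ∷ kept d i js else i ∷ kept d j js

    -- `picks` is the number of positions still to be drawn, starting at k. `gap` grows with every
    -- drawn position and shrinks with every discarded maximum.
    record State : Set where
      constructor state
      field
        gap    : ℕ
        picks  : ℕ
        buffer : List (Fin n)

    -- At the end of the stream both counts equal k, so the discarding rule with D = 0 isolates the target.
    finish : ℕ → ℕ → Fin n → List (Fin n) → Fin n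
    finish zero    G i js = i
    finish (suc f) G i js with G <ᵇ 2
    ... | true with kept false i js
    ...   | []     = i
    ...   | j ∷ ks = finish f G j ks
    finish (suc f) G i js | false with kept true i js
    ...   | []     = i
    ...   | j ∷ ks = finish f (pred G) j ks

    result : State → Fin n
    result (state G K [])       = default
    result (state G K (i ∷ js)) = finish (length js) G i js

    insert : ℕ → ℕ → Fin n → List (Fin n) → State
    insert G K i B =
      if length B <ᵇ capacity then state G K (B ++ [ i ]) else
      if G <ᵇ 2 + D then state G K (kept false i B) else state (pred G) K (kept true i B)

    next : State → Fin n → Bool → State
    next (state G K B) i true  = insert (suc G) (pred K) i B
    next (state G K B) i false = insert G K i B

    -- Selection sampling: with K picks left for N remaining positions, the next position is drawn
    -- with probability K / N, which makes all subsets of the right size equally likely.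
    simulate : State → List (Fin n) → Rand (Fin n)
    simulate s []       = return (result s)
    simulate s (i ∷ is) = uniform (suc (length is)) λ j →
      simulate (next s i (toℕ j <ᵇ State.picks s)) is

-- Invariants under which the target stays in the buffer.

module Survival where

  open import Data.Bool.Base using (Bool; true; false; if_then_else_; T)
  open import Data.Fin.Base using (Fin; toℕ)
  open import Data.List.Base using (List; []; _∷_; length; map)
  open import Data.List.Relation.Binary.Permutation.Propositional hiding (trans; refl)
  open import Data.List.Relation.Binary.Permutation.Propositional.Properties hiding (sum-↭)
  open import Data.List.Relation.Unary.All as All using (All; []; _∷_)
  open import Data.Nat.Base
  open import Data.Nat.ListAction using (sum)
  open import Data.Nat.ListAction.Properties using (sum-↭)
  open import Data.Nat.Properties
  open import Data.Nat.Tactic.RingSolver using (solve-∀)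
  open import Data.Product.Base using (_,_; ∃-syntax; _×_)
  open import Relation.Binary.PropositionalEquality hiding ([_])
  open import Relation.Nullary.Decidable using (yes; no; dec-true; dec-false)
  open import Relation.Nullary.Negation using (contradiction)
  open Buffers

  <ᵇ-false : ∀ a b → (a <ᵇ b) ≡ false → b ≤ a
  <ᵇ-false a b e = ≮⇒≥ λ l → contradiction (trans (sym (dec-true (a <? b) l)) e) λ ()

  <ᵇ-true : ∀ a b → (a <ᵇ b) ≡ true → a < b
  <ᵇ-true a b e with a <? b
  ... | yes l = l
  ... | no l  = contradiction (trans (sym (dec-false (a <? b) l)) e) λ ()

  indicator : Bool → ℕ
  indicator b = if b then 1 else 0

  -- Additive counts are invariant under permutation, so the invariants can ignore how `kept`
  -- rearranges the buffer.
  weight : ∀ {A : Set} → (A → ℕ) → List A → ℕ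
  weight f xs = sum (map f xs)

  weight-↭ : ∀ {A : Set} (f : A → ℕ) {xs ys} → xs ↭ ys → weight f xs ≡ weight f ys
  weight-↭ f p = sum-↭ (map⁺ f p)

  weight-mono : ∀ {A : Set} {f g : A → ℕ} {xs} → All (λ x → f x ≤ g x) xs → weight f xs ≤ weight g xs
  weight-mono []       = z≤n
  weight-mono (l ∷ ls) = +-mono-≤ l (weight-mono ls)

  weight-const : ∀ {A : Set} c (xs : List A) → weight (λ _ → c) xs ≡ length xs * c
  weight-const c []       = refl
  weight-const c (x ∷ xs) = cong (c +_) (weight-const c xs)

  module Correctness {n : ℕ} (D : ℕ) (κ : Fin n) where

    open Model D κ

    -- Index κ has rank k = κ + 1, so the top elements are the k largest, the target included.
    isTop isTarget : Fin n → Bool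
    isTop    i = toℕ i <ᵇ suc (toℕ κ)
    isTarget i = toℕ i ≡ᵇ toℕ κ

    tops targets : List (Fin n) → ℕ
    tops    = weight λ i → indicator (isTop i)
    targets = weight λ i → indicator (isTarget i)

    top-≤ : ∀ {i j} → toℕ i ≤ toℕ j → indicator (isTop j) ≤ indicator (isTop i)
    top-≤ {i} {j} l with isTop j in e
    ... | false = z≤n
    ... | true  rewrite dec-true (toℕ i <? suc (toℕ κ)) (≤-<-trans l (<ᵇ-true _ _ e)) = ≤-refl

    target≤top : ∀ i → indicator (isTarget i) ≤ indicator (isTop i)
    target≤top i with isTarget i in e
    ... | false = z≤n
    ... | true  rewrite ≡ᵇ⇒≡ (toℕ i) (toℕ κ) (subst T (sym e) _)
                      | dec-true (toℕ κ <? suc (toℕ κ)) ≤-refl = ≤-refl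

    beyond-target : ∀ {i} → toℕ κ ≤ toℕ i → indicator (isTop i) ≤ indicator (isTarget i)
    beyond-target {i} l with isTop i in e
    ... | false = z≤n
    ... | true  rewrite dec-true (toℕ i ≟ toℕ κ) (≤-antisym (s≤s⁻¹ (<ᵇ-true _ _ e)) l) = ≤-refl

    precedes : Bool → Fin n → Fin n → Set
    precedes true  i j = toℕ i ≤ toℕ j
    precedes false i j = toℕ j ≤ toℕ i

    precedes-trans : ∀ d {i j l} → precedes d i j → precedes d j l → precedes d i l
    precedes-trans true  p q = ≤-trans p q
    precedes-trans false p q = ≤-trans q p

    precedes-refl : ∀ d {i} → precedes d i i
    precedes-refl true  = ≤-refl
    precedes-refl false = ≤-refl

    beats-true : ∀ d i j → beats d i j ≡ true → precedes d i j
    beats-true true  i j e = <⇒≤ (<ᵇ-true _ _ e)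
    beats-true false i j e = <⇒≤ (<ᵇ-true _ _ e)

    beats-false : ∀ d i j → beats d i j ≡ false → precedes d j i
    beats-false true  i j e = <ᵇ-false _ _ e
    beats-false false i j e = <ᵇ-false _ _ e

    -- `z` is the entry carried out, which `kept` itself does not return. That it precedes the
    -- carried `i` strengthens the induction: through this, `z` also precedes whichever of `i` and
    -- `j` stays behind.
    kept-spec : ∀ d i js → ∃[ z ] z ∷ kept d i js ↭ i ∷ js × precedes d z i × All (precedes d z)
      (kept d i js)
    kept-spec d i [] = i , ↭-refl , precedes-refl d , []
    kept-spec d i (j ∷ js) with beats d i j in e
    ... | true  = let z , p , l , ls = kept-spec d i js in
      z , ↭-trans (swap z j ↭-refl) (↭-trans (prep j p) (swap j i ↭-refl)) , l ,
      precedes-trans d l (beats-true d i j e) ∷ ls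
    ... | false = let z , p , l , ls = kept-spec d j js; l′ = precedes-trans d l (beats-false d i j e) in
      z , ↭-trans (swap z i ↭-refl) (prep i p) , l′ , l′ ∷ ls

    -- If the maximum were no top element, there would be none. If it were the target, the other
    -- entries would be no larger, so the target would be the only top element.
    drop-max : ∀ i js → 2 ≤ tops (i ∷ js) → targets (i ∷ js) ≤ 1 →
      suc (tops (kept true i js)) ≡ tops (i ∷ js) × targets (kept true i js) ≡ targets (i ∷ js)
    drop-max i js 2≤tops targets≤1 with kept-spec true i js
    ... | z , p , _ , ls with isTop z in top | isTarget z in target
                            | weight-↭ (λ i → indicator (isTop i)) p | weight-↭ (λ i →
                              indicator (isTarget i)) p
    ... | true  | false | e | e′ = e , e′
    ... | true  | true  | e | e′ = contradiction (≤-trans (≤-trans 2≤tops (≤-reflexive (sym e)))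
      (s≤s none))
                                     λ { (s≤s ()) }
      where
      z≡κ : toℕ z ≡ toℕ κ
      z≡κ = ≡ᵇ⇒≡ (toℕ z) (toℕ κ) (subst T (sym target) _)
      none : tops (kept true i js) ≤ 0
      none = ≤-trans (weight-mono (All.map (λ l → beyond-target (subst (_≤ _) z≡κ l)) ls))
                     (s≤s⁻¹ (≤-trans (≤-reflexive e′) targets≤1))
    ... | false | _ | e | e′ = contradiction (≤-trans (≤-trans 2≤tops (≤-reflexive (sym e))) none) λ ()
      where
      none : tops (kept true i js) ≤ 0
      none = ≤-trans (weight-mono {g = λ _ → 0}
          (All.map (λ {j} l → ≤-trans (top-≤ {z} {j} l) (≤-reflexive (cong indicator top))) ls))
        (≤-reflexive (trans (weight-const 0 (kept true i js)) (*-zeroʳ (length (kept true i js)))))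

    -- If the minimum were a top element, all entries would be; and what is not a top element is not
    -- the target.
    drop-min : ∀ i js → tops (i ∷ js) < suc (length js) →
      tops (kept false i js) ≡ tops (i ∷ js) × targets (kept false i js) ≡ targets (i ∷ js)
    drop-min i js tops< with kept-spec false i js
    ... | z , p , _ , ls with isTop z in top | target≤top z
                            | weight-↭ (λ i → indicator (isTop i)) p | weight-↭ (λ i →
                              indicator (isTarget i)) p
    ... | false | l | e | e′ = e , trans (cong (_+ targets (kept false i js)) (sym (n≤0⇒n≡0 l))) e′
    ... | true  | _ | e | e′ = contradiction (≤-trans tops< (≤-trans (≤-reflexive (sym (↭-length p)))
      (≤-trans (s≤s all) (≤-reflexive e)))) (<-irrefl refl)
      where
      all : length (kept false i js) ≤ tops (kept false i js)
      all = ≤-trans (≤-reflexive (sym (trans (weight-const 1 (kept false i js)) (*-identityʳ _))))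
        (weight-mono (All.map (λ {j} l → ≤-trans (≤-reflexive (sym (cong indicator top)))
          (top-≤ {j} {z} l)) ls))

    -- Both sides of `position` are k minus the number of discarded maxima, as long as every
    -- discarded maximum was a top element and no discarded minimum was. Together with `unlost` they
    -- give the rank of the target among buffer and future.
    record Good (s : State) (is : List (Fin n)) : Set where
      constructor good
      open State s
      field
        position : tops buffer + tops is ≡ picks + gap
        unlost   : targets buffer + targets is ≡ 1

    -- By `position` and the last two hypotheses the number of top elements at hand differs from G
    -- by at most D. For G ≤ D + 1 it is at most 2 D + 1, fewer than the 2 D + 2 entries of an
    -- overflowing buffer, so the minimum may go; for G ≥ D + 2 it is at least 2, so the maximum may
    -- go.
    insert-good : ∀ G K i B is → tops (i ∷ B) + tops is ≡ K + G → targets (i ∷ B) + targets is ≡ 1 →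
      tops is ≤ K + D → K ≤ tops is + D → Good (insert G K i B) is
    insert-good G K i B is position unlost low high with length B <ᵇ capacity in b
    ... | true = good (trans (cong (_+ tops is) (sym (weight-↭ _ (∷↭∷ʳ i B)))) position)
                      (trans (cong (_+ targets is) (sym (weight-↭ _ (∷↭∷ʳ i B)))) unlost)
    ... | false with G <ᵇ 2 + D in g
    ...   | true  = let e , e′ = drop-min i B few in
      good (trans (cong (_+ tops is) e) position) (trans (cong (_+ targets is) e′) unlost)
      where
      few : tops (i ∷ B) < suc (length B)
      few = s≤s (≤-trans (+-cancelʳ-≤ (tops is) _ _ (begin
        tops (i ∷ B) + tops is    ≡⟨ position ⟩
        K + G                     ≤⟨ +-mono-≤ high (s≤s⁻¹ (<ᵇ-true _ _ g)) ⟩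
        tops is + D + suc D       ≡⟨ l (tops is) D ⟩
        suc (2 * D) + tops is     ∎)) (<ᵇ-false _ _ b))
        where
        open ≤-Reasoning
        l : ∀ k d → k + d + suc d ≡ suc (2 * d) + k
        l = solve-∀
    ...   | false = let e , e′ = drop-max i B many (≤-trans (m≤m+n _ _) (≤-reflexive unlost)) in
      good (suc-injective (trans (cong (_+ tops is) e)
        (trans position (trans (cong (K +_) (sym suc-pred-G)) (+-suc K (pred G))))))
           (trans (cong (_+ targets is) e′) unlost)
      where
      2+D≤G = <ᵇ-false _ _ g
      suc-pred-G : suc (pred G) ≡ G
      suc-pred-G = m+[n∸m]≡n (≤-trans (s≤s z≤n) 2+D≤G)
      many : 2 ≤ tops (i ∷ B)
      many = +-cancelʳ-≤ (tops is) _ _ (begin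
        2 + tops is               ≤⟨ +-monoʳ-≤ 2 low ⟩
        2 + (K + D)               ≡⟨ l K D ⟩
        K + (2 + D)               ≤⟨ +-monoʳ-≤ K 2+D≤G ⟩
        K + G                     ≡⟨ position ⟨
        tops (i ∷ B) + tops is    ∎)
        where
        open ≤-Reasoning
        l : ∀ k d → 2 + (k + d) ≡ k + (2 + d)
        l = solve-∀

    -- Now G is exact: G ≥ 2 is the hypothesis of `drop-max`, and G < 2 leaves at most one top
    -- element among at least two entries.
    finish-target : ∀ f G i js → length js ≡ f → tops (i ∷ js) ≡ G → targets (i ∷ js) ≡ 1 →
      isTarget (finish f G i js) ≡ true
    finish-target zero G i [] _ _ e with isTarget i
    ... | true = refl
    finish-target (suc f) G i js q position unlost with G <ᵇ 2 in g
    ... | true with kept false i js | kept-spec false i js | drop-min i js few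
      where
      few : tops (i ∷ js) < suc (length js)
      few = ≤-trans (≤-trans (s≤s (≤-reflexive position)) (<ᵇ-true _ _ g))
        (s≤s (≤-trans (s≤s z≤n) (≤-reflexive (sym q))))
    ...   | []     | _ , p , _ | _      = contradiction (trans (↭-length p) (cong suc q)) λ ()
    ...   | k ∷ ks | _ , p , _ | e , e′ = finish-target f G k ks
            (suc-injective (suc-injective (trans (↭-length p) (cong suc q)))) (trans e position)
              (trans e′ unlost)
    finish-target (suc f) G i js q position unlost | false
      with kept true i js | kept-spec true i js
         | drop-max i js (≤-trans (<ᵇ-false _ _ g) (≤-reflexive (sym position))) (≤-reflexive unlost)
    ...   | []     | _ , p , _ | _      = contradiction (trans (↭-length p) (cong suc q)) λ ()
    ...   | k ∷ ks | _ , p , _ | e , e′ = finish-target f (pred G) k ks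
            (suc-injective (suc-injective (trans (↭-length p) (cong suc q))))
              (cong pred (trans e position)) (trans e′ unlost)

    result-target : ∀ G B → Good (state G 0 B) [] → isTarget (result (state G 0 B)) ≡ true
    result-target G []       (good _ ())
    result-target G (i ∷ js) (good position unlost) = finish-target (length js) G i js refl
      (trans (sym (+-identityʳ _)) position) (trans (sym (+-identityʳ _)) unlost)

-- Symbolic execution rules for the word RAM.

module Machines where

  open import Data.Bool.Base using (Bool; true; if_then_else_; T)
  open import Data.Fin.Base using (Fin; toℕ; fromℕ<; zero; suc)
  open import Data.Integer.Base using (+_)
  open import Data.List.Base using (List; []; _∷_; [_]; map; drop; head)
  open import Data.List.Properties
  open import Data.Maybe.Base as Maybe using (Maybe; just; nothing; _>>=_)
  open import Data.Nat.Base as ℕ hiding (less)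
  open import Data.Nat.Properties as ℕ
  open import Data.Product.Base
  import Data.Rational.Base as ℚ
  open import Data.Sum.Base using (_⊎_; inj₁; inj₂)
  open import Data.Vec.Base as Vec using (Vec; []; _∷_; toList)
  open import Data.Vec.Functional using (Vector)
  open import Level using (0ℓ)
  open import Relation.Binary.Bundles using (StrictTotalOrder)
  open import Relation.Binary.PropositionalEquality hiding ([_])
  open import Relation.Nullary.Decidable using (yes; no)
  open import Relation.Nullary.Negation using (contradiction)

  module Execution (O : StrictTotalOrder 0ℓ 0ℓ 0ℓ) (W : ℕ) {s : ℕ} (code : List Instr)
                   {n : ℕ} (x : Vector (StrictTotalOrder.Carrier O) n) where

    open StrictTotalOrder O using (Carrier; _<?_)
    open Machine O W

    -- A second semantics of memory, on lists with numeric addresses. The bounds check of the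
    -- machine is stuck for a symbolic memory size, whereas these functions compute on known
    -- prefixes, so that most premises of the rules below hold by `refl`.
    nth : ℕ → List Word → Maybe Word
    nth a       []       = nothing
    nth zero    (w ∷ ws) = just w
    nth (suc a) (w ∷ ws) = nth a ws

    write : ℕ → Word → List Word → Maybe (List Word)
    write a       v []       = nothing
    write zero    v (w ∷ ws) = just (v ∷ ws)
    write (suc a) v (w ∷ ws) = Maybe.map (w ∷_) (write a v ws)

    asAddress : Word → Maybe ℕ
    asAddress (int (+ a)) = just a
    asAddress _           = nothing

    place : List Word → Place → Maybe ℕ
    place ws (cell a)   = just a
    place ws (cell[ a ]) = nth a ws >>= asAddress

    value : List Word → Operand → Maybe Word
    value ws (lit z) = just (int z)
    value ws (val q) = place ws q >>= λ a → nth a ws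

    assign : List Word → Place → Word → Maybe (List Word)
    assign ws q w = place ws q >>= λ a → write a w ws

    nth-address : ∀ {t} (mem : Vec Word t) a {w} → nth a (toList mem) ≡ just w →
      ∃[ i ] address (int (+ a)) ≡ just i × Vec.lookup mem i ≡ w
    nth-address {t} mem a e with a ℕ.<? t
    ... | yes a<t = fromℕ< a<t , refl , go mem a a<t e
      where
      go : ∀ {t} (mem : Vec Word t) a (a<t : a ℕ.< t) {w} → nth a (toList mem) ≡ just w →
           Vec.lookup mem (fromℕ< a<t) ≡ w
      go (v ∷ mem) zero    _         refl = refl
      go (v ∷ mem) (suc a) (s<s a<t) e    = go mem a a<t e
    ... | no a≮t = contradiction (go mem a e) a≮t
      where
      go : ∀ {t} (mem : Vec Word t) a {w} → nth a (toList mem) ≡ just w → a ℕ.< t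
      go (v ∷ mem) zero    _ = z<s
      go (v ∷ mem) (suc a) e = s<s (go mem a e)

    write-address : ∀ {t} (mem : Vec Word t) a {w ws} → write a w (toList mem) ≡ just ws →
      ∃[ i ] address (int (+ a)) ≡ just i × toList (mem Vec.[ i ]≔ w) ≡ ws
    write-address {t} mem a e with a ℕ.<? t
    ... | yes a<t = fromℕ< a<t , refl , go mem a a<t e
      where
      go : ∀ {t} (mem : Vec Word t) a (a<t : a ℕ.< t) {w ws} → write a w (toList mem) ≡ just ws →
           toList (mem Vec.[ fromℕ< a<t ]≔ w) ≡ ws
      go (v ∷ mem) zero    _         refl = refl
      go (v ∷ mem) (suc a) (s<s a<t) {w} e with write a w (toList mem) in eq
      go (v ∷ mem) (suc a) (s<s a<t) refl | just ws = cong (v ∷_) (go mem a a<t eq)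
    ... | no a≮t = contradiction (go mem a e) a≮t
      where
      go : ∀ {t} (mem : Vec Word t) a {w ws} → write a w (toList mem) ≡ just ws → a ℕ.< t
      go (v ∷ mem) zero    _ = z<s
      go (v ∷ mem) (suc a) {w} e with write a w (toList mem) in eq
      ... | just ws = s<s (go mem a eq)

    place-locate : ∀ {t} (mem : Vec Word t) q {a} → place (toList mem) q ≡ just a →
      locate mem q ≡ address (int (+ a))
    place-locate mem (cell a)   refl = refl
    place-locate mem (cell[ b ]) e with nth b (toList mem) in eq
    place-locate mem (cell[ b ]) refl | just (int (+ a)) with nth-address mem b eq
    ... | i , e₁ , e₂ rewrite e₁ | e₂ = refl

    value-eval : ∀ {t} (mem : Vec Word t) u {w} → value (toList mem) u ≡ just w → eval mem u ≡ just w
    value-eval mem (lit z) refl = refl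
    value-eval mem (val q) e with place (toList mem) q in eq
    ... | just a with nth-address mem a e
    ...   | i , e₁ , refl rewrite place-locate mem q eq | e₁ = refl

    assign-store : ∀ {t} (mem : Vec Word t) q {w ws} → T (fits w) → assign (toList mem) q w ≡ just ws →
      ∃[ mem′ ] store mem q w ≡ just mem′ × toList mem′ ≡ ws
    assign-store mem q {w} f e with place (toList mem) q in eq | fits w
    ... | just a | true with write-address mem a e
    ...   | i , e₁ , e₂ rewrite place-locate mem q eq | e₁ = _ , refl , e₂

    -- Deterministic steps leave no trace in the tree, and each toss matches one `uniform` node. A
    -- relation is used because an equation between trees would need function extensionality; it
    -- still transports `Surely` and `Pr`.
    data Runs : ℕ → Config s → Rand (Fin n) → Set where
      halt : ∀ {t c i} → step code c ≡ return (just (inj₂ (x i))) → Runs (suc t) c (return i)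
      go   : ∀ {t c c′ ρ} → step code c ≡ return (just (inj₁ c′)) → Runs t c′ ρ → Runs (suc t) c ρ
      toss : ∀ {t c N f ρ} → step code c ≡ uniform (suc N) f →
             (∀ j → ∃[ c′ ] f j ≡ return (just (inj₁ c′)) × Runs t c′ (ρ j)) →
             Runs (suc t) c (uniform (suc N) ρ)

    weaken : ∀ {t t′ c ρ} → t ≤ t′ → Runs t c ρ → Runs t′ c ρ
    weaken (s≤s l) (halt e)   = halt e
    weaken (s≤s l) (go e r)   = go e (weaken l r)
    weaken (s≤s l) (toss e r) = toss e λ j → map₂ (map₂ (weaken l)) (r j)

    runs-surely : ∀ {t c ρ} → Runs t c ρ → Surely (λ r → ∃[ j ] r ≡ just (x j)) (runFor t code c)
    runs-surely (halt e)   rewrite e = _ , refl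
    runs-surely (go e r)   rewrite e = runs-surely r
    runs-surely (toss e r) rewrite e = λ j → let c , e′ , r′ = r j in
      subst (λ r → Surely (λ r → ∃[ j ] r ≡ just (x j)) (bind r _)) (sym e′) (runs-surely r′)

    runs-Pr : ∀ {t c ρ} {E : Maybe Carrier → Bool} {F : Fin n → Bool} → (∀ i → E (just (x i)) ≡ F i) →
      Runs t c ρ → Pr E (runFor t code c) ≡ Pr F ρ
    runs-Pr E≗F (halt {i = i} e) rewrite e | E≗F i = refl
    runs-Pr E≗F (go e r) rewrite e = runs-Pr E≗F r
    runs-Pr {E = E} {F} E≗F (toss {t} {N = N} {f} {ρ} e r) rewrite e = average _ (λ c → refl)
      where
      -- The continuation is an anonymous function inside `runFor` and cannot be written down again,
      -- so it is abstracted together with its value on unfinished runs.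
      average : (k : Maybe (Config s ⊎ Carrier) → Rand (Maybe Carrier)) →
                (∀ c → k (just (inj₁ c)) ≡ runFor t code c) →
                Pr E (uniform (suc N) λ j → bind (f j) k) ≡ Pr F (uniform (suc N) ρ)
      average k k≗ = cong (λ qs → sumℚ qs ℚ.* (+ 1 ℚ./ suc N)) (tabulate-cong λ j → pointwise j)
        where
        pointwise : ∀ j → Pr E (bind (f j) k) ≡ Pr F (ρ j)
        pointwise j with f j | r j
        ... | _ | c , refl , r′ rewrite k≗ c = runs-Pr {E = E} {F} E≗F r′

    RunsFrom : ℕ → ℕ → List Word → List Carrier → Rand (Fin n) → Set
    RunsFrom t pc ws σ ρ = (mem : Vec Word s) → toList mem ≡ ws → Runs t (config pc mem σ) ρ

    weaken′ : ∀ {t t′ pc ws σ ρ} → t ≤ t′ → RunsFrom t pc ws σ ρ → RunsFrom t′ pc ws σ ρ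
    weaken′ l r mem e = weaken l (r mem e)

    fetch : ℕ → Maybe Instr
    fetch pc = head (drop pc code)

    -- The bound 60 covers the 40 instructions of the program. At a literal program counter the
    -- implicit `small` reduces to the unit type and is filled in automatically.
    module Rules (pc-fits : ∀ pc → T (pc ≤ᵇ 60) → T (pc ≤ᵇ W)) where

      private
        step-execute : ∀ (c : Config s) {i} → T (Config.pc c ≤ᵇ 60) → fetch (Config.pc c) ≡ just i →
          step code c ≡ execute i c
        step-execute c p e with Config.pc c ≤ᵇ W | pc-fits (Config.pc c) p
        ... | true | _ rewrite e = refl

      copy-rule : ∀ {t pc ws q u w ws′ σ ρ} {small : T (pc ≤ᵇ 60)} → fetch pc ≡ just (copy q u) →
        value ws u ≡ just w → T (fits w) → assign ws q w ≡ just ws′ →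
        RunsFrom t (suc pc) ws′ σ ρ → RunsFrom (suc t) pc ws σ ρ
      copy-rule {pc = pc} {q = q} {u} {σ = σ} {_} {p} f v b a r mem refl with assign-store mem q b a
      ... | mem′ , e , e′ = go (trans (step-execute (config pc mem σ) p f) eq) (r mem′ e′)
        where
        eq : execute (copy q u) (config pc mem σ) ≡ return (just (inj₁ (config (suc pc) mem′ σ)))
        eq rewrite value-eval mem u v | e = refl

      arith-rule : ∀ {t pc ws op q u v y z w ws′ σ ρ} {small : T (pc ≤ᵇ 60)} →
        fetch pc ≡ just (arith op q u v) →
        value ws u ≡ just y → value ws v ≡ just z → compute op y z ≡ just w → T (fits w) →
        assign ws q w ≡ just ws′ →
        RunsFrom t (suc pc) ws′ σ ρ → RunsFrom (suc t) pc ws σ ρ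
      arith-rule {pc = pc} {op = op} {q} {u} {v} {σ = σ} {_} {p} f vu vv c b a r mem refl
        with assign-store mem q b a
      ... | mem′ , e , e′ = go (trans (step-execute (config pc mem σ) p f) eq) (r mem′ e′)
        where
        eq : execute (arith op q u v) (config pc mem σ) ≡ return (just (inj₁ (config (suc pc) mem′ σ)))
        eq rewrite value-eval mem u vu | value-eval mem v vv | c | e = refl

      jump-rule : ∀ {t pc ws u v l y z b σ ρ} {small : T (pc ≤ᵇ 60)} → fetch pc ≡ just (jump< u v l) →
        value ws u ≡ just y → value ws v ≡ just z → less y z ≡ just b →
        RunsFrom t (if b then l else suc pc) ws σ ρ → RunsFrom (suc t) pc ws σ ρ
      jump-rule {pc = pc} {u = u} {v} {l} {b = b} {σ} {_} {p} f vu vv c r mem refl =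
        go (trans (step-execute (config pc mem σ) p f) eq) (r mem refl)
        where
        eq : execute (jump< u v l) (config pc mem σ) ≡
             return (just (inj₁ (config (if b then l else suc pc) mem σ)))
        eq rewrite value-eval mem u vu | value-eval mem v vv | c = refl

      read-rule : ∀ {t pc ws q i ws′ σ ρ} {small : T (pc ≤ᵇ 60)} → fetch pc ≡ just (read q) →
        assign ws q (elem i) ≡ just ws′ →
        RunsFrom t (suc pc) ws′ σ ρ → RunsFrom (suc t) pc ws (i ∷ σ) ρ
      read-rule {pc = pc} {q = q} {i} {σ = σ} {_} {p} f a r mem refl with assign-store mem q {elem i} _
        a
      ... | mem′ , e , e′ = go (trans (step-execute (config pc mem (i ∷ σ)) p f) eq) (r mem′ e′)
        where
        eq : execute (read q) (config pc mem (i ∷ σ)) ≡ return (just (inj₁ (config (suc pc) mem′ σ)))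
        eq rewrite e = refl

      random-rule : ∀ {t pc ws q u N σ ρ} (ws′ : Fin (suc N) → List Word) {small : T (pc ≤ᵇ 60)} →
        fetch pc ≡ just (random q u) → value ws u ≡ just (int (+ suc N)) → (∀ j → T (toℕ j ≤ᵇ W)) →
        (∀ (j : Fin (suc N)) → assign ws q (int (+ toℕ j)) ≡ just (ws′ j)) →
        (∀ j → RunsFrom t (suc pc) (ws′ j) σ (ρ j)) → RunsFrom (suc t) pc ws σ (uniform (suc N) ρ)
      random-rule {pc = pc} {q = q} {u} {N} {σ} {ρ} ws′ {p} f v b a r mem refl =
        toss (trans (step-execute (config pc mem σ) p f) eq) λ j → let mem′ , e , e′ = assign-store mem q (b j) (a j) in
          config (suc pc) mem′ σ ,
          cong (λ r → return (r >>= λ mem′ → just (inj₁ (config (suc pc) mem′ σ)))) e ,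
          r j mem′ e′
        where
        eq : execute (random q u) (config pc mem σ) ≡ uniform (suc N) λ j → return (
          store mem q (int (+ toℕ j)) >>= λ mem′ → just (inj₁ (config (suc pc) mem′ σ)))
        eq rewrite value-eval mem u v = refl

      output-rule : ∀ {t pc ws u i σ} {small : T (pc ≤ᵇ 60)} → fetch pc ≡ just (output u) →
        value ws u ≡ just (elem (x i)) → RunsFrom (suc t) pc ws σ (return i)
      output-rule {pc = pc} {u = u} {i} {σ} {p} f v mem refl =
        halt (trans (step-execute (config pc mem σ) p f) eq)
        where
        eq : execute (output u) (config pc mem σ) ≡ return (just (inj₂ (x i)))
        eq rewrite value-eval mem u v = refl

-- The program and its agreement with the abstract process.

module Programs where

  open import Data.Bool.Base using (Bool; true; false; if_then_else_; T)
  open import Data.Fin.Base as Fin using (Fin; toℕ; zero; suc)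
  import Data.Fin.Properties as Fin
  open import Data.Integer.Base using (+_)
  open import Data.List.Base using (List; []; _∷_; _++_; [_]; length; map)
  open import Data.List.Properties
  open import Data.Maybe.Base using (just)
  open import Data.Nat.Base as ℕ hiding (less; compare)
  open import Data.Nat.Properties as ℕ
  open import Data.Vec.Base using ([]; _∷_)
  open import Data.Vec.Functional using (Vector)
  open import Level using (0ℓ)
  open import Relation.Binary.Bundles using (StrictTotalOrder)
  open import Relation.Binary.PropositionalEquality hiding ([_])
  open import Relation.Nullary.Decidable using (does; dec-true; dec-false)
  open import Relation.Nullary.Negation using (contradiction)
  open Buffers
  open Machines
  open Survival using (<ᵇ-true; <ᵇ-false)

  -- The inputs n and k in cells 0 and 1 are counted down in place, as elements left to read and
  -- positions left to draw. Cell 2 holds the gap, and the buffer begins at cell 8.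
  pattern remaining = cell 0
  pattern quota     = cell 1
  pattern target       = cell 2
  pattern start     = cell 3
  pattern end       = cell 4
  pattern carry     = cell 5
  pattern pointer   = cell 6
  pattern temp      = cell 7
  pattern at-start   = cell[ 3 ]
  pattern at-end     = cell[ 4 ]
  pattern at-pointer = cell[ 6 ]

  jump : ℕ → Instr
  jump = jump< (lit (+ 0)) (lit (+ 1))

  -- The operands appear reversed with respect to `beats`, since larger elements have smaller
  -- indices.
  compare : Bool → ℕ → Instr
  compare true  = jump< (val at-pointer) (val carry)
  compare false = jump< (val carry) (val at-pointer)

  -- Carries the word in cell 5 through the buffer; p is the address of the first instruction.
  sweep : Bool → ℕ → List Instr
  sweep d p =
    copy pointer (val start) ∷
    jump< (val pointer) (val end) (3 + p) ∷
    -- Both phases share this exit: once nothing remains to be read, the test at 2 leads on to the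
    -- selection at 16.
    jump 2 ∷
    compare d (7 + p) ∷
    copy temp (val at-pointer) ∷
    copy at-pointer (val carry) ∷
    copy carry (val temp) ∷
    arith add pointer (val pointer) (lit (+ 1)) ∷
    jump (1 + p) ∷ []

  -- The main loop starts at 2, the final selection at 16, and the two sweeps at 22 and 31.  The thresholds
  -- depending on D are literals, which unlike stored words may exceed the word size.
  program : ℕ → List Instr
  program D =
    copy start (lit (+ 8)) ∷
    copy end (lit (+ 8)) ∷
    jump< (val remaining) (lit (+ 1)) 16 ∷
    read carry ∷
    random temp (val remaining) ∷
    arith sub remaining (val remaining) (lit (+ 1)) ∷
    jump< (val temp) (val quota) 8 ∷
    jump 10 ∷
    arith sub quota (val quota) (lit (+ 1)) ∷
    arith add target (val target) (lit (+ 1)) ∷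
    -- There is room while the end lies below 8 + (2 D + 1).
    jump< (val end) (lit (+ (9 + 2 * D))) 13 ∷
    jump< (val target) (lit (+ (2 + D))) 31 ∷
    jump 21 ∷
    copy at-end (val carry) ∷
    arith add end (val end) (lit (+ 1)) ∷
    jump 2 ∷
    copy carry (val at-start) ∷
    arith add start (val start) (lit (+ 1)) ∷
    jump< (val start) (val end) 20 ∷
    output (val carry) ∷
    jump< (val target) (lit (+ 2)) 31 ∷
    arith sub target (val target) (lit (+ 1)) ∷
    sweep true 22 ++ sweep false 31

  -- The argument `t` is the time of what follows the sweep. Seven steps per entry are spent when an
  -- exchange occurs; faster paths are padded with `weaken′`.
  sweepTime : ℕ → ℕ → ℕ
  sweepTime zero    t = 2 + t
  sweepTime (suc q) t = 7 + sweepTime q t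

  finishTime : ℕ → ℕ
  finishTime zero    = 4
  finishTime (suc q) = 6 + sweepTime (suc q) (1 + finishTime q)

  time : ℕ → ℕ → ℕ
  time D zero    = 1 + finishTime (2 * D)
  time D (suc N) = 12 + sweepTime (suc (2 * D)) (time D N)

  module Simulation
    (O : StrictTotalOrder 0ℓ 0ℓ 0ℓ) (W : ℕ) {n : ℕ} (D : ℕ) (s : ℕ)
    (x : Vector (StrictTotalOrder.Carrier O) n) (default : Fin n)
    (W-large : n + 60 ≤ W)
    (order : ∀ i j → does (StrictTotalOrder._<?_ O (x i) (x j)) ≡ (toℕ j <ᵇ toℕ i))
    where

    open StrictTotalOrder O using (Carrier; _<?_)
    open Machine O W
    open Model D default
    open Execution O W {s} (program D) x

    fits-small : ∀ {a} → a ≤ n + 60 → T (a ≤ᵇ W)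
    fits-small l = ≤⇒≤ᵇ (≤-trans l W-large)

    pc-fits : ∀ pc → T (pc ≤ᵇ 60) → T (pc ≤ᵇ W)
    pc-fits pc p = fits-small (≤-trans (≤ᵇ⇒≤ pc 60 p) (m≤n+m 60 n))

    open Rules pc-fits

    increment-rule : ∀ {t pc ws q a ws′ σ ρ} {small : T (pc ≤ᵇ 60)} →
      fetch pc ≡ just (arith add q (val q) (lit (+ 1))) → value ws (val q) ≡ just (int (+ a)) →
      suc a ≤ n + 60 → assign ws q (int (+ suc a)) ≡ just ws′ →
      RunsFrom t (suc pc) ws′ σ ρ → RunsFrom (suc t) pc ws σ ρ
    increment-rule {a = a} {small = small} f v l =
      arith-rule {small = small} f v refl (cong (λ b → just (int (+ b))) (+-comm a 1)) (fits-small l)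

    decrement-rule : ∀ {t pc ws q a ws′ σ ρ} {small : T (pc ≤ᵇ 60)} →
      fetch pc ≡ just (arith sub q (val q) (lit (+ 1))) → value ws (val q) ≡ just (int (+ a)) →
      1 ≤ a → a ≤ n + 60 → assign ws q (int (+ pred a)) ≡ just ws′ →
      RunsFrom t (suc pc) ws′ σ ρ → RunsFrom (suc t) pc ws σ ρ
    decrement-rule {a = suc a} {small = small} f v _ l =
      arith-rule {small = small} f v refl refl (fits-small (≤-trans (n≤1+n a) l))

    registers : (N K G S E : ℕ) (C I R : Word) → List Word → List Word
    registers N K G S E C I R buf =
      int (+ N) ∷ int (+ K) ∷ int (+ G) ∷ int (+ S) ∷ int (+ E) ∷ C ∷ I ∷ R ∷ buf

    elems : List (Fin n) → List Word
    elems = map λ i → elem (x i)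

    nth-++ : ∀ as {w bs} → nth (length as) (as ++ w ∷ bs) ≡ just w
    nth-++ []       = refl
    nth-++ (a ∷ as) = nth-++ as

    write-++ : ∀ as {v w bs} → write (length as) v (as ++ w ∷ bs) ≡ just (as ++ v ∷ bs)
    write-++ []       = refl
    write-++ (a ∷ as) {v} {w} {bs} rewrite write-++ as {v} {w} {bs} = refl

    write-buffer : ∀ {N K G S E C I R a} as {v w bs} → length as ≡ a →
      write (8 + a) v (registers N K G S E C I R (as ++ w ∷ bs)) ≡
      just (registers N K G S E C I R (as ++ v ∷ bs))
    write-buffer as {v} {w} {bs} refl rewrite write-++ as {v} {w} {bs} = refl

    compare-rule : ∀ {t pc l N K G S E a i j R buf σ ρ} d {small : T (pc ≤ᵇ 60)} →
      fetch pc ≡ just (compare d l) → nth a buf ≡ just (elem (x j)) →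
      RunsFrom t (if beats d i j then l else suc pc)
        (registers N K G S E (elem (x i)) (int (+ (8 + a))) R buf) σ ρ →
      RunsFrom (suc t) pc (registers N K G S E (elem (x i)) (int (+ (8 + a))) R buf) σ ρ
    compare-rule {i = i} {j} true  {small} f e r = jump-rule {small =
      small} f e refl (cong just (order j i)) r
    compare-rule {i = i} {j} false {small} f e r = jump-rule {small =
      small} f refl e (cong just (order i j)) r

    -- The sweep occurs at two addresses. Abstracting over what is fetched lets one proof serve
    -- both, and each assumption is then `refl`.
    module Sweep (d : Bool) (p : ℕ) (small : T (8 + p ≤ᵇ 60))
      (f₀ : fetch p ≡ just (copy pointer (val start)))
      (f₁ : fetch (1 + p) ≡ just (jump< (val pointer) (val end) (3 + p)))
      (f₂ : fetch (2 + p) ≡ just (jump 2))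
      (f₃ : fetch (3 + p) ≡ just (compare d (7 + p)))
      (f₄ : fetch (4 + p) ≡ just (copy temp (val at-pointer)))
      (f₅ : fetch (5 + p) ≡ just (copy at-pointer (val carry)))
      (f₆ : fetch (6 + p) ≡ just (copy carry (val temp)))
      (f₇ : fetch (7 + p) ≡ just (arith add pointer (val pointer) (lit (+ 1))))
      (f₈ : fetch (8 + p) ≡ just (jump (1 + p)))
      where

      private
        small′ : ∀ i → i ≤ 8 → T (i + p ≤ᵇ 60)
        small′ i l = ≤⇒≤ᵇ (≤-trans (+-monoˡ-≤ p l) (≤ᵇ⇒≤ (8 + p) 60 small))

      -- `as` holds all words before the pointer, even those before the start of the buffer, and
      -- `bs` the words from its end on. The continuation accepts any `C`, `I`, `R`, as these
      -- registers are rewritten before their next use.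
      loop : ∀ {t N K G S a e R buf σ ρ} as i js bs →
        length as ≡ a → a + length js ≡ e → buf ≡ as ++ elems js ++ bs → 8 + e ≤ n + 60 →
        (∀ {C I R buf′} → buf′ ≡ as ++ elems (kept d i js) ++ bs →
          RunsFrom t 2 (registers N K G S (8 + e) C I R buf′) σ ρ) →
        RunsFrom (sweepTime (length js) t) (1 + p)
          (registers N K G S (8 + e) (elem (x i)) (int (+ (8 + a))) R buf) σ ρ
      loop {a = a} as i [] bs refl refl eq l r =
        jump-rule {small = small′ 1 (≤ᵇ⇒≤ 1 8 _)} f₁ refl refl
          (cong just (dec-false (8 + a ℕ.<? 8 + (a + 0))
            (≤⇒≯ (≤-reflexive (cong (λ b → 8 + b) (+-identityʳ a))))))
          (jump-rule {small = small′ 2 (≤ᵇ⇒≤ 2 8 _)} f₂ refl refl refl (r eq))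
      loop {t} {N} {K} {G} {S} {a} {R = R} {σ = σ} {ρ} as i (j ∷ js) bs refl refl refl l r =
        jump-rule {small = small′ 1 (≤ᵇ⇒≤ 1 8 _)} f₁ refl refl
          (cong just (dec-true (8 + a ℕ.<? 8 + (a + suc (length js))) (m<m+n (8 + a) z<s)))
          (compare-rule d {small′ 3 (≤ᵇ⇒≤ 3 8 _)} f₃ (nth-++ as) (branch (beats d i j) refl))
        where
        e = a + suc (length js)


        continue : ∀ {j′ i′ R′} → elem (x j′) ∷ elems (kept d i′ js) ≡ elems (kept d i (j ∷ js)) →
          RunsFrom (2 + sweepTime (length js) t) (7 + p)
            (registers N K G S (8 + e) (elem (x i′)) (int (+ (8 + a))) R′
              (as ++ elem (x j′) ∷ elems js ++ bs)) σ ρ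
        continue {j′} {i′} {R′} eq =
          increment-rule {small = small′ 7 (≤ᵇ⇒≤ 7 8 _)} f₇ refl
            (≤-trans (m<m+n (8 + a) z<s) l) refl
          (jump-rule {small = small} f₈ refl refl refl
            (loop (as ++ [ elem (x j′) ]) i′ js bs
              (trans (length-++ as) (+-comm a 1)) (sym (+-suc a (length js)))
              (sym (++-assoc as _ _)) l
              λ eq′ → r (trans eq′ (trans (++-assoc as _ _) (cong (λ ws → as ++ ws ++ bs) eq)))))

        branch : ∀ b → beats d i j ≡ b → RunsFrom (5 + sweepTime (length js) t)
          (if b then 7 + p else 4 + p)
          (registers N K G S (8 + e) (elem (x i)) (int (+ (8 + a))) R
            (as ++ elem (x j) ∷ elems js ++ bs)) σ ρ
        branch true  b =
          weaken′ (m≤n+m _ 3) (continue (cong elems (sym (cong (λ b → if b then j ∷ kept d i js else i ∷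
            kept d j js) b))))
        branch false b =
          copy-rule {small = small′ 4 (≤ᵇ⇒≤ 4 8 _)} f₄ (nth-++ as) _ refl
          (copy-rule {small = small′ 5 (≤ᵇ⇒≤ 5 8 _)} f₅ refl _ (write-buffer as refl)
          (copy-rule {small = small′ 6 (≤ᵇ⇒≤ 6 8 _)} f₆ refl _ refl
            (continue (cong elems (sym (cong (λ b → if b then j ∷ kept d i js else i ∷ kept d j js)
              b))))))

      sweep-rule : ∀ {t N K G a q e C I R buf σ ρ} as i js bs →
        length as ≡ a → length js ≡ q → a + q ≡ e → buf ≡ as ++ elems js ++ bs → 8 + e ≤ n + 60 →
        C ≡ elem (x i) →
        (∀ {C I R buf′} → buf′ ≡ as ++ elems (kept d i js) ++ bs →
          RunsFrom t 2 (registers N K G (8 + a) (8 + e) C I R buf′) σ ρ) →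
        RunsFrom (1 + sweepTime q t) p
          (registers N K G (8 + a) (8 + e) C I R buf) σ ρ
      sweep-rule {a = a} as i js bs refl refl refl eq l refl r =
        copy-rule {small = small′ 0 z≤n} f₀ refl (fits-small (≤-trans (m≤m+n (8 + a) (length js)) l))
          refl
          (loop as i js bs refl refl eq l r)

    module MaxSweep = Sweep true  22 _ refl refl refl refl refl refl refl refl refl
    module MinSweep = Sweep false 31 _ refl refl refl refl refl refl refl refl refl

    kept-length : ∀ d i js → length (kept d i js) ≡ length js
    kept-length d i []       = refl
    kept-length d i (j ∷ js) with beats d i j
    ... | true  = cong suc (kept-length d i js)
    ... | false = cong suc (kept-length d j js)

    finish-min : ∀ {f G i k ks} js → (G <ᵇ 2) ≡ true → kept false i js ≡ k ∷ ks →
      finish (suc f) G i js ≡ finish f G k ks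
    finish-min js e e′ rewrite e | e′ = refl

    finish-max : ∀ {f G i k ks} js → (G <ᵇ 2) ≡ false → kept true i js ≡ k ∷ ks →
      finish (suc f) G i js ≡ finish f (pred G) k ks
    finish-max js e e′ rewrite e | e′ = refl

    -- Each round loads the front entry into the carry register and advances the start, so the freed
    -- cell joins `as` and the sweep leaves one entry fewer.
    finish-runs : ∀ {K G a e C I R buf} f as i js bs → G ≤ n → length js ≡ f → length as ≡ a →
      a + suc f ≡ e → buf ≡ as ++ elems (i ∷ js) ++ bs → 8 + e ≤ n + 60 →
      RunsFrom (finishTime f) 16 (registers 0 K G (8 + a) (8 + e) C I R buf) []
        (return (finish f G i js))
    finish-runs {a = a} zero as i [] bs G≤n refl refl refl refl l =
      copy-rule refl (nth-++ as) _ refl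
      (increment-rule refl refl (≤-trans (≤-reflexive (sym (cong (λ b → 8 + b) (+-comm a 1)))) l) refl
      (jump-rule refl refl refl
        (cong just (dec-false (9 + a ℕ.<? 8 + (a + 1))
          (≤⇒≯ (≤-reflexive (cong (λ b → 8 + b) (+-comm a 1))))))
      (output-rule refl refl)))
    finish-runs {K} {G} {a} {e} (suc f) as i js bs G≤n q refl refl refl l =
      copy-rule refl (nth-++ as) _ refl
      (increment-rule refl refl (≤-trans (m<m+n (8 + a) z<s) l) refl
      (jump-rule refl refl refl
        (cong just (dec-true (9 + a ℕ.<? 8 + e) (≤-trans (≤-reflexive (cong (λ b → 8 + b) (+-comm 2 a)))
          (+-monoʳ-≤ 8 (+-monoʳ-≤ a (s≤s (s≤s z≤n)))))))
      (jump-rule refl refl refl refl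
        (branch (G <ᵇ 2) refl))))
      where
      as′ = as ++ [ elem (x i) ]

      again : ∀ {C I R G′ buf′} ks → G′ ≤ n → length ks ≡ suc f → buf′ ≡ as′ ++ elems ks ++ bs →
        (ρ : Fin n) → (∀ k ks′ → ks ≡ k ∷ ks′ → finish f G′ k ks′ ≡ ρ) →
        RunsFrom (1 + finishTime f) 2 (registers 0 K G′ (9 + a) (8 + e) C I R buf′) [] (return ρ)
      again (k ∷ ks) G′≤n q eq ρ h =
        jump-rule refl refl refl refl
          (subst (λ z → RunsFrom _ 16 _ [] (return z)) (h k ks refl)
            (finish-runs f as′ k ks bs G′≤n (suc-injective q) (trans (length-++ as) (+-comm a 1))
              (sym (+-suc a (suc f))) eq l))

      branch : ∀ {I R} b → (G <ᵇ 2) ≡ b → RunsFrom (2 + sweepTime (suc f) (1 + finishTime f))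
        (if b then 31 else 21)
        (registers 0 K G (9 + a) (8 + e) (elem (x i)) I R (as ++ elems (i ∷ js) ++ bs)) []
        (return (finish (suc f) G i js))
      branch true eq = weaken′ (n≤1+n _)
        (MinSweep.sweep-rule as′ i js bs (trans (length-++ as) (+-comm a 1)) q (sym (+-suc a (suc f)))
          (sym (++-assoc as _ _)) l refl
          λ eq′ → again (kept false i js) G≤n (trans (kept-length false i js) q) eq′ _
            λ k ks e → sym (finish-min {f} {G} js eq e))
      branch false eq = decrement-rule refl refl (≤-trans (n≤1+n 1) 2≤G) (≤-trans G≤n (m≤m+n n 60)) refl
        (MaxSweep.sweep-rule as′ i js bs (trans (length-++ as) (+-comm a 1)) q (sym (+-suc a (suc f)))
          (sym (++-assoc as _ _)) l refl
          λ eq′ → again (kept true i js) (≤-trans (pred[n]≤n {G}) G≤n) (trans (kept-length true i js) q)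
            eq′ _
            λ k ks e → sym (finish-max {f} {G} js eq e))
        where
        2≤G : 2 ≤ G
        2≤G = <ᵇ-false G 2 eq

    finish-time-mono : ∀ {p q} → p ≤ q → finishTime p ≤ finishTime q
    finish-time-mono {q = q} z≤n = 4≤finish q
      where
      4≤finish : ∀ q → 4 ≤ finishTime q
      4≤finish zero    = ≤-refl
      4≤finish (suc q) = ≤-trans (≤ᵇ⇒≤ 4 6 _) (m≤m+n 6 _)
    finish-time-mono (s≤s l) = +-monoʳ-≤ 6 (sweep-time-mono (s≤s l) (s≤s (finish-time-mono l)))
      where
      sweep-time-mono : ∀ {p q t u} → p ≤ q → t ≤ u → sweepTime p t ≤ sweepTime q u
      sweep-time-mono (s≤s l) m = +-monoʳ-≤ 7 (sweep-time-mono l m)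
      sweep-time-mono {q = zero}  z≤n m = +-monoʳ-≤ 2 m
      sweep-time-mono {q = suc q} z≤n m = ≤-trans (sweep-time-mono {q = q} z≤n m) (m≤n+m _ 7)

    t≤sweepTime : ∀ q t → t ≤ sweepTime q t
    t≤sweepTime zero    t = m≤n+m t 2
    t≤sweepTime (suc q) t = ≤-trans (t≤sweepTime q t) (m≤n+m _ 7)

    -- The capacity depends on m, which is not bounded in terms of n; addresses fit into words
    -- because no more elements are stored than have been read. `nonempty` ensures that something is
    -- left to output.
    record Valid (N : ℕ) (s : State) (buf : List Word) : Set where
      constructor valid
      open State s
      field
        unused       : List Word
        contents     : buf ≡ elems buffer ++ unused
        size         : length buffer + length unused ≡ capacity
        stored≤n     : length buffer + N ≤ n
        gap+picks≤n  : gap + picks ≤ n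
        nonempty     : 1 ≤ length buffer + N

    at : ℕ → State → (C I R : Word) → List Word → List Word
    at N (state G K B) = registers N K G 8 (8 + length B)

    buffer-fits : ∀ {b N} → b + N ≤ n → 8 + b ≤ n + 60
    buffer-fits {b} {N} l =
      ≤-trans (≤-reflexive (+-comm 8 b)) (+-mono-≤ (≤-trans (m≤m+n b N) l) (≤ᵇ⇒≤ 8 60 _))

    move-end : ∀ {t pc N K G S a b C I R buf σ ρ} → a ≡ b →
      RunsFrom t pc (registers N K G S (8 + a) C I R buf) σ ρ →
      RunsFrom t pc (registers N K G S (8 + b) C I R buf) σ ρ
    move-end refl r = r

    insert-runs : ∀ {t N C I R buf σ ρ} G K i B bs →
      buf ≡ elems B ++ bs → length B + length bs ≡ capacity → length B + suc N ≤ n → G + K ≤ n →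
      C ≡ elem (x i) →
      (∀ {C I R buf′} → Valid N (insert G K i B) buf′ →
        RunsFrom t 2 (at N (insert G K i B) C I R buf′) σ ρ) →
      RunsFrom (5 + sweepTime capacity t) 10 (at N (state G K B) C I R buf) σ ρ
    insert-runs {t} {N} {C} {I} {R} {buf} {σ} {ρ} G K i B bs refl size l g refl r =
      jump-rule refl refl refl refl (branch (length B <ᵇ capacity) refl)
      where
      Continue : State → Set
      Continue s = ∀ {C I R buf′} → Valid N s buf′ → RunsFrom t 2 (at N s C I R buf′) σ ρ

      l′ : length B + N ≤ n
      l′ = ≤-trans (+-monoʳ-≤ (length B) (n≤1+n N)) l

      append : ∀ {C I R} bs → length B + length bs ≡ capacity → length B < capacity →
        Continue (state G K (B ++ [ i ])) →
        C ≡ elem (x i) → RunsFrom (3 + t) 13 (at N (state G K B) C I R (elems B ++ bs)) σ ρ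
      append [] size b r _ = contradiction (trans (sym (+-identityʳ _)) size) (<⇒≢ b)
      append (w ∷ bs) size b r refl =
        copy-rule refl refl _ (write-buffer (elems B) (length-map _ B))
        (increment-rule refl refl (buffer-fits 1+B+N≤n) refl
        (jump-rule refl refl refl refl
        (move-end length-B++i
          (r (valid bs contents′ (trans (cong (_+ length bs) length-B++i)
            (trans (sym (+-suc _ _)) size))
            (subst (λ b → b + N ≤ n) (sym length-B++i) 1+B+N≤n) g
            (subst (λ b → 1 ≤ b + N) (sym length-B++i) (s≤s z≤n)))))))
        where
        length-B++i : length (B ++ [ i ]) ≡ suc (length B)
        length-B++i = trans (length-++ B) (+-comm (length B) 1)
        1+B+N≤n : suc (length B) + N ≤ n
        1+B+N≤n = ≤-trans (≤-reflexive (sym (+-suc (length B) N))) l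
        contents′ : elems B ++ elem (x i) ∷ bs ≡ elems (B ++ [ i ]) ++ bs
        contents′ = sym (trans (cong (_++ bs) (map-++ _ B [ i ])) (++-assoc (elems B) _ bs))

      module _ (b : capacity ≤ length B) where

        full : length B ≡ capacity
        full = ≤-antisym (≤-trans (m≤m+n _ _) (≤-reflexive size)) b

        shrunk : ∀ d {G′} → G′ + K ≤ n → ∀ {buf′} → buf′ ≡ elems (kept d i B) ++ bs →
                 Valid N (state G′ K (kept d i B)) buf′
        shrunk d g eq = valid bs eq (trans (cong (_+ length bs) (kept-length d i B)) size)
          (subst (λ b → b + N ≤ n) (sym (kept-length d i B)) l′) g
          (subst (λ b → 1 ≤ b + N) (sym (trans (kept-length d i B) full)) (s≤s z≤n))

        resume : ∀ d {G′} → G′ + K ≤ n → Continue (state G′ K (kept d i B)) →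
          ∀ {C I R buf′} → buf′ ≡ elems (kept d i B) ++ bs →
          RunsFrom t 2 (registers N K G′ 8 (8 + length B) C I R buf′) σ ρ
        resume d g r eq = move-end
          (kept-length d i B) (r (shrunk d g eq))

        G≤ : G ≤ n + 60
        G≤ = ≤-trans (m≤m+n G K) (≤-trans g (m≤m+n n 60))

        evict : ∀ c → (G <ᵇ 2 + D) ≡ c →
          Continue (if c then state G K (kept false i B) else state (pred G) K (kept true i B)) →
          ∀ {I R} → RunsFrom (3 + sweepTime capacity t) (if c then 31 else 12)
            (registers N K G 8 (8 + length B) (elem (x i)) I R (elems B ++ bs)) σ ρ
        evict true  e r = weaken′ (m≤n+m _ 2)
          (MinSweep.sweep-rule [] i B bs refl full (sym full) refl (buffer-fits l′) refl (resume false g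
            r))
        evict false e r = jump-rule refl refl refl refl
          (decrement-rule refl refl (≤-trans (s≤s z≤n) (<ᵇ-false G (2 + D) e)) G≤ refl
          (MaxSweep.sweep-rule [] i B bs refl full (sym full) refl (buffer-fits l′) refl
            (resume true (≤-trans (+-monoˡ-≤ K (pred[n]≤n {G})) g) r)))

      branch : ∀ c → (length B <ᵇ capacity) ≡ c →
        RunsFrom (4 + sweepTime capacity t) (if c then 13 else 11)
          (at N (state G K B) (elem (x i)) I R (elems B ++ bs)) σ ρ
      branch true  e = weaken′ (+-mono-≤ (n≤1+n 3) (t≤sweepTime capacity t))
        (append bs size (<ᵇ-true _ _ e) (subst Continue (cong (λ c → if c then state G K (B ++
          [ i ]) else
          (if G <ᵇ 2 + D then state G K (kept false i B) else state (pred G) K (kept true i B))) e) r)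
            refl)
      branch false e =
        jump-rule refl refl refl refl
          (evict b (G <ᵇ 2 + D) refl (subst Continue (cong (λ c → if c then state G K (B ++ [ i ]) else
            (if G <ᵇ 2 + D then state G K (kept false i B) else state (pred G) K (kept true i B))) e)
              r))
        where b = <ᵇ-false _ _ e

    finish-from : ∀ {C I R buf} s → Valid 0 s buf →
      RunsFrom (finishTime (2 * D)) 16 (at 0 s C I R buf) [] (return (result s))
    finish-from (state G K []) (valid _ _ _ _ _ ())
    finish-from (state G K (i ∷ js)) (valid bs eq size l g _) =
      weaken′ (finish-time-mono (≤-trans (m≤m+n (length js) (length bs))
        (≤-reflexive (suc-injective size))))
        (finish-runs (length js) [] i js bs (≤-trans (m≤m+n G K) g) refl refl refl eq (buffer-fits l))

    -- The machine tosses once per element read, with the range that `simulate` uses, so the two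
    -- trees agree node by node.
    simulate-runs : ∀ {C I R buf} is s → Valid (length is) s buf →
      RunsFrom (time D (length is)) 2 (at (length is) s C I R buf) (map x is) (simulate s is)
    simulate-runs [] s v = jump-rule refl refl refl refl (finish-from s v)
    simulate-runs {C} {I} {R} {buf} (i ∷ is) s@(state G K B) (valid bs eq size l g _) =
      jump-rule refl refl refl refl
      (read-rule refl refl
      (random-rule (λ j → at (suc N) s (elem (x i)) I (int (+ toℕ j)) buf) refl refl
        (λ j → fits-small (≤-trans (<⇒≤ (Fin.toℕ<n j)) N≤)) (λ j → refl) λ j →
      decrement-rule refl refl (s≤s z≤n) N≤ refl
      (jump-rule refl refl refl refl
      (branch (toℕ j <ᵇ K) refl))))
      where
      N = length is

      N≤ : suc N ≤ n + 60
      N≤ = ≤-trans (m≤n+m _ (length B)) (≤-trans l (m≤m+n n 60))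

      small : ∀ {a} → a ≤ G + K → a ≤ n + 60
      small a≤ = ≤-trans a≤ (≤-trans g (m≤m+n n 60))

      branch : ∀ {R j} b → (j <ᵇ K) ≡ b →
        RunsFrom (7 + (sweepTime capacity (time D N))) (if b then 8 else 7)
          (at N s (elem (x i)) I R buf) (map x is) (simulate (next s i b) is)
      branch false _ = weaken′ (n≤1+n _) (jump-rule refl refl refl refl
        (insert-runs G K i B bs eq size l g refl (simulate-runs is (insert G K i B))))
      branch {j = j} true e =
        decrement-rule refl refl 1≤K (small (m≤n+m K G)) refl
        (increment-rule refl refl (small (≤-trans (≤-reflexive (+-comm 1 G)) (+-monoʳ-≤ G 1≤K))) refl
        (insert-runs (suc G) (pred K) i B bs eq size l
          (≤-trans (≤-reflexive (trans (sym (+-suc G (pred K))) (cong (λ b → G + b) (m+[n∸m]≡n 1≤K))))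
            g) refl
          (simulate-runs is (insert (suc G) (pred K) i B))))
        where
        1≤K : 1 ≤ K
        1≤K = ≤-trans (s≤s z≤n) (<ᵇ-true j K e)

    run-simulates : ∀ {k} is ws → length is ≤ n → 1 ≤ length is → k ≤ n → length ws ≡ capacity →
      RunsFrom (2 + time D (length is)) 0
        (registers (length is) k 0 0 0 (int (+ 0)) (int (+ 0)) (int (+ 0)) ws)
        (map x is) (simulate (state 0 k []) is)
    run-simulates {k} is ws l 1≤ k≤n size =
      copy-rule refl refl 8-fits refl
      (copy-rule refl refl 8-fits refl
      (simulate-runs is (state 0 k []) (valid ws refl size l k≤n 1≤)))
      where
      8-fits : T (8 ≤ᵇ W)
      8-fits = fits-small (≤-trans (≤ᵇ⇒≤ 8 60 _) (m≤n+m 60 n))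

-- Sums over random orders, and the reflection potential.

module Counting where

  open import Data.Bool.Base using (Bool; true; false)
  open import Data.Fin.Base using (Fin; toℕ; zero; suc)
  open import Data.List.Base using (List; []; _∷_; _++_; length; map; concatMap; tabulate)
  open import Data.List.Properties using (map-∘; map-cong; map-++)
  open import Data.List.Relation.Binary.Permutation.Propositional using (_↭_; ↭-trans; ↭-refl; ↭-prep; ↭-swap)
  open import Data.List.Relation.Unary.All as All using (All; []; _∷_)
  import Data.List.Relation.Unary.All.Properties as All
  open import Data.Nat.Base
  open import Data.Nat.Combinatorics using (_C_; nCk+nC[k+1]≡[n+1]C[k+1])
  open import Data.Nat.ListAction using (sum)
  open import Data.Nat.ListAction.Properties using (sum-++)
  open import Data.Nat.Properties
  open import Data.Nat.Tactic.RingSolver using (solve-∀)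
  open import Data.Product.Base using (_,_; _×_; proj₁)
  open import Data.Sum.Base using (_⊎_; inj₁; inj₂)
  open import Relation.Binary.PropositionalEquality hiding ([_])
  open import Function.Base using (_∘_)
  open Survival
  open Binomials

  weight-++ : ∀ {A : Set} (f : A → ℕ) xs ys → weight f (xs ++ ys) ≡ weight f xs + weight f ys
  weight-++ f xs ys = trans (cong sum (map-++ f xs ys)) (sum-++ (map f xs) (map f ys))

  weight-map : ∀ {A B : Set} (f : B → ℕ) (g : A → B) xs → weight f (map g xs) ≡ weight (f ∘ g) xs
  weight-map f g xs = cong sum (sym (map-∘ xs))

  weight-concatMap : ∀ {A B : Set} (f : B → ℕ) (g : A → List B) xs →
    weight f (concatMap g xs) ≡ weight (λ x → weight f (g x)) xs
  weight-concatMap f g []       = refl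
  weight-concatMap f g (x ∷ xs) = trans (weight-++ f (g x) (concatMap g xs))
    (cong (weight f (g x) +_) (weight-concatMap f g xs))

  weight-cong : ∀ {A : Set} {f g : A → ℕ} {xs} → All (λ x → f x ≡ g x) xs → weight f xs ≡ weight g xs
  weight-cong []       = refl
  weight-cong (e ∷ es) = cong₂ _+_ e (weight-cong es)

  weight-+ : ∀ {A : Set} (f g : A → ℕ) xs → weight (λ x → f x + g x) xs ≡ weight f xs + weight g xs
  weight-+ f g []       = refl
  weight-+ f g (x ∷ xs) = trans (cong (f x + g x +_) (weight-+ f g xs)) (l (f x) (g x) (weight f xs)
    (weight g xs))
    where
    l : ∀ a b c d → a + b + (c + d) ≡ a + c + (b + d)
    l = solve-∀

  weight-* : ∀ {A : Set} c (f : A → ℕ) xs → weight (λ x → c * f x) xs ≡ c * weight f xs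
  weight-* c f []       = sym (*-zeroʳ c)
  weight-* c f (x ∷ xs) = trans (cong (c * f x +_) (weight-* c f xs)) (sym (*-distribˡ-+ c (f x) _))

  selections : ∀ {A : Set} → List A → List (A × List A)
  selections []       = []
  selections (x ∷ xs) = (x , xs) ∷ map (λ (y , ys) → y , x ∷ ys) (selections xs)

  selections-↭ : ∀ {A : Set} (xs : List A) → All (λ (y , ys) → y ∷ ys ↭ xs) (selections xs)
  selections-↭ []       = []
  selections-↭ (x ∷ xs) = ↭-refl ∷ All.map⁺ (All.map (λ {(y , ys)} p → ↭-trans (↭-swap y x ↭-refl)
    (↭-prep x p)) (selections-↭ xs))

  selections-proj₁ : ∀ {A : Set} (xs : List A) → map proj₁ (selections xs) ≡ xs
  selections-proj₁ []       = refl
  selections-proj₁ (x ∷ xs) = cong (x ∷_) (trans (sym (map-∘ (selections xs))) (selections-proj₁ xs))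

  -- The first element of a random ordering is uniform, and the others are in random order.
  orderings-head : ∀ {A : Set} (f : List A → ℕ) x xs →
    weight f (orderings (x ∷ xs)) ≡
    weight (λ (y , ys) → weight (λ zs → f (y ∷ zs)) (orderings ys)) (selections (x ∷ xs))
  orderings-head {A} f x xs = begin
    weight f (concatMap (insertions x) (orderings xs))
      ≡⟨ weight-concatMap f (insertions x) (orderings xs) ⟩
    weight (λ zs → weight f (insertions x zs)) (orderings xs)
      ≡⟨ cong sum (map-cong split (orderings xs)) ⟩
    weight (λ zs → f (x ∷ zs) + later zs) (orderings xs)
      ≡⟨ weight-+ (λ zs → f (x ∷ zs)) later (orderings xs) ⟩
    weight (λ zs → f (x ∷ zs)) (orderings xs) + weight later (orderings xs)
      ≡⟨ cong (weight (λ zs → f (x ∷ zs)) (orderings xs) +_) (rest xs) ⟩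
    weight (λ zs → f (x ∷ zs)) (orderings xs) + weight h (map (λ (y , ys) → y , x ∷ ys) (selections xs))
      ∎
    where
    open ≡-Reasoning
    h : A × List A → ℕ
    h (y , ys) = weight (λ zs → f (y ∷ zs)) (orderings ys)

    -- Collects the insertions of `x` behind the head. Applying the induction hypothesis to `later`
    -- itself groups them by that head.
    later : List A → ℕ
    later []       = 0
    later (y ∷ zs) = weight (λ zs → f (y ∷ zs)) (insertions x zs)

    split : ∀ zs → weight f (insertions x zs) ≡ f (x ∷ zs) + later zs
    split []       = refl
    split (y ∷ zs) = cong (f (x ∷ y ∷ zs) +_) (weight-map f (y ∷_) (insertions x zs))

    rest : ∀ xs → weight later (orderings xs) ≡ weight h (map (λ (y , ys) → y , x ∷ ys) (selections xs))
    rest []       = refl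
    rest (x′ ∷ xs) = begin
      weight later (orderings (x′ ∷ xs))
        ≡⟨ orderings-head later x′ xs ⟩
      weight (λ (y , ys) → weight (λ zs → later (y ∷ zs)) (orderings ys)) (selections (x′ ∷ xs))
        ≡⟨ cong sum (map-cong (λ (y , ys) → weight-concatMap (λ zs → f (y ∷ zs)) (insertions x)
          (orderings ys)) (selections (x′ ∷ xs))) ⟨
      weight (λ (y , ys) → h (y , x ∷ ys)) (selections (x′ ∷ xs))
        ≡⟨ weight-map h (λ (y , ys) → y , x ∷ ys) (selections (x′ ∷ xs)) ⟨
      weight h (map (λ (y , ys) → y , x ∷ ys) (selections (x′ ∷ xs))) ∎

  orderings-lengths : ∀ {A : Set} (xs : List A) → All (λ zs → length zs ≡ length xs) (orderings xs)
  orderings-lengths []       = refl ∷ []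
  orderings-lengths (x ∷ xs) = All.concat⁺ (All.map⁺ (All.map
    (λ {ys} e → All.map (λ e′ → trans e′ (cong suc e)) (insertions-lengths x ys))
      (orderings-lengths xs)))

  sum-tabulate-const : ∀ n c → sum (tabulate {n = n} λ _ → c) ≡ n * c
  sum-tabulate-const zero    c = refl
  sum-tabulate-const (suc n) c = cong (c +_) (sum-tabulate-const n c)

  sum-threshold : ∀ K L (f : Bool → ℕ) →
    sum (tabulate {n = K + L} λ j → f (toℕ j <ᵇ K)) ≡ K * f true + L * f false
  sum-threshold zero    L f = sum-tabulate-const L (f false)
  sum-threshold (suc K) L f = trans (cong (f true +_) (sum-threshold K L f))
    (sym (+-assoc (f true) _ _))

  sum-tabulate-≤ : ∀ {n} (f : Fin n → ℕ) c → (∀ j → f j ≤ c) → sum (tabulate f) ≤ n * c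
  sum-tabulate-≤ {zero}  f c l = z≤n
  sum-tabulate-≤ {suc n} f c l = +-mono-≤ (l zero) (sum-tabulate-≤ (f ∘ suc) c (l ∘ suc))

  -- Of the N = K + L = K′ + L′ remaining elements K are among the top k, and K′ of their positions are
  -- still to be drawn.  The factor C(N, L′ + δ) stands for C(N, K′ − δ), without truncated subtraction.
  potential : (δ N K L K′ L′ : ℕ) → ℕ
  potential δ N K L K′ L′ = K ! * L ! * (K′ ! * L′ !) *
    ((N C (K + δ)) * (N C (L′ + δ)) + (N C (K′ + δ)) * (N C (L + δ)))

  module _ (D N K L K′ L′ : ℕ) where

    private
      δ = suc D
      a = K ! * L ! * (K′ ! * L′ !)
      c = N C_

    -- One of four moves, here a top element at a drawn position: the numbers of choices K and K′
    -- restore the factorials. If one of them is 0 the left side vanishes, so the truncated `pred`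
    -- does no harm, but only an inequality is left. The other three moves are alike.
    potential-step₁ : K * (K′ * potential δ N (pred K) L (pred K′) L′) ≤
      a * (c (K + D) * c (L′ + δ) + c (K′ + D) * c (L + δ))
    potential-step₁ = go K K′
      where
      go : ∀ K K′ → K * (K′ * potential δ N (pred K) L (pred K′) L′) ≤
        K ! * L ! * (K′ ! * L′ !) * (c (K + D) * c (L′ + δ) + c (K′ + D) * c (L + δ))
      go zero    K′     = z≤n
      go (suc K) zero   = ≤-trans (≤-reflexive (*-zeroʳ (suc K))) z≤n
      go (suc K) (suc K′) rewrite +-suc K D | +-suc K′ D =
        ≤-reflexive (l (suc K) (suc K′) (K !) (L !) (K′ !) (L′ !) _)
        where
        l : ∀ s s′ a b a′ b′ p → s * (s′ * (a * b * (a′ * b′) * p)) ≡ s * a * b * (s′ * a′ * b′) * p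
        l = solve-∀

    potential-step₂ : K * (L′ * potential δ N (pred K) L K′ (pred L′)) ≤
      a * (c (K + D) * c (L′ + D) + c (K′ + δ) * c (L + δ))
    potential-step₂ = go K L′
      where
      go : ∀ K L′ → K * (L′ * potential δ N (pred K) L K′ (pred L′)) ≤
        K ! * L ! * (K′ ! * L′ !) * (c (K + D) * c (L′ + D) + c (K′ + δ) * c (L + δ))
      go zero    L′     = z≤n
      go (suc K) zero   = ≤-trans (≤-reflexive (*-zeroʳ (suc K))) z≤n
      go (suc K) (suc L′) rewrite +-suc K D | +-suc L′ D =
        ≤-reflexive (l (suc K) (suc L′) (K !) (L !) (K′ !) (L′ !) _)
        where
        l : ∀ s s′ a b a′ b′ p → s * (s′ * (a * b * (a′ * b′) * p)) ≡ s * a * b * (a′ * (s′ * b′)) * p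
        l = solve-∀

    potential-step₃ : L * (K′ * potential δ N K (pred L) (pred K′) L′) ≤
      a * (c (K + δ) * c (L′ + δ) + c (K′ + D) * c (L + D))
    potential-step₃ = go L K′
      where
      go : ∀ L K′ → L * (K′ * potential δ N K (pred L) (pred K′) L′) ≤
        K ! * L ! * (K′ ! * L′ !) * (c (K + δ) * c (L′ + δ) + c (K′ + D) * c (L + D))
      go zero    K′     = z≤n
      go (suc L) zero   = ≤-trans (≤-reflexive (*-zeroʳ (suc L))) z≤n
      go (suc L) (suc K′) rewrite +-suc L D | +-suc K′ D =
        ≤-reflexive (l (suc L) (suc K′) (K !) (L !) (K′ !) (L′ !) _)
        where
        l : ∀ s s′ a b a′ b′ p → s * (s′ * (a * b * (a′ * b′) * p)) ≡ a * (s * b) * (s′ * a′ * b′) * p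
        l = solve-∀

    potential-step₄ : L * (L′ * potential δ N K (pred L) K′ (pred L′)) ≤
      a * (c (K + δ) * c (L′ + D) + c (K′ + δ) * c (L + D))
    potential-step₄ = go L L′
      where
      go : ∀ L L′ → L * (L′ * potential δ N K (pred L) K′ (pred L′)) ≤
        K ! * L ! * (K′ ! * L′ !) * (c (K + δ) * c (L′ + D) + c (K′ + δ) * c (L + D))
      go zero    L′     = z≤n
      go (suc L) zero   = ≤-trans (≤-reflexive (*-zeroʳ (suc L))) z≤n
      go (suc L) (suc L′) rewrite +-suc L D | +-suc L′ D =
        ≤-reflexive (l (suc L) (suc L′) (K !) (L !) (K′ !) (L′ !) _)
        where
        l : ∀ s s′ a b a′ b′ p → s * (s′ * (a * b * (a′ * b′) * p)) ≡ a * (s * b) * (a′ * (s′ * b′)) * p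
        l = solve-∀

    -- After the four steps all terms share the factor a, and the products of binomial coefficients
    -- factor into Pascal sums. Divided by (N + 1)!², the result is that the potential over N!² does
    -- not increase on average when one element is read.
    potential-harmonic :
      K * (K′ * potential δ N (pred K) L (pred K′) L′ + L′ * potential δ N (pred K) L K′ (pred L′)) +
      L * (K′ * potential δ N K (pred L) (pred K′) L′ + L′ * potential δ N K (pred L) K′ (pred L′)) ≤
      potential δ (suc N) K L K′ L′
    potential-harmonic = begin
      _ ≡⟨ cong₂ _+_ (*-distribˡ-+ K _ _) (*-distribˡ-+ L _ _) ⟩
      _
        ≤⟨ +-mono-≤ (+-mono-≤ potential-step₁ potential-step₂)
          (+-mono-≤ potential-step₃ potential-step₄) ⟩
      _
        ≡⟨ l a (c (K + D)) (c (K + δ)) (c (L′ + D)) (c (L′ + δ)) (c (K′ + D)) (c (K′ + δ)) (c (L + D))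
          (c (L + δ)) ⟩
      a * ((c (K + D) + c (K + δ)) * (c (L′ + D) + c (L′ + δ)) + (c (K′ + D) + c (K′ + δ)) *
        (c (L + D) + c (L + δ)))
        ≡⟨ cong (a *_) (cong₂ _+_ (cong₂ _*_ (pascal K) (pascal L′)) (cong₂ _*_ (pascal K′)
          (pascal L))) ⟩
      potential δ (suc N) K L K′ L′ ∎
      where
      open ≤-Reasoning
      pascal : ∀ i → c (i + D) + c (i + δ) ≡ suc N C (i + δ)
      pascal i rewrite +-suc i D = nCk+nC[k+1]≡[n+1]C[k+1] N (i + D)
      l : ∀ a k k₁ l′ l′₁ k′ k′₁ l l₁ →
        a * (k * l′₁ + k′ * l₁) + a * (k * l′ + k′₁ * l₁) + (a * (k₁ * l′₁ + k′ * l) + a *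
          (k₁ * l′ + k′₁ * l)) ≡
        a * ((k + k₁) * (l′ + l′₁) + (k′ + k′₁) * (l + l₁))
      l = solve-∀

  C-factorial′ : ∀ {N} K L → K + L ≡ N → (N C K) * (K ! * L !) ≡ N !
  C-factorial′ K L refl = C-factorial K L

  -- On the boundary the product of binomial coefficients is C(N, K) C(N, K′).
  potential-boundary : ∀ δ {N} K L K′ L′ → K + L ≡ N → K′ + L′ ≡ N → K′ ≡ K + δ ⊎ K ≡ K′ + δ →
    N ! * N ! ≤ potential δ N K L K′ L′
  potential-boundary δ {N} K L K′ L′ e e′ (inj₁ refl) = begin
    N ! * N !   ≡⟨ cong₂ _*_ (C-factorial′ K′ L′ e′) (C-factorial′ L K (trans (+-comm L K) e)) ⟨
    (N C K′) * (K′ ! * L′ !) * ((N C L) * (L ! * K !)) ≡⟨ l (N C K′) (N C L) (K !) (L !) (K′ ! * L′ !) ⟩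
    K ! * L ! * (K′ ! * L′ !) * ((N C K′) * (N C L))
      ≡⟨ cong (λ i → K ! * L ! * (K′ ! * L′ !) * ((N C K′) * (N C i))) L≡ ⟩
    K ! * L ! * (K′ ! * L′ !) * ((N C K′) * (N C (L′ + δ)))
      ≤⟨ *-monoʳ-≤ (K ! * L ! * (K′ ! * L′ !)) (m≤m+n _ _) ⟩
    potential δ N K L K′ L′ ∎
    where
    open ≤-Reasoning
    L≡ : L ≡ L′ + δ
    L≡ = +-cancelˡ-≡ K _ _ (trans e (trans (sym e′) (trans (+-assoc K δ L′)
      (cong (K +_) (+-comm δ L′)))))
    l : ∀ p q k l r → p * r * (q * (l * k)) ≡ k * l * r * (p * q)
    l = solve-∀
  potential-boundary δ {N} K L K′ L′ e e′ (inj₂ refl) = begin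
    N ! * N !   ≡⟨ cong₂ _*_ (C-factorial′ K L e) (C-factorial′ L′ K′ (trans (+-comm L′ K′) e′)) ⟨
    (N C K) * (K ! * L !) * ((N C L′) * (L′ ! * K′ !)) ≡⟨ l (N C K) (N C L′) (K ! * L !) (K′ !) (L′ !) ⟩
    K ! * L ! * (K′ ! * L′ !) * ((N C K) * (N C L′))
      ≡⟨ cong (λ i → K ! * L ! * (K′ ! * L′ !) * ((N C K) * (N C i))) L′≡ ⟩
    K ! * L ! * (K′ ! * L′ !) * ((N C K) * (N C (L + δ)))
      ≤⟨ *-monoʳ-≤ (K ! * L ! * (K′ ! * L′ !)) (m≤n+m _ _) ⟩
    potential δ N K L K′ L′ ∎
    where
    open ≤-Reasoning
    L′≡ : L′ ≡ L + δ
    L′≡ = +-cancelˡ-≡ K′ _ _ (trans e′ (trans (sym e) (trans (+-assoc K′ δ L)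
      (cong (K′ +_) (+-comm δ L)))))
    l : ∀ p q r k l → p * r * (q * (l * k)) ≡ r * (k * l) * (p * q)
    l = solve-∀

-- The number of failing outcomes is at most the potential.

module Failures where

  open import Data.Bool.Base using (Bool; true; false; not)
  open import Data.Fin.Base using (Fin; toℕ; zero; suc)
  open import Data.List.Base using (List; []; _∷_; length; map; tabulate)
  open import Data.List.Relation.Binary.Permutation.Propositional using (_↭_)
  open import Data.List.Relation.Binary.Permutation.Propositional.Properties using (↭-length)
  open import Data.List.Relation.Unary.All as All using ([]; _∷_)
  open import Data.Nat.Base
  open import Data.Nat.ListAction using (sum)
  open import Data.Nat.Properties
  open import Data.Nat.Tactic.RingSolver using (solve-∀)
  open import Data.Product.Base using (_,_; proj₁)
  open import Data.Sum.Base using (inj₁; inj₂)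
  open import Relation.Binary.PropositionalEquality hiding ([_])
  open import Relation.Nullary.Decidable using (yes; no)
  open import Function.Base using (_∘_)
  open Buffers
  open Survival
  open Counting

  module Failure {n : ℕ} (D : ℕ) (κ : Fin n) where

    open Model D κ
    open Correctness D κ

    δ = suc D

    -- The tosses have ranges N, N - 1, ..., 1, so their N! outcomes are equally likely and failures
    -- can be counted in ℕ.
    misses : State → List (Fin n) → ℕ
    misses s []       = indicator (not (isTarget (result s)))
    misses s (i ∷ is) = sum (tabulate {n = suc (length is)} λ j →
      misses (next s i (toℕ j <ᵇ State.picks s)) is)

    totalMisses : State → List (Fin n) → ℕ
    totalMisses s is = weight (misses s) (orderings is)

    misses≤! : ∀ s is → misses s is ≤ length is !
    misses≤! s [] with isTarget (result s)
    ... | true  = z≤n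
    ... | false = ≤-refl
    misses≤! s (i ∷ is) = sum-tabulate-≤ {suc (length is)} _ (length is !) λ j →
      misses≤! (next s i (toℕ j <ᵇ State.picks s)) is

    totalMisses≤!² : ∀ s is → totalMisses s is ≤ length is ! * length is !
    totalMisses≤!² s is = begin
      weight (misses s) (orderings is)
        ≤⟨ weight-mono (All.map (λ {σ} e → ≤-trans (misses≤! s σ) (≤-reflexive (cong _! e)))
          (orderings-lengths is)) ⟩
      weight (λ _ → length is !) (orderings is)      ≡⟨ weight-const (length is !) (orderings is) ⟩
      length (orderings is) * length is !            ≡⟨ cong (_* length is !) (length-orderings is) ⟩
      length is ! * length is !                      ∎
      where open ≤-Reasoning

    others : List (Fin n) → ℕ
    others = weight λ i → indicator (not (isTop i))

    tops+others : ∀ is → tops is + others is ≡ length is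
    tops+others []       = refl
    tops+others (i ∷ is) with isTop i
    ... | true  = cong suc (tops+others is)
    ... | false = trans (+-suc (tops is) (others is)) (cong suc (tops+others is))

    weight-isTop : ∀ (h : Bool → ℕ) is → weight (h ∘ isTop) is ≡ tops is * h true + others is * h false
    weight-isTop h []       = refl
    weight-isTop h (i ∷ is) with isTop i
    ... | true  = trans (cong (h true +_) (weight-isTop h is)) (sym (+-assoc (h true) _ _))
    ... | false = trans (cong (h false +_) (weight-isTop h is)) (l (h false) (tops is * h true) _)
      where
      l : ∀ a b c → a + (b + c) ≡ b + (a + c)
      l = solve-∀

    totalMisses-head : ∀ s i is L → State.picks s + L ≡ suc (length is) → totalMisses s (i ∷ is) ≡
      weight (λ (j , js) →
          State.picks s * totalMisses (next s j true) js + L * totalMisses (next s j false) js)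
        (selections (i ∷ is))
    totalMisses-head s i is L e = trans (orderings-head (misses s) i is)
      (weight-cong (All.map (λ {(j , js)} p → average j js (suc-injective (↭-length p)))
        (selections-↭ (i ∷ is))))
      where
      K = State.picks s
      average : ∀ j js → length js ≡ length is → weight (λ σ → misses s (j ∷ σ)) (orderings js) ≡
        K * totalMisses (next s j true) js + L * totalMisses (next s j false) js
      average j js e′ = begin
        weight (λ σ → misses s (j ∷ σ)) (orderings js)
          ≡⟨ weight-cong (All.map (λ {σ} e″ → choose σ (trans e (cong suc (sym (trans e″ e′)))))
            (orderings-lengths js)) ⟩
        weight (λ σ → K * misses (next s j true) σ + L * misses (next s j false) σ) (orderings js)
          ≡⟨ weight-+ (λ σ → K * misses (next s j true) σ) (λ σ → L * misses (next s j false) σ)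
            (orderings js) ⟩
        weight (λ σ → K * misses (next s j true) σ) (orderings js) +
        weight (λ σ → L * misses (next s j false) σ) (orderings js)
          ≡⟨ cong₂ _+_ (weight-* K (misses (next s j true)) (orderings js))
            (weight-* L (misses (next s j false)) (orderings js)) ⟩
        K * totalMisses (next s j true) js + L * totalMisses (next s j false) js ∎
        where
        open ≡-Reasoning
        choose : ∀ σ → K + L ≡ suc (length σ) →
          misses s (j ∷ σ) ≡ K * misses (next s j true) σ + L * misses (next s j false) σ
        choose σ eq = trans (cong (λ N → sum (tabulate {n = N} λ r → misses (next s j (toℕ r <ᵇ K)) σ))
          (sym eq))
          (sum-threshold K L (λ b → misses (next s j b) σ))

    next-picks-true : ∀ s i → State.picks (next s i true) ≡ pred (State.picks s)
    next-picks-true (state G K B) i with length B <ᵇ capacity | suc G <ᵇ 2 + D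
    ... | true  | _     = refl
    ... | false | true  = refl
    ... | false | false = refl

    next-picks-false : ∀ s i → State.picks (next s i false) ≡ State.picks s
    next-picks-false (state G K B) i with length B <ᵇ capacity | G <ᵇ 2 + D
    ... | true  | _     = refl
    ... | false | true  = refl
    ... | false | false = refl

    -- Goodness is only needed while the picks track the tops to within D.
    Tracked : State → List (Fin n) → Set
    Tracked s is = tops is ≤ State.picks s + D → State.picks s ≤ tops is + D → Good s is

    near : ∀ {a b} → a ≤ b + δ → a ≢ b + δ → a ≤ b + D
    near {a} {b} l ne = s≤s⁻¹ (≤-trans (≤∧≢⇒< l ne) (≤-reflexive (+-suc b D)))

    -- An optional stopping argument. Where the counts differ by δ, all N!² outcomes are given up,
    -- and the potential covers them; strictly inside, `potential-harmonic` carries the bound over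
    -- one step; and a run that ends inside outputs the target.
    totalMisses≤potential : ∀ N is s L′ → length is ≡ N → State.picks s + L′ ≡ N →
      tops is ≤ State.picks s + δ → State.picks s ≤ tops is + δ → Tracked s is →
      totalMisses s is ≤ potential δ N (tops is) (others is) (State.picks s) L′
    totalMisses≤potential N is s L′ len e low high tracked
      with State.picks s ≟ tops is + δ | tops is ≟ State.picks s + δ
    ... | yes b | _ = ≤-trans (totalMisses≤!² s is) (≤-trans (≤-reflexive (cong (λ N → N ! * N !) len))
      (potential-boundary δ (tops is) (others is) (State.picks s) L′ (trans (tops+others is) len) e
        (inj₁ b)))
    ... | no _ | yes b = ≤-trans (totalMisses≤!² s is)
      (≤-trans (≤-reflexive (cong (λ N → N ! * N !) len))
      (potential-boundary δ (tops is) (others is) (State.picks s) L′ (trans (tops+others is) len) e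
        (inj₂ b)))
    totalMisses≤potential zero [] s@(state G zero B) zero len e low high tracked | no _ | no _ =
      ≤-trans (≤-reflexive (trans (+-identityʳ _) (cong (indicator ∘ not)
        (result-target G B (tracked z≤n z≤n))))) z≤n
    totalMisses≤potential (suc N) is@(i ∷ is₁) s@(state G K′ B) L′ len e low high tracked
      | no ne₁ | no ne₂ = begin
      totalMisses s is
        ≡⟨ totalMisses-head s i is₁ L′ (trans e (sym len)) ⟩
      weight (λ (j , js) → K′ * totalMisses (next s j true) js + L′ * totalMisses (next s j false) js)
        (selections is)
        ≤⟨ weight-mono (All.map (λ {(j , js)} p → branch j js p) (selections-↭ is)) ⟩
      weight (h ∘ isTop ∘ proj₁) (selections is)
        ≡⟨ trans (sym (weight-map (h ∘ isTop) proj₁ (selections is))) (cong (weight (h ∘ isTop))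
          (selections-proj₁ is)) ⟩
      weight (h ∘ isTop) is
        ≡⟨ weight-isTop h is ⟩
      K * h true + L * h false
        ≤⟨ potential-harmonic D N K L K′ L′ ⟩
      potential δ (suc N) K L K′ L′ ∎
      where
      open ≤-Reasoning
      K = tops is
      L = others is

      h : Bool → ℕ
      h true  = K′ * potential δ N (pred K) L (pred K′) L′ + L′ * potential δ N (pred K) L K′ (pred L′)
      h false = K′ * potential δ N K (pred L) (pred K′) L′ + L′ * potential δ N K (pred L) K′ (pred L′)

      low′ : K ≤ K′ + D
      low′ = near low ne₂
      high′ : K′ ≤ K + D
      high′ = near high ne₁

      module _ (j : Fin n) (js : List (Fin n)) (p : j ∷ js ↭ is) where

        topW = indicator (isTop j)

        tops-js : topW + tops js ≡ K
        tops-js = weight-↭ _ p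
        others-js : indicator (not (isTop j)) + others js ≡ L
        others-js = weight-↭ _ p

        topW≤1 : topW ≤ 1
        topW≤1 with isTop j
        ... | true  = ≤-refl
        ... | false = z≤n

        length-js : length js ≡ N
        length-js = suc-injective (trans (↭-length p) len)

        tops-js≤ : tops js ≤ K
        tops-js≤ = ≤-trans (m≤n+m (tops js) topW) (≤-reflexive tops-js)

        ≤tops-js : K ≤ suc (tops js)
        ≤tops-js = ≤-trans (≤-reflexive (sym tops-js)) (+-monoˡ-≤ (tops js) topW≤1)

        open Good (tracked low′ high′)

        targets′ : targets (j ∷ B) + targets js ≡ 1
        targets′ = trans (trans (shuffle (indicator (isTarget j)) (targets B) (targets js))
          (cong (targets B +_) (weight-↭ _ p))) unlost
          where
          shuffle : ∀ a b c → a + b + c ≡ b + (a + c)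
          shuffle = solve-∀

        tops′ : tops (j ∷ B) + tops js ≡ K′ + G
        tops′ = trans (trans (shuffle topW (tops B) (tops js)) (cong (tops B +_) tops-js)) position
          where
          shuffle : ∀ a b c → a + b + c ≡ b + (a + c)
          shuffle = solve-∀

        pick-bound : ∀ K₁ → K′ ≡ suc K₁ → totalMisses (next s j true) js ≤ potential δ N (tops js)
          (others js) K₁ L′
        pick-bound K₁ refl = subst (λ K₂ → totalMisses (next s j true) js ≤ potential δ N (tops js)
          (others js) K₂ L′)
          (next-picks-true s j)
          (totalMisses≤potential N js (next s j true) L′ length-js
            (trans (cong (_+ L′) (next-picks-true s j)) (suc-injective e))
            (subst (λ K₂ → tops js ≤ K₂ + δ) (sym (next-picks-true s j))
              (≤-trans tops-js≤ (≤-trans low′ (≤-reflexive (sym (+-suc K₁ D))))))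
            (subst (λ K₂ → K₂ ≤ tops js + δ) (sym (next-picks-true s j))
              (≤-trans (s≤s⁻¹ (≤-trans high′ (+-monoˡ-≤ D ≤tops-js))) (+-monoʳ-≤ (tops js) (n≤1+n D))))
            (subst (λ K₂ → tops js ≤ K₂ + D → K₂ ≤ tops js + D → Good (next s j true) js)
              (sym (next-picks-true s j))
              -- The bounds asked for by `insert-good` remain premises. Where they fail, the next
              -- state lies on the boundary and goodness is no longer consulted.
              (insert-good (suc G) K₁ j B js (trans tops′ (sym (+-suc K₁ G))) targets′)))

        skip-bound : ∀ L₁ → L′ ≡ suc L₁ → totalMisses (next s j false) js ≤ potential δ N (tops js)
          (others js) K′ L₁
        skip-bound L₁ refl = subst (λ K₂ → totalMisses (next s j false) js ≤ potential δ N (tops js)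
          (others js) K₂ L₁)
          (next-picks-false s j)
          (totalMisses≤potential N js (next s j false) L₁ length-js
            (trans (cong (_+ L₁) (next-picks-false s j)) (suc-injective (trans (sym (+-suc K′ L₁)) e)))
            (subst (λ K₂ → tops js ≤ K₂ + δ) (sym (next-picks-false s j)) (≤-trans tops-js≤ low))
            (subst (λ K₂ → K₂ ≤ tops js + δ) (sym (next-picks-false s j))
              (≤-trans high′ (≤-trans (+-monoˡ-≤ D ≤tops-js) (≤-reflexive (sym (+-suc (tops js) D))))))
            (subst (λ K₂ → tops js ≤ K₂ + D → K₂ ≤ tops js + D → Good (next s j false) js)
              (sym (next-picks-false s j))
              (insert-good G K′ j B js tops′ targets′)))

        bound-with : ℕ → ℕ → ℕ
        bound-with k l = K′ * potential δ N k l (pred K′) L′ + L′ * potential δ N k l K′ (pred L′)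

        branch′ : K′ * totalMisses (next s j true) js + L′ * totalMisses (next s j false) js ≤
                 bound-with (tops js) (others js)
        branch′ = +-mono-≤ (scaled K′ pick-bound) (scaled L′ skip-bound)
          where
          scaled : ∀ m {x} {f : ℕ → ℕ} → (∀ m₁ → m ≡ suc m₁ → x ≤ f m₁) → m * x ≤ m * f (pred m)
          scaled zero    l = z≤n
          scaled (suc m) l = *-monoʳ-≤ (suc m) (l m refl)

        branch : K′ * totalMisses (next s j true) js + L′ * totalMisses (next s j false) js ≤
          h (isTop j)
        branch with isTop j | tops-js | others-js
        ... | true  | t | o = ≤-trans branch′ (≤-reflexive (cong₂ bound-with (cong pred t) o))
        ... | false | t | o = ≤-trans branch′ (≤-reflexive (cong₂ bound-with t (cong pred o)))

-- Decay of the reflected binomial products.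

module Decay where

  open import Data.Nat.Base
  open import Data.Nat.Combinatorics using (_C_; k>n⇒nCk≡0)
  open import Data.Nat.Properties
  open import Data.Nat.Tactic.RingSolver using (solve-∀)
  open import Relation.Binary.PropositionalEquality
  open Binomials
  open Counting using (potential; C-factorial′)

  module _ (k l : ℕ) where

    private n = k + l

    spread : ℕ → ℕ
    spread i = (n C (k + i)) * (n C (l + i))

    -- By absorption the quotient of consecutive values is (l - i) / (k + i + 1) times (k - i) / (l
    -- + i + 1), with truncated subtraction. Pairing the numerators the other way gives factors of
    -- at most 1 and k / (k + i + 1).
    spread-step : ∀ i → spread (suc i) * suc (k + i) ≤ spread i * k
    spread-step i = *-cancelʳ-≤ _ _ (suc (l + i)) (begin
      (n C (k + suc i)) * (n C (l + suc i)) * suc (k + i) * suc (l + i)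
        ≡⟨ cong₂ (λ a b → (n C a) * (n C b) * suc (k + i) * suc (l + i)) (+-suc k i) (+-suc l i) ⟩
      (n C suc (k + i)) * (n C suc (l + i)) * suc (k + i) * suc (l + i)
        ≡⟨ l₁ (n C suc (k + i)) (n C suc (l + i)) (suc (k + i)) (suc (l + i)) ⟩
      suc (k + i) * (n C suc (k + i)) * (suc (l + i) * (n C suc (l + i)))
        ≡⟨ cong₂ _*_ (C-absorb n (k + i)) (C-absorb n (l + i)) ⟩
      (n ∸ (k + i)) * (n C (k + i)) * ((n ∸ (l + i)) * (n C (l + i)))
        ≡⟨ l₂ (n ∸ (k + i)) (n ∸ (l + i)) (n C (k + i)) (n C (l + i)) ⟩
      spread i * ((n ∸ (l + i)) * (n ∸ (k + i)))
        ≤⟨ *-monoʳ-≤ (spread i) (*-mono-≤ n∸≤k n∸≤l) ⟩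
      spread i * (k * suc (l + i))
        ≡⟨ *-assoc (spread i) k (suc (l + i)) ⟨
      spread i * k * suc (l + i) ∎)
      where
      open ≤-Reasoning
      n∸≤k : n ∸ (l + i) ≤ k
      n∸≤k = ≤-trans (∸-monoʳ-≤ n (m≤m+n l i)) (≤-reflexive (m+n∸n≡m k l))
      n∸≤l : n ∸ (k + i) ≤ suc (l + i)
      n∸≤l = ≤-trans (∸-monoʳ-≤ n (m≤m+n k i)) (≤-trans (≤-reflexive (m+n∸m≡n k l))
        (m≤n⇒m≤1+n (m≤m+n l i)))
      l₁ : ∀ c d s t → c * d * s * t ≡ s * c * (t * d)
      l₁ = solve-∀
      l₂ : ∀ u v c d → u * c * (v * d) ≡ c * d * (v * u)
      l₂ = solve-∀

    spread-anti : ∀ i → spread i ≤ spread 0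
    spread-anti zero    = ≤-refl
    spread-anti (suc i) = ≤-trans (*-cancelʳ-≤ _ _ (suc (k + i))
      (≤-trans (spread-step i) (*-monoʳ-≤ (spread i) (m≤n⇒m≤1+n (m≤m+n k i))))) (spread-anti i)

    -- From index m on every denominator k + i + 1 exceeds k + m, so each step gains the same
    -- factor.
    spread-decay : ∀ m j → spread (m + j) * (k + m) ^ j ≤ spread m * k ^ j
    spread-decay m zero    = ≤-reflexive (cong (λ i → spread i * 1) (+-identityʳ m))
    spread-decay m (suc j) = begin
      spread (m + suc j) * ((k + m) * (k + m) ^ j)
        ≡⟨ cong (λ i → spread i * ((k + m) * (k + m) ^ j)) (+-suc m j) ⟩
      spread (suc (m + j)) * ((k + m) * (k + m) ^ j)   ≡⟨ *-assoc (spread (suc (m + j))) (k + m) _ ⟨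
      spread (suc (m + j)) * (k + m) * (k + m) ^ j
        ≤⟨ *-monoˡ-≤ ((k + m) ^ j) (*-monoʳ-≤ (spread (suc (m + j)))
          (m≤n⇒m≤1+n (+-monoʳ-≤ k (m≤m+n m j)))) ⟩
      spread (suc (m + j)) * suc (k + (m + j)) * (k + m) ^ j
        ≤⟨ *-monoˡ-≤ ((k + m) ^ j) (spread-step (m + j)) ⟩
      spread (m + j) * k * (k + m) ^ j                 ≡⟨ l₁ (spread (m + j)) k ((k + m) ^ j) ⟩
      spread (m + j) * (k + m) ^ j * k                 ≤⟨ *-monoˡ-≤ k (spread-decay m j) ⟩
      spread m * k ^ j * k                             ≡⟨ l₂ (spread m) k (k ^ j) ⟩
      spread m * (k * k ^ j)                           ∎
      where
      open ≤-Reasoning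
      l₁ : ∀ a k p → a * k * p ≡ a * p * k
      l₁ = solve-∀
      l₂ : ∀ a k p → a * p * k ≡ a * (k * p)
      l₂ = solve-∀

    -- Here l + δ exceeds n, and C(n, l + δ) occurs in both products.
    potential-zero : ∀ {δ} → k < δ → potential δ n k l k l ≡ 0
    potential-zero {δ} k<δ rewrite k>n⇒nCk≡0 {n} {l + δ} (≤-trans (≤-reflexive (cong suc (+-comm k l)))
      (≤-trans (≤-reflexive (sym (+-suc l k))) (+-monoʳ-≤ l k<δ)))
      | *-zeroʳ (n C (k + δ)) = *-zeroʳ (k ! * l ! * (k ! * l !))

    -- With equal counts the two directions coincide, whence the 2. The first m steps use only that
    -- `spread` decreases, and `spread 0` with the factorials is n!².
    potential-decay : ∀ m → potential (m + m) n k l k l * (k + m) ^ m ≤ 2 * (n ! * n !) * k ^ m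
    potential-decay m = begin
      a * (spread (m + m) + spread (m + m)) * (k + m) ^ m   ≡⟨ l₁ a (spread (m + m)) ((k + m) ^ m) ⟩
      2 * a * (spread (m + m) * (k + m) ^ m)                ≤⟨ *-monoʳ-≤ (2 * a) (spread-decay m m) ⟩
      2 * a * (spread m * k ^ m)
        ≤⟨ *-monoʳ-≤ (2 * a) (*-monoˡ-≤ (k ^ m) (spread-anti m)) ⟩
      2 * a * (spread 0 * k ^ m)
        ≡⟨ l₂ (k !) (l !) (n C (k + 0)) (n C (l + 0)) (k ^ m) ⟩
      2 * ((n C (k + 0)) * (k ! * l !) * ((n C (l + 0)) * (l ! * k !))) * k ^ m
        ≡⟨ cong₂ (λ x y → 2 * (x * y) * k ^ m)
             (trans (cong (λ i → (n C i) * (k ! * l !)) (+-identityʳ k)) (C-factorial′ k l refl))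
             (trans (cong (λ i → (n C i) * (l ! * k !)) (+-identityʳ l))
               (C-factorial′ l k (+-comm l k))) ⟩
      2 * (n ! * n !) * k ^ m                               ∎
      where
      open ≤-Reasoning
      a = k ! * l ! * (k ! * l !)
      l₁ : ∀ a s p → a * (s + s) * p ≡ 2 * a * (s * p)
      l₁ = solve-∀
      l₂ : ∀ k l c d p → 2 * (k * l * (k * l)) * (c * d * p) ≡ 2 * (c * (k * l) * (d * (l * k))) * p
      l₂ = solve-∀

-- From counted failures to the success probability and the memory bound.

module Analyses where

  open import Data.Bool.Base using (true; false)
  open import Data.Fin.Base as Fin using (Fin; toℕ; fromℕ<; zero; suc)
  import Data.Fin.Properties as Fin
  open import Data.Integer.Base using (+_)
  open import Data.List.Base using (List; []; _∷_; _++_; length; map; concatMap; filter; tabulate; allFin)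
  open import Data.List.Properties using (map-∘; map-++; map-tabulate; length-tabulate; tabulate-cong)
  open import Data.List.Membership.Propositional.Properties using (∈-map⁻)
  open import Data.List.Relation.Unary.All as All using (All; []; _∷_)
  open import Data.Maybe.Base using (just)
  open import Data.Nat.Base as ℕ using (ℕ; zero; suc; _!; NonZero; z≤n; s≤s)
  open import Data.Nat.ListAction using (sum)
  import Data.Nat.Properties as ℕ
  open import Data.Nat.Tactic.RingSolver using (solve-∀)
  open import Data.Product.Base using (_,_; _×_)
  open import Data.Rational.Base hiding (NonZero)
  open import Data.Rational.Properties hiding (_<?_; _≤?_)
  open import Data.Rational.Solver
  open import Data.Sum.Base using (inj₁; inj₂)
  open import Data.Vec.Base as Vec using (toList; replicate)
  import Data.Vec.Properties as Vec
  open import Data.Vec.Functional using (Vector)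
  open import Function.Base using (_∘_; id)
  open import Level using (0ℓ)
  open import Relation.Binary.Bundles using (StrictTotalOrder)
  open import Relation.Binary.Definitions using (tri<; tri≈; tri>)
  open import Relation.Binary.PropositionalEquality
  open import Relation.Nullary.Decidable using (Dec; does; yes; no; dec-true; dec-false)
  open Buffers
  open Machines
  open Programs
  open Rationals
  open Survival
  open Counting
  open Failures
  open Decay
  open Bounds
  open +-*-Solver using (solve; _:+_; _:*_; _:-_; :-_; _:=_; con)

  module _ {A B : Set} (f : A → B) where

    insertions-map : ∀ x ys → insertions (f x) (map f ys) ≡ map (map f) (insertions x ys)
    insertions-map x []       = refl
    insertions-map x (y ∷ ys) = cong ((f x ∷ f y ∷ map f ys) ∷_) (begin
      map (f y ∷_) (insertions (f x) (map f ys))   ≡⟨ cong (map (f y ∷_)) (insertions-map x ys) ⟩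
      map (f y ∷_) (map (map f) (insertions x ys)) ≡⟨ map-∘ (insertions x ys) ⟨
      map (λ zs → f y ∷ map f zs) (insertions x ys) ≡⟨ map-∘ (insertions x ys) ⟩
      map (map f) (map (y ∷_) (insertions x ys))   ∎)
      where open ≡-Reasoning

    concatMap-insertions-map : ∀ x yss →
      concatMap (insertions (f x)) (map (map f) yss) ≡ map (map f) (concatMap (insertions x) yss)
    concatMap-insertions-map x []         = refl
    concatMap-insertions-map x (ys ∷ yss) = trans
      (cong₂ _++_ (insertions-map x ys) (concatMap-insertions-map x yss))
      (sym (map-++ (map f) (insertions x ys) (concatMap (insertions x) yss)))

    -- `orderings` never inspects its elements, so an average over orders of the stream becomes one
    -- over orders of indices, where the model lives.
    orderings-map : ∀ xs → orderings (map f xs) ≡ map (map f) (orderings xs)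
    orderings-map []       = refl
    orderings-map (x ∷ xs) = trans (cong (concatMap (insertions (f x))) (orderings-map xs))
      (concatMap-insertions-map x (orderings xs))

  count-below : ∀ {n} K → K ℕ.≤ n → sum (tabulate {n = n} λ j → indicator (toℕ j ℕ.<ᵇ K)) ≡ K
  count-below {n} K K≤n = subst (λ n → sum (tabulate {n = n} λ j → indicator (toℕ j ℕ.<ᵇ K)) ≡ K)
    (ℕ.m+[n∸m]≡n K≤n)
    (trans (sum-threshold K (n ℕ.∸ K) indicator)
      (trans (cong₂ ℕ._+_ (ℕ.*-identityʳ K) (ℕ.*-zeroʳ (n ℕ.∸ K))) (ℕ.+-identityʳ K)))

  weight-tabulate : ∀ {A : Set} {n} (f : A → ℕ) (g : Fin n → A) → weight f (tabulate g) ≡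
    sum (tabulate (f ∘ g))
  weight-tabulate f g = cong sum (map-tabulate g f)

  length-filter : ∀ {A : Set} {P : A → Set} (P? : ∀ x → Dec (P x)) xs →
    length (filter P? xs) ≡ weight (λ x → indicator (does (P? x))) xs
  length-filter P? []       = refl
  length-filter P? (x ∷ xs) with does (P? x)
  ... | true  = cong suc (length-filter P? xs)
  ... | false = length-filter P? xs

  module Ranks (O : StrictTotalOrder 0ℓ 0ℓ 0ℓ) {n : ℕ} (x : Vector (StrictTotalOrder.Carrier O) n)
               (decreasing : Quantile.Decreasing O x) where

    open StrictTotalOrder O using (_<?_; module Eq; irrefl; asym) renaming (_<_ to _≺_)
    open import Relation.Binary.Properties.StrictTotalOrder O using (_≤?_)
    open Quantile O x

    order : ∀ i j → does (x i <? x j) ≡ (toℕ j ℕ.<ᵇ toℕ i)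
    order i j with Fin.<-cmp j i
    ... | tri< j<i _ _ = trans (dec-true (x i <? x j) (decreasing j<i))
      (sym (dec-true (toℕ j ℕ.<? toℕ i) j<i))
    ... | tri≈ _ refl _ = trans (dec-false (x i <? x i) (irrefl Eq.refl))
      (sym (dec-false (toℕ i ℕ.<? toℕ i) (ℕ.n≮n _)))
    ... | tri> j≮i _ i<j = trans (dec-false (x i <? x j) (asym (decreasing i<j)))
      (sym (dec-false (toℕ j ℕ.<? toℕ i) j≮i))

    order-≤ : ∀ i j → does (x i ≤? x j) ≡ (toℕ j ℕ.<ᵇ suc (toℕ i))
    order-≤ i j with Fin.<-cmp j i
    ... | tri< j<i _ _ = trans (dec-true (x i ≤? x j) (inj₁ (decreasing j<i)))
      (sym (dec-true (toℕ j ℕ.<? suc (toℕ i)) (ℕ.m<n⇒m<1+n j<i)))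
    ... | tri≈ _ refl _ = trans (dec-true (x i ≤? x i) (inj₂ Eq.refl))
      (sym (dec-true (toℕ i ℕ.<? suc (toℕ i)) (ℕ.n<1+n _)))
    ... | tri> _ _ i<j = trans (dec-false (x i ≤? x j) λ
            { (inj₁ l) → asym l (decreasing i<j) ; (inj₂ e) → irrefl (Eq.sym e) (decreasing i<j) })
          (sym (dec-false (toℕ j ℕ.<? suc (toℕ i)) (ℕ.≤⇒≯ i<j)))

    rank : ∀ i → Rank (x i) ≡ suc (toℕ i)
    rank i = begin
      length (filter (x i ≤?_) (tabulate x))
        ≡⟨ length-filter (x i ≤?_) (tabulate x) ⟩
      weight (λ y → indicator (does (x i ≤? y))) (tabulate x)     ≡⟨ weight-tabulate _ x ⟩
      sum (tabulate {n = n} λ j → indicator (does (x i ≤? x j)))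
        ≡⟨ cong sum (tabulate-cong {n = n} λ j → cong indicator (order-≤ i j)) ⟩
      sum (tabulate {n = n} λ j → indicator (toℕ j ℕ.<ᵇ suc (toℕ i)))
        ≡⟨ count-below {n} (suc (toℕ i)) (Fin.toℕ<n i) ⟩
      suc (toℕ i)                                                 ∎
      where open ≡-Reasoning

    zeroError-rank : ∀ (κ i : Fin n) → zeroError (suc (toℕ κ)) (just (x i)) ≡ (toℕ i ℕ.≡ᵇ toℕ κ)
    zeroError-rank κ i = trans (cong (λ r → does (ℕ.∣ r - suc (toℕ κ) ∣ ℕ.≟ 0)) (rank i))
      (go (toℕ i) (toℕ κ))
      where
      go : ∀ a b → (ℕ.∣ a - b ∣ ℕ.≡ᵇ 0) ≡ (a ℕ.≡ᵇ b)
      go zero    zero    = refl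
      go zero    (suc b) = refl
      go (suc a) zero    = refl
      go (suc a) (suc b) = go a b

  -- Success probabilities `f` and failure counts `g` out of c outcomes are related by addition,
  -- which spares a subtraction in ℕ and passes through sums.
  sumℚ-tabulate-complement : ∀ {n} (f : Fin n → ℚ) (g : Fin n → ℕ) c →
    (∀ j → f j * ι c + ι (g j) ≡ ι c) → sumℚ (tabulate f) * ι c + ι (sum (tabulate g)) ≡ ι (n ℕ.* c)
  sumℚ-tabulate-complement {zero}  f g c e = trans (+-identityʳ _) (*-zeroˡ (ι c))
  sumℚ-tabulate-complement {suc n} f g c e = begin
    (f zero + F) * ι c + ι (g zero ℕ.+ G)
      ≡⟨ cong (λ z → (f zero + F) * ι c + z) (ι-+ (g zero) G) ⟩
    (f zero + F) * ι c + (ι (g zero) + ι G)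
      ≡⟨ solve 5 (λ p q c a b → (p :+ q) :* c :+ (a :+ b) := (p :* c :+ a) :+ (q :* c :+ b))
                                                        refl (f zero) F (ι c) (ι (g zero)) (ι G) ⟩
    (f zero * ι c + ι (g zero)) + (F * ι c + ι G)
      ≡⟨ cong₂ _+_ (e zero) (sumℚ-tabulate-complement (f ∘ suc) (g ∘ suc) c (e ∘ suc)) ⟩
    ι c + ι (n ℕ.* c)                              ≡⟨ ι-+ c (n ℕ.* c) ⟨
    ι (c ℕ.+ n ℕ.* c)                              ∎
    where
    open ≡-Reasoning
    F = sumℚ (tabulate (f ∘ suc))
    G = sum (tabulate (g ∘ suc))

  sumℚ-complement : ∀ {A : Set} (f : A → ℚ) (g : A → ℕ) c {xs} →
    All (λ x → f x * ι c + ι (g x) ≡ ι c) xs → sumℚ (map f xs) * ι c + ι (weight g xs) ≡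
      ι (length xs ℕ.* c)
  sumℚ-complement f g c []                 = trans (+-identityʳ _) (*-zeroˡ (ι c))
  sumℚ-complement f g c {x ∷ xs} (e ∷ es) = begin
    (f x + F) * ι c + ι (g x ℕ.+ G)          ≡⟨ cong (λ z → (f x + F) * ι c + z) (ι-+ (g x) G) ⟩
    (f x + F) * ι c + (ι (g x) + ι G)
      ≡⟨ solve 5 (λ p q c a b → (p :+ q) :* c :+ (a :+ b) := (p :* c :+ a) :+ (q :* c :+ b))
                                                  refl (f x) F (ι c) (ι (g x)) (ι G) ⟩
    (f x * ι c + ι (g x)) + (F * ι c + ι G)  ≡⟨ cong₂ _+_ e (sumℚ-complement f g c es) ⟩
    ι c + ι (length xs ℕ.* c)                ≡⟨ ι-+ c (length xs ℕ.* c) ⟨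
    ι (c ℕ.+ length xs ℕ.* c)                ∎
    where
    open ≡-Reasoning
    F = sumℚ (map f xs)
    G = weight g xs

  module Probability {n : ℕ} (D : ℕ) (κ : Fin n) where

    open Model D κ
    open Correctness D κ
    open Failure D κ

    Pr-simulate : ∀ s is → Pr isTarget (simulate s is) * ι (length is !) + ι (misses s is) ≡
      ι (length is !)
    Pr-simulate s [] with isTarget (result s)
    ... | true  = refl
    ... | false = refl
    Pr-simulate s (i ∷ is) = begin
      S * r * ι (N ℕ.* c) + ι M                    ≡⟨ cong (λ z → S * r * z + ι M) (ι-* N c) ⟩
      S * r * (ι N * ι c) + ι M
        ≡⟨ cong (λ z → z + ι M) (solve 4 (λ s r n c → s :* r :* (n :* c) := (r :* n) :* (s :* c)) refl S
          r (ι N) (ι c)) ⟩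
      r * ι N * (S * ι c) + ι M                    ≡⟨ cong (λ z → z * (S * ι c) + ι M) (/-cancel 1 N) ⟩
      1ℚ * (S * ι c) + ι M                         ≡⟨ cong (λ z → z + ι M) (*-identityˡ (S * ι c)) ⟩
      S * ι c + ι M
        ≡⟨ sumℚ-tabulate-complement {N} (λ j → Pr isTarget (simulate (s′ j) is)) (λ j →
          misses (s′ j) is) c
                                                        (λ j → Pr-simulate (s′ j) is) ⟩
      ι (N ℕ.* c)                                  ∎
      where
      open ≡-Reasoning
      N = suc (length is)
      c = length is !
      r = + 1 / N
      s′ : Fin N → State
      s′ j = next s i (toℕ j ℕ.<ᵇ State.picks s)
      S = sumℚ (tabulate {n = N} λ j → Pr isTarget (simulate (next s i (toℕ j ℕ.<ᵇ State.picks s)) is))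
      M = misses s (i ∷ is)

    initialState : State
    initialState = state 0 (suc (toℕ κ)) []

    initial-good : Good initialState (allFin n)
    initial-good = good
      (trans (weight-tabulate {n = n} (λ i → indicator (isTop i)) id)
        (trans (count-below {n} (suc (toℕ κ)) (Fin.toℕ<n κ)) (sym (ℕ.+-identityʳ _))))
      (trans (weight-tabulate {n = n} (λ i → indicator (isTarget i)) id) (count-target κ))
      where
      sum-zero : ∀ n → sum (tabulate {n = n} λ _ → 0) ≡ 0
      sum-zero n = trans (sum-tabulate-const n 0) (ℕ.*-zeroʳ n)
      count-target : ∀ {n} (κ : Fin n) → sum (tabulate {n = n} λ j → indicator (toℕ j ℕ.≡ᵇ toℕ κ)) ≡ 1
      count-target {suc n} zero    = cong suc (sum-zero n)
      count-target {suc n} (suc κ) = count-target κ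

    totalMisses-initial : ∀ l → suc (toℕ κ) ℕ.+ l ≡ n →
      totalMisses initialState (allFin n) ℕ.≤ potential (suc D) n (suc (toℕ κ)) l (suc (toℕ κ)) l
    totalMisses-initial l e = subst₂ (λ a b → totalMisses initialState (allFin n) ℕ.≤
      potential (suc D) n a b (suc (toℕ κ)) l)
      tops≡ others≡
      (totalMisses≤potential n (allFin n) initialState l (length-tabulate id) e
        (ℕ.≤-trans (ℕ.≤-reflexive tops≡) (ℕ.m≤m+n _ (suc D))) (ℕ.≤-trans (ℕ.≤-reflexive (sym tops≡))
          (ℕ.m≤m+n _ (suc D)))
        λ _ _ → initial-good)
      where
      tops≡ : tops (allFin n) ≡ suc (toℕ κ)
      tops≡ = trans (Good.position initial-good) (ℕ.+-identityʳ _)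
      others≡ : others (allFin n) ≡ l
      others≡ = ℕ.+-cancelˡ-≡ (tops (allFin n)) _ _
        (trans (trans (tops+others (allFin n)) (length-tabulate id)) (trans (sym e) (cong (ℕ._+ l)
          (sym tops≡))))

  wordBound-large : ∀ d n → 1 ℕ.≤ n → n ℕ.+ d ℕ.≤ wordBound d n
  wordBound-large d n 1≤n = begin
    n ℕ.+ d             ≡⟨ cong (n ℕ.+_) (ℕ.*-identityʳ d) ⟨
    n ℕ.+ d ℕ.* 1       ≤⟨ ℕ.+-monoʳ-≤ n (ℕ.*-monoʳ-≤ d 1≤n) ⟩
    suc d ℕ.* n
      ≤⟨ ℕ.*-monoʳ-≤ (suc d) (ℕ.m≤m*n n (n ℕ.^ d) {{ℕ.m^n≢0 n d {{ℕ.>-nonZero 1≤n}}}}) ⟩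
    wordBound d n       ∎
    where open ℕ.≤-Reasoning

  -- Eight registers, two of which are the input words, and 2 D + 1 words of buffer.
  bufferAlgorithm : ℕ → Algorithm
  bufferAlgorithm D = record { spare = 6 ℕ.+ suc (2 ℕ.* D) ; code = program D }

  module Analysis (d : ℕ) (60≤d : 60 ℕ.≤ d) {n : ℕ} (D : ℕ) (κ : Fin n)
                  (O : StrictTotalOrder 0ℓ 0ℓ 0ℓ) (x : Vector (StrictTotalOrder.Carrier O) n)
                  (decreasing : Quantile.Decreasing O x) where

    open Quantile O x
    open Ranks O x decreasing
    open Model D κ
    open Correctness D κ
    open Failure D κ
    open Probability D κ

    private
      k T W : ℕ
      k = suc (toℕ κ)
      T = 2 ℕ.+ time D n
      W = wordBound d n
      1≤n : 1 ℕ.≤ n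
      1≤n = ℕ.≤-trans (s≤s z≤n) (Fin.toℕ<n κ)

    open Machine O W using (run; initial; int)
    module S = Simulation O W D (8 ℕ.+ suc (2 ℕ.* D)) x κ
      (ℕ.≤-trans (ℕ.+-monoʳ-≤ n 60≤d) (wordBound-large d n 1≤n)) order
    open Execution O W {8 ℕ.+ suc (2 ℕ.* D)} (program D) x

    runs : ∀ is → length is ≡ n → Runs T (initial (bufferAlgorithm D) n k (map x is))
      (simulate initialState is)
    runs is e = subst (λ N → RunsFrom (2 ℕ.+ time D N) 0
          (S.registers N k 0 0 0 (int (+ 0)) (int (+ 0)) (int (+ 0)) (toList (replicate (suc (2 ℕ.* D))
            (int (+ 0)))))
          (map x is) (simulate initialState is)) e
        (S.run-simulates is (toList (replicate (suc (2 ℕ.* D)) (int (+ 0)))) (ℕ.≤-reflexive e)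
          (ℕ.≤-trans 1≤n (ℕ.≤-reflexive (sym e))) (Fin.toℕ<n κ)
          (Vec.length-toList (replicate (suc (2 ℕ.* D)) (int (+ 0))))) _ refl

    orderings-x : orderings (tabulate x) ≡ map (map x) (orderings (allFin n))
    orderings-x = trans (cong orderings (sym (map-tabulate id x))) (orderings-map x (allFin n))

    lengths : All (λ is → length is ≡ n) (orderings (allFin n))
    lengths = All.map (λ e → trans e (length-tabulate id)) (orderings-lengths (allFin n))

    successProbability : ℚ
    successProbability = zeroErrorProbability d (bufferAlgorithm D) T k

    private
      M : ℕ
      M = totalMisses initialState (allFin n)

    outputs : OutputsElement d (bufferAlgorithm D) T k
    outputs σ σ∈ rewrite orderings-x with ∈-map⁻ (map x) σ∈
    ... | is , is∈ , refl = runs-surely (runs is (All.lookup lengths is∈))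

    probability : successProbability * ι (n ! ℕ.* n !) + ι M ≡ ι (n ! ℕ.* n !)
    probability = begin
      Σ * r * ι (n ! ℕ.* n !) + ι M      ≡⟨ cong (λ z → Σ * r * z + ι M) (ι-* (n !) (n !)) ⟩
      Σ * r * (ι (n !) * ι (n !)) + ι M
        ≡⟨ cong (λ z → z + ι M) (solve 3 (λ s r c → s :* r :* (c :* c) := (r :* c) :* (s :* c)) refl Σ r
          (ι (n !))) ⟩
      r * ι (n !) * (Σ * ι (n !)) + ι M
        ≡⟨ cong (λ z → z * (Σ * ι (n !)) + ι M) (/-cancel 1 (n !) {{n ℕ.!≢0}}) ⟩
      1ℚ * (Σ * ι (n !)) + ι M           ≡⟨ cong (λ z → z + ι M) (*-identityˡ (Σ * ι (n !))) ⟩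
      Σ * ι (n !) + ι M                  ≡⟨ cong (λ z → z * ι (n !) + ι M) Σ≡ ⟩
      sumℚ (map f (orderings (allFin n))) * ι (n !) + ι M
                                         ≡⟨ sumℚ-complement f (misses initialState) (n !)
                                           (All.map (λ {is} → complement is) lengths) ⟩
      ι (length (orderings (allFin n)) ℕ.* n !)
                                         ≡⟨ cong (λ c → ι (c ℕ.* n !))
                                           (trans (length-orderings (allFin n))
                                             (cong _! (length-tabulate {n = n} id))) ⟩
      ι (n ! ℕ.* n !)                    ∎
      where
      open ≡-Reasoning
      r = (+ 1 / (n !)) {{n ℕ.!≢0}}
      g : List (StrictTotalOrder.Carrier O) → ℚ
      g σ = Pr (zeroError k) (run (bufferAlgorithm D) T n k σ)
      Σ = sumℚ (map g (orderings (tabulate x)))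
      f : List (Fin n) → ℚ
      f is = g (map x is)

      Σ≡ : Σ ≡ sumℚ (map f (orderings (allFin n)))
      Σ≡ = trans (cong (λ os → sumℚ (map g os)) orderings-x)
        (cong sumℚ (sym (map-∘ (orderings (allFin n)))))

      complement : ∀ is → length is ≡ n → f is * ι (n !) + ι (misses initialState is) ≡ ι (n !)
      complement is e = trans
        (cong (λ p → p * ι (n !) + ι (misses initialState is)) (runs-Pr {E = zeroError k} {F =
          isTarget} (zeroError-rank κ) (runs is e)))
        (subst (λ N → Pr isTarget (simulate initialState is) * ι (N !) + ι (misses initialState is) ≡
          ι (N !)) e
          (Pr-simulate initialState is))

    private
      instance
        n!²≢0 : NonZero (n ! ℕ.* n !)
        n!²≢0 = ℕ.m*n≢0 (n !) (n !) {{n ℕ.!≢0}} {{n ℕ.!≢0}}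
      l : ℕ
      l = n ℕ.∸ k
      k+l≡n : k ℕ.+ l ≡ n
      k+l≡n = ℕ.m+[n∸m]≡n (Fin.toℕ<n κ)

    probability-one : k ℕ.< suc D → 1ℚ ≤ successProbability
    probability-one k<δ = *-cancelʳ-≤-pos (ι (n ! ℕ.* n !)) {{positive (0<ι (n ! ℕ.* n !))}}
      (≤-reflexive (begin
      1ℚ * ι (n ! ℕ.* n !)         ≡⟨ *-identityˡ _ ⟩
      ι (n ! ℕ.* n !)              ≡⟨ probability ⟨
      successProbability * ι (n ! ℕ.* n !) + ι M
        ≡⟨ cong (λ m → successProbability * ι (n ! ℕ.* n !) + ι m) M≡0 ⟩
      successProbability * ι (n ! ℕ.* n !) + ι 0    ≡⟨ +-identityʳ _ ⟩
      successProbability * ι (n ! ℕ.* n !)          ∎))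
      where
      open ≡-Reasoning
      M≡0 : M ≡ 0
      M≡0 = ℕ.n≤0⇒n≡0 (ℕ.≤-trans (totalMisses-initial l k+l≡n)
        (ℕ.≤-reflexive (subst (λ N → potential (suc D) N k l k l ≡ 0) k+l≡n (potential-zero k l k<δ))))

    -- `potential-decay` divided by n!² (k + m)^m bounds the share of failing outcomes.
    probability-ratio : ∀ m → suc D ≡ m ℕ.+ m → 1ℚ - ι 2 * ratio k m ^ m ≤ successProbability
    probability-ratio m δ≡ = *-cancelʳ-≤-pos c {{positive (0<ι (n ! ℕ.* n !))}} (begin
      (1ℚ - ι 2 * p) * c
        ≡⟨ trans (*-distribʳ-+ c 1ℚ (- (ι 2 * p))) (cong₂ _+_ (*-identityˡ c)
          (sym (neg-distribˡ-* (ι 2 * p) c))) ⟩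
      c - ι 2 * p * c           ≤⟨ +-monoʳ-≤ c (neg-antimono-≤ few) ⟩
      c - ι M                   ≡⟨ cong (λ z → z - ι M) probability ⟨
      successProbability * c + ι M - ι M
        ≡⟨ solve 2 (λ a b → a :+ b :- b := a) refl (successProbability * c) (ι M) ⟩
      successProbability * c                     ∎)
      where
      open ≤-Reasoning
      instance
        k+m≢0 : NonZero (k ℕ.+ m)
        k+m≢0 = _
      c = ι (n ! ℕ.* n !)
      p = ratio k m ^ m
      K = (k ℕ.+ m) ℕ.^ m

      misses-decay : M ℕ.* K ℕ.≤ 2 ℕ.* (n ! ℕ.* n !) ℕ.* k ℕ.^ m
      misses-decay = ℕ.≤-trans (ℕ.*-monoˡ-≤ K (totalMisses-initial l k+l≡n))
        (subst₂ (λ N δ → potential δ N k l k l ℕ.* K ℕ.≤ 2 ℕ.* (N ! ℕ.* N !) ℕ.* k ℕ.^ m) k+l≡n (sym δ≡)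
          (potential-decay k l m))

      p-cancel : p * ι K ≡ ι (k ℕ.^ m)
      p-cancel = trans (cong (λ z → p * z) (ι-^ (k ℕ.+ m) m))
        (trans (sym (*-^ (ratio k m) (ι (k ℕ.+ m)) m))
        (trans (cong (_^ m) (/-cancel k (k ℕ.+ m))) (sym (ι-^ k m))))

      few : ι M ≤ ι 2 * p * c
      few = *-cancelʳ-≤-pos (ι K) {{positive (0<ι K {{ℕ.m^n≢0 (k ℕ.+ m) m}})}} (begin
        ι M * ι K                                 ≡⟨ ι-* M K ⟨
        ι (M ℕ.* K)                               ≤⟨ ι-mono misses-decay ⟩
        ι (2 ℕ.* (n ! ℕ.* n !) ℕ.* k ℕ.^ m)
          ≡⟨ trans (ι-* (2 ℕ.* (n ! ℕ.* n !)) (k ℕ.^ m)) (cong₂ _*_ (ι-* 2 (n ! ℕ.* n !))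
            (sym p-cancel)) ⟩
        ι 2 * c * (p * ι K)
          ≡⟨ solve 4 (λ t c p k → t :* c :* (p :* k) := t :* p :* c :* k) refl (ι 2) c p (ι K) ⟩
        ι 2 * p * c * ι K                         ∎)

  -- Failures require counts that differ by slack m + 1 = 2 m.
  slack : ℕ → ℕ
  slack m = ℕ.pred (2 ℕ.* m)

  suc-slack : ∀ m .{{_ : NonZero m}} → suc (slack m) ≡ 2 ℕ.* m
  suc-slack (suc m) = refl

  -- With D = 2 m - 1 there are 8 + (2 D + 1) = 4 m + 7 words, and 7 ≤ 7 m.
  few-words : ∀ m .{{_ : NonZero m}} → Algorithm.words (bufferAlgorithm (slack m)) ℕ.≤ 11 ℕ.* m
  few-words (suc m) = ℕ.≤-trans (ℕ.m≤m+n _ (7 ℕ.* m)) (ℕ.≤-reflexive (l m))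
    where
    l : ∀ m → 8 ℕ.+ suc (2 ℕ.* (m ℕ.+ suc (m ℕ.+ 0))) ℕ.+ 7 ℕ.* m ≡ 11 ℕ.* suc m
    l = solve-∀

  runTime : ℕ → ℕ → ℕ
  runTime m n = 2 ℕ.+ time (slack m) n

  module _ (d : ℕ) (60≤d : 60 ℕ.≤ d) (m : ℕ) .{{_ : NonZero m}} where

    Analysed : (n k : ℕ) .{{_ : NonZero k}} → Set₁
    Analysed n k = (O : StrictTotalOrder 0ℓ 0ℓ 0ℓ) (x : Vector (StrictTotalOrder.Carrier O) n) →
      Quantile.Decreasing O x →
      Quantile.OutputsElement O x d (bufferAlgorithm (slack m)) (runTime m n) k ×
      bound m k ≤ᴿ fromℚ (Quantile.zeroErrorProbability O x d (bufferAlgorithm (slack m))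
        (runTime m n) k)

    analysis-at : ∀ {n} (κ : Fin n) → Analysed n (suc (toℕ κ))
    analysis-at κ O x decreasing = outputs , accurate
      where
      open Analysis d 60≤d (slack m) κ O x decreasing
      accurate : bound m (suc (toℕ κ)) ≤ᴿ fromℚ successProbability
      accurate with suc (toℕ κ) ℕ.<? 2 ℕ.* m
      ... | yes k<2m = bound≤1 m (suc (toℕ κ)) {successProbability}
        (probability-one (ℕ.≤-trans k<2m (ℕ.≤-reflexive (sym (suc-slack m)))))
      ... | no  k≮2m = bound≤ratio m (suc (toℕ κ)) {successProbability} (ℕ.≮⇒≥ k≮2m)
        (probability-ratio m (trans (suc-slack m) (cong (m ℕ.+_) (ℕ.+-identityʳ m))))

    analysis : ∀ n k .{{_ : NonZero k}} → k ℕ.≤ n → Analysed n k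
    analysis n (suc k) k<n =
      subst (λ k → Analysed n (suc k)) (Fin.toℕ-fromℕ< k<n) (analysis-at (fromℕ< k<n))

open import Data.Nat.Base using (ℕ; NonZero; _≤_; _*_)
open import Data.Product.Base using (∃-syntax; _×_)
open import Data.Vec.Functional using (Vector)
open import Level using (0ℓ)
open import Relation.Binary.Bundles using (StrictTotalOrder)
open import Data.Product.Base using (_,_)
import Data.Nat.Properties as ℕ
open Analyses using (bufferAlgorithm; slack; few-words; runTime; analysis)

-- Words of magnitude 61 n^61 hold n plus the program counter and the fixed addresses.
theorem3 : ∃[ C ] ∃[ d ] ((m : ℕ) .{{_ : NonZero m}} →
    ∃[ alg ] (Algorithm.words alg ≤ C * m ×
    ((n k : ℕ) .{{_ : NonZero k}} → k ≤ n →
    ∃[ T ] ((O : StrictTotalOrder 0ℓ 0ℓ 0ℓ)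
    (x : Vector (StrictTotalOrder.Carrier O) n) →
    Quantile.Decreasing O x →
    Quantile.OutputsElement O x d alg T k ×
    bound m k ≤ᴿ fromℚ (Quantile.zeroErrorProbability O x d alg T k)))))
theorem3 = 11 , 60 , λ m → bufferAlgorithm (slack m) , few-words m , λ n k k≤n →
  runTime m n , analysis 60 ℕ.≤-refl m n k k≤n
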